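{- Let $L_1,L,M,x$ be real numbers with $10<L_1<L<M/2$ and $x>L^2>M$. Let $\mathcal{N}$ be the set of odd composite integers $n\le x$ such that, writing $P=P^+(n)$ and $Q=P^+(n/P)$, we have $P\le L$, $PQ>M$ and $F(n)\ge\varphi(n)/L_1$. Then $$\sum_{n\in\mathcal{N}}F(n)\le x^2C,$$ where $$C=\frac{L^2}{2x}(1+\log L_1)+\frac{2(1+\log L_1)^2}{M\log M}+\frac{1}{12(M-2L)}(1+\log L)(4+\log L_1)^4\Big(\frac{5}{12}+(\zeta(3)-1)(1+\log L)\Big).$$
   Context: For a positive integer $n$, $F(n)=\#\{b\in(\mathbb{Z}/n\mathbb{Z})^\times : b^{n-1}=1\}$; $\varphi$ is Euler's totient function. $P^+(m)$ denotes the largest prime factor of $m>1$. $\zeta$ is the Riemann zeta function and $\log$ is the natural logarithm. -}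

module Defs where

open import Data.Nat as ℕ using (ℕ; zero; suc)
import Data.Nat.Properties as ℕ
open import Data.Integer as ℤ using (+_; +[1+_]; -[1+_]; +0)
import Data.Integer.Properties as ℤ
open import Data.Rational as ℚ using (ℚ; mkℚ; 0ℚ; 1ℚ; ½)
import Data.Rational.Properties as ℚ
import Data.Rational.Unnormalised.Base as ℚᵘ
import Data.Rational.Unnormalised.Properties as ℚᵘ
open import Data.Product using (Σ; ∃; ∃-syntax; _×_; _,_; proj₁; proj₂)
open import Data.Sum using (inj₁; inj₂)
open import Relation.Nullary using (yes; no; ¬_; contradiction)
open import Relation.Nullary.Decidable using (from-yes; True; toWitness)
open import Relation.Binary.PropositionalEquality

module Rational where

  open import Data.Rational
  open import Data.Rational.Properties
  open import Data.Rational.Solver using (module +-*-Solver)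
  open +-*-Solver
  open ≤-Reasoning
  infix 9 _⁻¹
  infixr 8 _^_

  _^_ : ℚ → ℕ → ℚ
  p ^ zero  = 1ℚ
  p ^ suc n = p * p ^ n

  -- The reciprocal made total by 0 ⁻¹ = 0, so that it can be applied to every
  -- term of a sequence of which only the tail is known to be positive.
  _⁻¹ : ℚ → ℚ
  mkℚ +0         _ _ ⁻¹ = 0ℚ
  p@(mkℚ +[1+ _ ] _ _) ⁻¹ = 1/ p
  p@(mkℚ -[1+ _ ] _ _) ⁻¹ = 1/ p

  fromℕ : ℕ → ℚ
  fromℕ n = + n / 1

  *-mono : ∀ {a b c d} → 0ℚ ≤ a → a ≤ b → 0ℚ ≤ c → c ≤ d → a * c ≤ b * d
  *-mono {a} {b} {c} {d} 0≤a a≤b 0≤c c≤d = begin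
    a * c ≤⟨ *-monoˡ-≤-nonNeg a {{nonNegative 0≤a}} c≤d ⟩
    a * d ≤⟨ *-monoʳ-≤-nonNeg d {{nonNegative (≤-trans 0≤c c≤d)}} a≤b ⟩
    b * d ∎

  *-nonneg : ∀ {a b} → 0ℚ ≤ a → 0ℚ ≤ b → 0ℚ ≤ a * b
  *-nonneg {a} {b} 0≤a 0≤b = begin
    0ℚ     ≡⟨ *-zeroˡ 0ℚ ⟨
    0ℚ * 0ℚ ≤⟨ *-mono ≤-refl 0≤a ≤-refl 0≤b ⟩
    a * b  ∎

  *-pos : ∀ {a b} → 0ℚ < a → 0ℚ < b → 0ℚ < a * b
  *-pos {a} {b} 0<a 0<b =
    positive⁻¹ (a * b) {{pos*pos⇒pos a {{positive 0<a}} b {{positive 0<b}}}}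

  +-pos : ∀ {a b} → 0ℚ < a → 0ℚ < b → 0ℚ < a + b
  +-pos {a} {b} 0<a 0<b =
    positive⁻¹ (a + b) {{pos+pos⇒pos a {{positive 0<a}} b {{positive 0<b}}}}

  0<1 : 0ℚ < 1ℚ
  0<1 = from-yes (0ℚ <? 1ℚ)

  0<½ : 0ℚ < ½
  0<½ = from-yes (0ℚ <? ½)

  a+[b-a] : ∀ a b → a + (b - a) ≡ b
  a+[b-a] = solve 2 (λ a b → a :+ (b :- a) := b) refl

  0≤b-a : ∀ {a b} → a ≤ b → 0ℚ ≤ b - a
  0≤b-a {a} {b} a≤b = begin
    0ℚ    ≡⟨ +-inverseʳ a ⟨
    a - a ≤⟨ +-monoˡ-≤ (- a) a≤b ⟩
    b - a ∎

  0≤b-a⇒a≤b : ∀ {a b} → 0ℚ ≤ b - a → a ≤ b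
  0≤b-a⇒a≤b {a} {b} h = begin
    a           ≡⟨ +-identityʳ a ⟨
    a + 0ℚ      ≤⟨ +-monoʳ-≤ a h ⟩
    a + (b - a) ≡⟨ a+[b-a] a b ⟩
    b           ∎

  p≤∣p∣ : ∀ p → p ≤ ∣ p ∣
  p≤∣p∣ p with ≤-total 0ℚ p
  ... | inj₁ 0≤p = ≤-reflexive (sym (0≤p⇒∣p∣≡p 0≤p))
  ... | inj₂ p≤0 = ≤-trans p≤0 (0≤∣p∣ p)

  ∣-∣-sym : ∀ a b → ∣ a - b ∣ ≡ ∣ b - a ∣
  ∣-∣-sym a b = trans (sym (∣-p∣≡∣p∣ (a - b)))
    (cong ∣_∣ (solve 2 (λ a b → :- (a :- b) := b :- a) refl a b))

  ∣-∣-triangle : ∀ a b c → ∣ a - c ∣ ≤ ∣ a - b ∣ + ∣ b - c ∣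
  ∣-∣-triangle a b c = begin
    ∣ a - c ∣             ≡⟨ cong ∣_∣ (solve 3 (λ a b c → a :- c := (a :- b) :+ (b :- c)) refl a b c) ⟩
    ∣ (a - b) + (b - c) ∣ ≤⟨ ∣p+q∣≤∣p∣+∣q∣ (a - b) (b - c) ⟩
    ∣ a - b ∣ + ∣ b - c ∣ ∎

  ∣a-a∣≡0 : ∀ a → ∣ a - a ∣ ≡ 0ℚ
  ∣a-a∣≡0 a = cong ∣_∣ (+-inverseʳ a)

  pow-nonneg : ∀ {p} → 0ℚ ≤ p → ∀ n → 0ℚ ≤ p ^ n
  pow-nonneg h zero    = <⇒≤ 0<1
  pow-nonneg h (suc n) = *-nonneg h (pow-nonneg h n)

  ⁻¹-inverse : ∀ {p} → 0ℚ < p → p * p ⁻¹ ≡ 1ℚ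
  ⁻¹-inverse {p@(mkℚ +[1+ _ ] _ _)} _ = *-inverseʳ p
  ⁻¹-inverse {mkℚ +0 _ _} h = contradiction (positive h) λ ()
  ⁻¹-inverse {mkℚ -[1+ _ ] _ _} h = contradiction (positive h) λ ()

  ⁻¹-pos : ∀ {p} → 0ℚ < p → 0ℚ < p ⁻¹
  ⁻¹-pos {p@(mkℚ +[1+ _ ] _ _)} _ = positive⁻¹ (p ⁻¹) {{1/pos⇒pos p}}
  ⁻¹-pos {mkℚ +0 _ _} h = contradiction (positive h) λ ()
  ⁻¹-pos {mkℚ -[1+ _ ] _ _} h = contradiction (positive h) λ ()

  ⁻¹-diff : ∀ {p q} → 0ℚ < p → 0ℚ < q → p ⁻¹ - q ⁻¹ ≡ (q - p) * (p ⁻¹ * q ⁻¹)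
  ⁻¹-diff {p} {q} 0<p 0<q = begin-equality
    p ⁻¹ - q ⁻¹
      ≡⟨ cong₂ _-_ (*-identityˡ (p ⁻¹)) (*-identityˡ (q ⁻¹)) ⟨
    1ℚ * p ⁻¹ - 1ℚ * q ⁻¹
      ≡⟨ cong₂ (λ u v → u * p ⁻¹ - v * q ⁻¹) (⁻¹-inverse 0<q) (⁻¹-inverse 0<p) ⟨
    (q * q ⁻¹) * p ⁻¹ - (p * p ⁻¹) * q ⁻¹
      ≡⟨ solve 4 (λ p q i j → (q :* j) :* i :- (p :* i) :* j := (q :- p) :* (i :* j)) refl p q (p ⁻¹) (q ⁻¹) ⟩
    (q - p) * (p ⁻¹ * q ⁻¹) ∎

  ⁻¹-antimono : ∀ {p q} → 0ℚ < p → p ≤ q → q ⁻¹ ≤ p ⁻¹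
  ⁻¹-antimono {p} {q} 0<p p≤q = 0≤b-a⇒a≤b (begin
    0ℚ                      ≤⟨ *-nonneg (0≤b-a p≤q) (*-nonneg (<⇒≤ (⁻¹-pos 0<p)) (<⇒≤ (⁻¹-pos 0<q))) ⟩
    (q - p) * (p ⁻¹ * q ⁻¹) ≡⟨ ⁻¹-diff 0<p 0<q ⟨
    p ⁻¹ - q ⁻¹             ∎)
    where 0<q = <-≤-trans 0<p p≤q

  fromℕ-suc : ∀ n → fromℕ (suc n) ≡ 1ℚ + fromℕ n
  fromℕ-suc n = toℚᵘ-injective (ℚᵘ.≃-trans (toℚᵘ-fromℚᵘ (ℚᵘ.mkℚᵘ (+ suc n) 0))
    (ℚᵘ.≃-trans eq (ℚᵘ.≃-sym (ℚᵘ.≃-trans (toℚᵘ-homo-+ 1ℚ (fromℕ n))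
      (ℚᵘ.+-congʳ ℚᵘ.1ℚᵘ (toℚᵘ-fromℚᵘ (ℚᵘ.mkℚᵘ (+ n) 0)))))))
    where
    eq : ℚᵘ.mkℚᵘ (+ suc n) 0 ℚᵘ.≃ ℚᵘ.1ℚᵘ ℚᵘ.+ ℚᵘ.mkℚᵘ (+ n) 0
    eq = ℚᵘ.*≡* (cong (ℤ._* + 1) (cong (ℤ._+_ (+ 1)) (sym (ℤ.*-identityʳ (+ n)))))

  fromℕ-pos : ∀ n → 0ℚ < fromℕ (suc n)
  fromℕ-pos n = positive⁻¹ (fromℕ (suc n)) {{normalize-pos (suc n) 1}}

  1≤fromℕ-suc : ∀ n → 1ℚ ≤ fromℕ (suc n)
  1≤fromℕ-suc n = begin
    1ℚ           ≡⟨ +-identityʳ 1ℚ ⟨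
    1ℚ + 0ℚ      ≤⟨ +-monoʳ-≤ 1ℚ (nonNegative⁻¹ (fromℕ n) {{normalize-nonNeg n 1}}) ⟩
    1ℚ + fromℕ n ≡⟨ fromℕ-suc n ⟨
    fromℕ (suc n) ∎

  fromℕ-mono : ∀ {m n} → m ℕ.≤ n → fromℕ m ≤ fromℕ n
  fromℕ-mono {n = n} ℕ.z≤n = nonNegative⁻¹ (fromℕ n) {{normalize-nonNeg n 1}}
  fromℕ-mono {suc m} {suc n} (ℕ.s≤s h) rewrite fromℕ-suc m | fromℕ-suc n =
    +-monoʳ-≤ 1ℚ (fromℕ-mono h)

  archimedean : ∀ {ε} → 0ℚ < ε → ∃[ N ] fromℕ (suc N) ⁻¹ ≤ ε
  archimedean {mkℚ +0 _ _} h = contradiction (positive h) λ ()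
  archimedean {mkℚ -[1+ _ ] _ _} h = contradiction (positive h) λ ()
  archimedean {ε@(mkℚ +[1+ a ] d _)} h = d , (begin
    f ⁻¹             ≡⟨ *-identityˡ (f ⁻¹) ⟨
    1ℚ * f ⁻¹        ≤⟨ *-monoʳ-≤-nonNeg (f ⁻¹) {{nonNegative (<⇒≤ (⁻¹-pos (fromℕ-pos d)))}} 1≤εf ⟩
    (ε * f) * f ⁻¹   ≡⟨ *-assoc ε f (f ⁻¹) ⟩
    ε * (f * f ⁻¹)   ≡⟨ cong (ε *_) (⁻¹-inverse (fromℕ-pos d)) ⟩
    ε * 1ℚ           ≡⟨ *-identityʳ ε ⟩
    ε                ∎)
    where
    f = fromℕ (suc d)
    εf : ε * f ≡ fromℕ (suc a)
    εf = toℚᵘ-injective (ℚᵘ.≃-trans (toℚᵘ-homo-* ε f)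
      (ℚᵘ.≃-trans (ℚᵘ.*-congˡ {toℚᵘ ε} (toℚᵘ-fromℚᵘ (ℚᵘ.mkℚᵘ (+ suc d) 0)))
      (ℚᵘ.≃-trans (ℚᵘ.*≡* (trans (ℤ.*-identityʳ _)
         (cong (λ k → + suc a ℤ.* + k) (sym (ℕ.*-identityʳ (suc d))))))
      (ℚᵘ.≃-sym (toℚᵘ-fromℚᵘ (ℚᵘ.mkℚᵘ (+ suc a) 0))))))
    1≤εf : 1ℚ ≤ ε * f
    1≤εf = ≤-trans (1≤fromℕ-suc a) (≤-reflexive (sym εf))

  Cauchy : (ℕ → ℚ) → Set
  Cauchy s = ∀ ε → 0ℚ < ε → ∃[ N ] ∀ m n → N ℕ.≤ m → N ℕ.≤ n → ∣ s m - s n ∣ ≤ ε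

  cauchy-scale : ∀ {s} K → 0ℚ < K →
    (∀ ε → 0ℚ < ε → ∃[ N ] ∀ m n → N ℕ.≤ m → N ℕ.≤ n → ∣ s m - s n ∣ ≤ K * ε) →
    Cauchy s
  cauchy-scale {s} K 0<K h ε 0<ε with h (K ⁻¹ * ε) (*-pos (⁻¹-pos 0<K) 0<ε)
  ... | N , c = N , λ m n N≤m N≤n → begin
    ∣ s m - s n ∣    ≤⟨ c m n N≤m N≤n ⟩
    K * (K ⁻¹ * ε)   ≡⟨ *-assoc K (K ⁻¹) ε ⟨
    (K * K ⁻¹) * ε   ≡⟨ cong (_* ε) (⁻¹-inverse 0<K) ⟩
    1ℚ * ε           ≡⟨ *-identityˡ ε ⟩
    ε                ∎

  m≤ : ∀ {m n k} → m ℕ.⊔ n ℕ.≤ k → m ℕ.≤ k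
  m≤ {m} {n} h = ℕ.≤-trans (ℕ.m≤m⊔n m n) h

  n≤ : ∀ {m n k} → m ℕ.⊔ n ℕ.≤ k → n ℕ.≤ k
  n≤ {m} {n} h = ℕ.≤-trans (ℕ.m≤n⊔m m n) h

  bounded : ∀ {s} → Cauchy s → ∃[ B ] 0ℚ < B × ∃[ N ] ∀ n → N ℕ.≤ n → ∣ s n ∣ ≤ B
  bounded {s} c with c 1ℚ 0<1
  ... | N , h = 1ℚ + ∣ s N ∣ , +-mono-<-≤ 0<1 (0≤∣p∣ (s N)) , N , λ n N≤n → begin
    ∣ s n ∣                 ≡⟨ cong ∣_∣ (solve 2 (λ a b → a := (a :- b) :+ b) refl (s n) (s N)) ⟩
    ∣ (s n - s N) + s N ∣   ≤⟨ ∣p+q∣≤∣p∣+∣q∣ (s n - s N) (s N) ⟩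
    ∣ s n - s N ∣ + ∣ s N ∣ ≤⟨ +-monoˡ-≤ ∣ s N ∣ (h n N N≤n ℕ.≤-refl) ⟩
    1ℚ + ∣ s N ∣            ∎

  cauchy-const : ∀ p → Cauchy (λ _ → p)
  cauchy-const p ε 0<ε = 0 , λ _ _ _ _ → ≤-trans (≤-reflexive (∣a-a∣≡0 p)) (<⇒≤ 0<ε)

  cauchy-+ : ∀ {s t} → Cauchy s → Cauchy t → Cauchy (λ n → s n + t n)
  cauchy-+ {s} {t} cs ct = cauchy-scale {λ n → s n + t n} (1ℚ + 1ℚ) (from-yes (0ℚ <? (1ℚ + 1ℚ))) λ ε 0<ε →
    let N , hs = cs ε 0<ε
        K , ht = ct ε 0<ε
    in N ℕ.⊔ K , λ m n hm hn → begin
      ∣ (s m + t m) - (s n + t n) ∣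
        ≡⟨ cong ∣_∣ (solve 4 (λ a b c d → (a :+ b) :- (c :+ d) := (a :- c) :+ (b :- d)) refl (s m) (t m) (s n) (t n)) ⟩
      ∣ (s m - s n) + (t m - t n) ∣ ≤⟨ ∣p+q∣≤∣p∣+∣q∣ (s m - s n) (t m - t n) ⟩
      ∣ s m - s n ∣ + ∣ t m - t n ∣ ≤⟨ +-mono-≤ (hs m n (m≤ hm) (m≤ hn)) (ht m n (n≤ {N} hm) (n≤ {N} hn)) ⟩
      ε + ε                         ≡⟨ solve 1 (λ e → e :+ e := (con 1ℚ :+ con 1ℚ) :* e) refl ε ⟩
      (1ℚ + 1ℚ) * ε                 ∎

  cauchy-neg : ∀ {s} → Cauchy s → Cauchy (λ n → - s n)
  cauchy-neg {s} cs ε 0<ε with cs ε 0<ε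
  ... | N , h = N , λ m n hm hn → begin
    ∣ - s m - - s n ∣ ≡⟨ cong ∣_∣ (solve 2 (λ a b → (:- a) :- (:- b) := b :- a) refl (s m) (s n)) ⟩
    ∣ s n - s m ∣     ≤⟨ h n m hn hm ⟩
    ε                 ∎

  cauchy-* : ∀ {s t} → Cauchy s → Cauchy t → Cauchy (λ n → s n * t n)
  cauchy-* {s} {t} cs ct =
    let A , 0<A , N₁ , hA = bounded {s} cs
        B , 0<B , N₂ , hB = bounded {t} ct
    in cauchy-scale {λ n → s n * t n} (A + B) (+-pos 0<A 0<B) λ ε 0<ε →
    let N₃ , hs = cs ε 0<ε
        N₄ , ht = ct ε 0<ε
    in (N₁ ℕ.⊔ N₂) ℕ.⊔ (N₃ ℕ.⊔ N₄) , λ m n hm hn → begin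
      ∣ s m * t m - s n * t n ∣
        ≡⟨ cong ∣_∣ (solve 4 (λ a b c d → a :* b :- c :* d := a :* (b :- d) :+ (a :- c) :* d) refl (s m) (t m) (s n) (t n)) ⟩
      ∣ s m * (t m - t n) + (s m - s n) * t n ∣
        ≤⟨ ∣p+q∣≤∣p∣+∣q∣ (s m * (t m - t n)) ((s m - s n) * t n) ⟩
      ∣ s m * (t m - t n) ∣ + ∣ (s m - s n) * t n ∣
        ≡⟨ cong₂ _+_ (∣p*q∣≡∣p∣*∣q∣ (s m) (t m - t n)) (∣p*q∣≡∣p∣*∣q∣ (s m - s n) (t n)) ⟩
      ∣ s m ∣ * ∣ t m - t n ∣ + ∣ s m - s n ∣ * ∣ t n ∣
        ≤⟨ +-mono-≤
             (*-mono (0≤∣p∣ _) (hA m (m≤ {N₁} (m≤ hm))) (0≤∣p∣ _) (ht m n (n≤ {N₃} (n≤ {N₁ ℕ.⊔ N₂} hm)) (n≤ {N₃} (n≤ {N₁ ℕ.⊔ N₂} hn))))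
             (*-mono (0≤∣p∣ _) (hs m n (m≤ {N₃} (n≤ {N₁ ℕ.⊔ N₂} hm)) (m≤ {N₃} (n≤ {N₁ ℕ.⊔ N₂} hn))) (0≤∣p∣ _) (hB n (n≤ {N₁} (m≤ hn)))) ⟩
      A * ε + ε * B
        ≡⟨ solve 3 (λ a b e → a :* e :+ e :* b := (a :+ b) :* e) refl A B ε ⟩
      (A + B) * ε ∎

  EventuallyPos : (ℕ → ℚ) → Set
  EventuallyPos s = ∃[ δ ] 0ℚ < δ × ∃[ N ] ∀ n → N ℕ.≤ n → δ ≤ s n

  cauchy-⁻¹ : ∀ {s} → Cauchy s → EventuallyPos s → Cauchy (λ n → s n ⁻¹)
  cauchy-⁻¹ {s} cs (δ , 0<δ , N₁ , hδ) = cauchy-scale {λ n → s n ⁻¹} (δ ⁻¹ * δ ⁻¹) (*-pos 0<D 0<D) λ ε 0<ε →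
    let N₂ , hs = cs ε 0<ε
    in N₁ ℕ.⊔ N₂ , λ m n hm hn →
    let δ≤m = hδ m (m≤ hm)
        δ≤n = hδ n (m≤ hn)
        0<m = <-≤-trans 0<δ δ≤m
        0<n = <-≤-trans 0<δ δ≤n
        i   = s m ⁻¹
        j   = s n ⁻¹
        0≤ij = *-nonneg (<⇒≤ (⁻¹-pos 0<m)) (<⇒≤ (⁻¹-pos 0<n))
    in begin
      ∣ i - j ∣                       ≡⟨ cong ∣_∣ (⁻¹-diff 0<m 0<n) ⟩
      ∣ (s n - s m) * (i * j) ∣       ≡⟨ ∣p*q∣≡∣p∣*∣q∣ (s n - s m) (i * j) ⟩
      ∣ s n - s m ∣ * ∣ i * j ∣       ≡⟨ cong (∣ s n - s m ∣ *_) (0≤p⇒∣p∣≡p 0≤ij) ⟩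
      ∣ s n - s m ∣ * (i * j)         ≤⟨ *-mono (0≤∣p∣ _) (hs n m (n≤ {N₁} hn) (n≤ {N₁} hm)) 0≤ij
                                           (*-mono (<⇒≤ (⁻¹-pos 0<m)) (⁻¹-antimono 0<δ δ≤m) (<⇒≤ (⁻¹-pos 0<n)) (⁻¹-antimono 0<δ δ≤n)) ⟩
      ε * (δ ⁻¹ * δ ⁻¹)               ≡⟨ *-comm ε _ ⟩
      (δ ⁻¹ * δ ⁻¹) * ε               ∎
    where 0<D = ⁻¹-pos 0<δ

  -- The left-endpoint Riemann sum of ∫ₐᵇ dt/t over 2 ^ k equal subintervals.
  riemann : ℕ → ℚ → ℚ → ℚ
  riemann zero    a b = (b - a) * a ⁻¹
  riemann (suc k) a b = riemann k a (½ * (a + b)) + riemann k (½ * (a + b)) b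

  mid≥ : ∀ {a b δ} → δ ≤ a → δ ≤ b → δ ≤ ½ * (a + b)
  mid≥ {a} {b} {δ} δ≤a δ≤b = begin
    δ           ≡⟨ solve 1 (λ d → d := con ½ :* (d :+ d)) refl δ ⟩
    ½ * (δ + δ) ≤⟨ *-monoˡ-≤-nonNeg ½ (+-mono-≤ δ≤a δ≤b) ⟩
    ½ * (a + b) ∎

  mid≤ : ∀ {a b u} → a ≤ u → b ≤ u → ½ * (a + b) ≤ u
  mid≤ {a} {b} {u} a≤u b≤u = begin
    ½ * (a + b) ≤⟨ *-monoˡ-≤-nonNeg ½ (+-mono-≤ a≤u b≤u) ⟩
    ½ * (u + u) ≡⟨ solve 1 (λ d → con ½ :* (d :+ d) := d) refl u ⟩
    u           ∎

  0≤p*p : ∀ p → 0ℚ ≤ p * p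
  0≤p*p p with ≤-total 0ℚ p
  ... | inj₁ 0≤p = *-nonneg 0≤p 0≤p
  ... | inj₂ p≤0 = begin
    0ℚ          ≤⟨ *-nonneg (neg-antimono-≤ p≤0) (neg-antimono-≤ p≤0) ⟩
    - p * - p   ≡⟨ solve 1 (λ p → (:- p) :* (:- p) := p :* p) refl p ⟩
    p * p       ∎

  riemann-refine : ∀ {δ} → 0ℚ < δ → ∀ k {a b} → δ ≤ a → δ ≤ b →
    ∣ riemann (suc k) a b - riemann k a b ∣ ≤ ((b - a) * (b - a)) * (δ ⁻¹ * δ ⁻¹) * ½ ^ k
  riemann-refine {δ} 0<δ zero {a} {b} δ≤a δ≤b = begin
    ∣ ((c - a) * i + (b - c) * j) - (b - a) * i ∣
      ≡⟨ cong ∣_∣ (solve 5 (λ a b c i j → ((c :- a) :* i :+ (b :- c) :* j) :- (b :- a) :* i := (b :- c) :* (j :- i)) refl a b c i j) ⟩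
    ∣ (b - c) * (j - i) ∣
      ≡⟨ cong (λ u → ∣ (b - c) * u ∣) (⁻¹-diff 0<c 0<a) ⟩
    ∣ (b - c) * ((a - c) * (j * i)) ∣
      ≡⟨ cong ∣_∣ (solve 4 (λ a b i j → (b :- con ½ :* (a :+ b)) :* ((a :- con ½ :* (a :+ b)) :* (j :* i))
                         := :- ((con ½ :* con ½) :* (((b :- a) :* (b :- a)) :* (i :* j)))) refl a b i j) ⟩
    ∣ - ((½ * ½) * (w * (i * j))) ∣
      ≡⟨ ∣-p∣≡∣p∣ ((½ * ½) * (w * (i * j))) ⟩
    ∣ (½ * ½) * (w * (i * j)) ∣
      ≡⟨ 0≤p⇒∣p∣≡p (*-nonneg (<⇒≤ (*-pos 0<½ 0<½)) 0≤wij) ⟩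
    (½ * ½) * (w * (i * j))
      ≤⟨ *-mono (<⇒≤ (*-pos 0<½ 0<½)) (from-yes ((½ * ½) ≤? 1ℚ)) 0≤wij
           (*-mono (0≤p*p (b - a)) ≤-refl 0≤ij (*-mono 0≤i (⁻¹-antimono 0<δ δ≤a) 0≤j (⁻¹-antimono 0<δ δ≤c))) ⟩
    1ℚ * (w * (δ ⁻¹ * δ ⁻¹))
      ≡⟨ *-comm 1ℚ (w * (δ ⁻¹ * δ ⁻¹)) ⟩
    w * (δ ⁻¹ * δ ⁻¹) * 1ℚ ∎
    where
    c = ½ * (a + b)
    i = a ⁻¹
    j = c ⁻¹
    w = (b - a) * (b - a)
    δ≤c = mid≥ δ≤a δ≤b
    0<a = <-≤-trans 0<δ δ≤a
    0<c = <-≤-trans 0<δ δ≤c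
    0≤i = <⇒≤ (⁻¹-pos 0<a)
    0≤j = <⇒≤ (⁻¹-pos 0<c)
    0≤ij = *-nonneg 0≤i 0≤j
    0≤wij = *-nonneg (0≤p*p (b - a)) 0≤ij
  riemann-refine {δ} 0<δ (suc k) {a} {b} δ≤a δ≤b = begin
    ∣ (r₁ + r₂) - (s₁ + s₂) ∣
      ≡⟨ cong ∣_∣ (solve 4 (λ a b c d → (a :+ b) :- (c :+ d) := (a :- c) :+ (b :- d)) refl r₁ r₂ s₁ s₂) ⟩
    ∣ (r₁ - s₁) + (r₂ - s₂) ∣
      ≤⟨ ∣p+q∣≤∣p∣+∣q∣ (r₁ - s₁) (r₂ - s₂) ⟩
    ∣ r₁ - s₁ ∣ + ∣ r₂ - s₂ ∣
      ≤⟨ +-mono-≤ (riemann-refine 0<δ k δ≤a δ≤c) (riemann-refine 0<δ k δ≤c δ≤b) ⟩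
    ((c - a) * (c - a)) * d * ½ ^ k + ((b - c) * (b - c)) * d * ½ ^ k
      ≡⟨ solve 4 (λ a b d h → let c = con ½ :* (a :+ b) in
           ((c :- a) :* (c :- a)) :* d :* h :+ ((b :- c) :* (b :- c)) :* d :* h
           := ((b :- a) :* (b :- a)) :* d :* (con ½ :* h)) refl a b d (½ ^ k) ⟩
    ((b - a) * (b - a)) * d * (½ * ½ ^ k) ∎
    where
    c = ½ * (a + b)
    d = δ ⁻¹ * δ ⁻¹
    δ≤c = mid≥ δ≤a δ≤b
    r₁ = riemann (suc k) a c
    r₂ = riemann (suc k) c b
    s₁ = riemann k a c
    s₂ = riemann k c b

  riemann-continuous : ∀ {δ ε} → 0ℚ < δ → ∀ k {a b a′ b′ η W} →
    δ ≤ a → δ ≤ b → δ ≤ a′ → δ ≤ b′ → ∣ a - a′ ∣ ≤ ε → ∣ b - b′ ∣ ≤ ε →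
    ∣ (b - a) - (b′ - a′) ∣ ≤ η → ∣ b′ - a′ ∣ ≤ W →
    ∣ riemann k a b - riemann k a′ b′ ∣ ≤ η * δ ⁻¹ + W * (ε * (δ ⁻¹ * δ ⁻¹))
  riemann-continuous {δ} {ε} 0<δ zero {a} {b} {a′} {b′} {η} {W} δ≤a δ≤b δ≤a′ δ≤b′ ha hb hη hW = begin
    ∣ (b - a) * i - (b′ - a′) * j ∣
      ≡⟨ cong ∣_∣ (solve 4 (λ u v i j → u :* i :- v :* j := (u :- v) :* i :+ v :* (i :- j)) refl (b - a) (b′ - a′) i j) ⟩
    ∣ w * i + (b′ - a′) * (i - j) ∣
      ≡⟨ cong (λ u → ∣ w * i + (b′ - a′) * u ∣) (⁻¹-diff 0<a 0<a′) ⟩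
    ∣ w * i + (b′ - a′) * ((a′ - a) * (i * j)) ∣
      ≤⟨ ∣p+q∣≤∣p∣+∣q∣ (w * i) _ ⟩
    ∣ w * i ∣ + ∣ (b′ - a′) * ((a′ - a) * (i * j)) ∣
      ≡⟨ cong₂ _+_ (trans (∣p*q∣≡∣p∣*∣q∣ w i) (cong (∣ w ∣ *_) (0≤p⇒∣p∣≡p 0≤i)))
           (trans (∣p*q∣≡∣p∣*∣q∣ (b′ - a′) _) (cong (∣ b′ - a′ ∣ *_)
             (trans (∣p*q∣≡∣p∣*∣q∣ (a′ - a) (i * j)) (cong₂ _*_ (∣-∣-sym a′ a) (0≤p⇒∣p∣≡p 0≤ij))))) ⟩
    ∣ w ∣ * i + ∣ b′ - a′ ∣ * (∣ a - a′ ∣ * (i * j))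
      ≤⟨ +-mono-≤ (*-mono (0≤∣p∣ w) hη 0≤i i≤)
           (*-mono (0≤∣p∣ (b′ - a′)) hW (*-nonneg (0≤∣p∣ (a - a′)) 0≤ij)
             (*-mono (0≤∣p∣ (a - a′)) ha 0≤ij (*-mono 0≤i i≤ 0≤j (⁻¹-antimono 0<δ δ≤a′)))) ⟩
    η * δ ⁻¹ + W * (ε * (δ ⁻¹ * δ ⁻¹)) ∎
    where
    w = (b - a) - (b′ - a′)
    i = a ⁻¹
    j = a′ ⁻¹
    0<a  = <-≤-trans 0<δ δ≤a
    0<a′ = <-≤-trans 0<δ δ≤a′
    0≤i = <⇒≤ (⁻¹-pos 0<a)
    0≤j = <⇒≤ (⁻¹-pos 0<a′)
    0≤ij = *-nonneg 0≤i 0≤j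
    i≤ = ⁻¹-antimono 0<δ δ≤a
  riemann-continuous {δ} {ε} 0<δ (suc k) {a} {b} {a′} {b′} {η} {W} δ≤a δ≤b δ≤a′ δ≤b′ ha hb hη hW = begin
    ∣ (r₁ + r₂) - (s₁ + s₂) ∣
      ≡⟨ cong ∣_∣ (solve 4 (λ a b c d → (a :+ b) :- (c :+ d) := (a :- c) :+ (b :- d)) refl r₁ r₂ s₁ s₂) ⟩
    ∣ (r₁ - s₁) + (r₂ - s₂) ∣
      ≤⟨ ∣p+q∣≤∣p∣+∣q∣ (r₁ - s₁) (r₂ - s₂) ⟩
    ∣ r₁ - s₁ ∣ + ∣ r₂ - s₂ ∣
      ≤⟨ +-mono-≤
           (riemann-continuous 0<δ k δ≤a δ≤c δ≤a′ δ≤c′ ha hc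
             (halve (solve 4 (λ a b a′ b′ → (con ½ :* (a :+ b) :- a) :- (con ½ :* (a′ :+ b′) :- a′)
                                := con ½ :* ((b :- a) :- (b′ :- a′))) refl a b a′ b′) hη)
             (halve (solve 2 (λ a b → con ½ :* (a :+ b) :- a := con ½ :* (b :- a)) refl a′ b′) hW))
           (riemann-continuous 0<δ k δ≤c δ≤b δ≤c′ δ≤b′ hc hb
             (halve (solve 4 (λ a b a′ b′ → (b :- con ½ :* (a :+ b)) :- (b′ :- con ½ :* (a′ :+ b′))
                                := con ½ :* ((b :- a) :- (b′ :- a′))) refl a b a′ b′) hη)
             (halve (solve 2 (λ a b → b :- con ½ :* (a :+ b) := con ½ :* (b :- a)) refl a′ b′) hW)) ⟩
    ((½ * η) * δ ⁻¹ + (½ * W) * e) + ((½ * η) * δ ⁻¹ + (½ * W) * e)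
      ≡⟨ solve 4 (λ n d w e → ((con ½ :* n) :* d :+ (con ½ :* w) :* e) :+ ((con ½ :* n) :* d :+ (con ½ :* w) :* e)
           := n :* d :+ w :* e) refl η (δ ⁻¹) W e ⟩
    η * δ ⁻¹ + W * e ∎
    where
    c  = ½ * (a + b)
    c′ = ½ * (a′ + b′)
    e  = ε * (δ ⁻¹ * δ ⁻¹)
    r₁ = riemann k a c
    r₂ = riemann k c b
    s₁ = riemann k a′ c′
    s₂ = riemann k c′ b′
    δ≤c  = mid≥ δ≤a δ≤b
    δ≤c′ = mid≥ δ≤a′ δ≤b′
    halve : ∀ {u v B} → u ≡ ½ * v → ∣ v ∣ ≤ B → ∣ u ∣ ≤ ½ * B
    halve {u} {v} {B} refl h = begin
      ∣ ½ * v ∣     ≡⟨ ∣p*q∣≡∣p∣*∣q∣ ½ v ⟩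
      ½ * ∣ v ∣     ≤⟨ *-monoˡ-≤-nonNeg ½ h ⟩
      ½ * B         ∎
    hc : ∣ c - c′ ∣ ≤ ε
    hc = begin
      ∣ c - c′ ∣
        ≡⟨ cong ∣_∣ (solve 4 (λ a b a′ b′ → con ½ :* (a :+ b) :- con ½ :* (a′ :+ b′)
                       := con ½ :* (a :- a′) :+ con ½ :* (b :- b′)) refl a b a′ b′) ⟩
      ∣ ½ * (a - a′) + ½ * (b - b′) ∣ ≤⟨ ∣p+q∣≤∣p∣+∣q∣ (½ * (a - a′)) (½ * (b - b′)) ⟩
      ∣ ½ * (a - a′) ∣ + ∣ ½ * (b - b′) ∣ ≤⟨ +-mono-≤ (halve refl ha) (halve refl hb) ⟩
      ½ * ε + ½ * ε ≡⟨ solve 1 (λ e → con ½ :* e :+ con ½ :* e := e) refl ε ⟩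
      ε ∎

  riemann-lower : ∀ k {a b B} → 0ℚ < a → a ≤ b → b ≤ B → (b - a) * B ⁻¹ ≤ riemann k a b
  riemann-lower zero {a} {b} {B} 0<a a≤b b≤B =
    *-monoˡ-≤-nonNeg (b - a) {{nonNegative (0≤b-a a≤b)}} (⁻¹-antimono 0<a (≤-trans a≤b b≤B))
  riemann-lower (suc k) {a} {b} {B} 0<a a≤b b≤B = begin
    (b - a) * B ⁻¹
      ≡⟨ solve 4 (λ a b c i → (b :- a) :* i := (c :- a) :* i :+ (b :- c) :* i) refl a b c (B ⁻¹) ⟩
    (c - a) * B ⁻¹ + (b - c) * B ⁻¹
      ≤⟨ +-mono-≤ (riemann-lower k 0<a a≤c (≤-trans c≤b b≤B)) (riemann-lower k (<-≤-trans 0<a a≤c) c≤b b≤B) ⟩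
    riemann k a c + riemann k c b ∎
    where
    c = ½ * (a + b)
    a≤c = mid≥ ≤-refl a≤b
    c≤b = mid≤ a≤b ≤-refl

  geometric : ∀ (f : ℕ → ℚ) {W} → (∀ k → ∣ f (suc k) - f k ∣ ≤ W * ½ ^ k) →
    ∀ k j → ∣ f (j ℕ.+ k) - f k ∣ ≤ (W + W) * (½ ^ k - ½ ^ (j ℕ.+ k))
  geometric f {W} h k zero = begin
    ∣ f k - f k ∣                 ≡⟨ ∣a-a∣≡0 (f k) ⟩
    0ℚ                            ≡⟨ solve 2 (λ w p → con 0ℚ := (w :+ w) :* (p :- p)) refl W (½ ^ k) ⟩
    (W + W) * (½ ^ k - ½ ^ k)     ∎
  geometric f {W} h k (suc j) = begin
    ∣ f (suc (j ℕ.+ k)) - f k ∣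
      ≤⟨ ∣-∣-triangle (f (suc (j ℕ.+ k))) (f (j ℕ.+ k)) (f k) ⟩
    ∣ f (suc (j ℕ.+ k)) - f (j ℕ.+ k) ∣ + ∣ f (j ℕ.+ k) - f k ∣
      ≤⟨ +-mono-≤ (h (j ℕ.+ k)) (geometric f {W} h k j) ⟩
    W * q + (W + W) * (½ ^ k - q)
      ≡⟨ solve 3 (λ w p q → w :* q :+ (w :+ w) :* (p :- q) := (w :+ w) :* (p :- con ½ :* q)) refl W (½ ^ k) q ⟩
    (W + W) * (½ ^ k - ½ * q) ∎
    where q = ½ ^ (j ℕ.+ k)

  ½^k≤ : ∀ k → ½ ^ k ≤ fromℕ (suc k) ⁻¹
  ½^k≤ k = begin
    h                  ≡⟨ *-identityʳ h ⟨
    h * 1ℚ             ≡⟨ cong (h *_) (⁻¹-inverse (fromℕ-pos k)) ⟨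
    h * (f * f ⁻¹)     ≡⟨ *-assoc h f (f ⁻¹) ⟨
    (h * f) * f ⁻¹     ≤⟨ *-monoʳ-≤-nonNeg (f ⁻¹) {{nonNegative (<⇒≤ (⁻¹-pos (fromℕ-pos k)))}} (hf≤1 k) ⟩
    1ℚ * f ⁻¹          ≡⟨ *-identityˡ (f ⁻¹) ⟩
    f ⁻¹               ∎
    where
    h = ½ ^ k
    f = fromℕ (suc k)
    hf≤1 : ∀ k → ½ ^ k * fromℕ (suc k) ≤ 1ℚ
    hf≤1 zero    = ≤-refl
    hf≤1 (suc k) = begin
      ½ ^ suc k * fromℕ (suc (suc k))  ≡⟨ cong (½ ^ suc k *_) (fromℕ-suc (suc k)) ⟩
      ½ * ½ ^ k * (1ℚ + g)             ≤⟨ *-monoˡ-≤-nonNeg (½ ^ suc k) {{nonNegative (pow-nonneg (<⇒≤ 0<½) (suc k))}} (+-monoˡ-≤ g (1≤fromℕ-suc k)) ⟩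
      ½ * ½ ^ k * (g + g)              ≡⟨ solve 2 (λ h f → con ½ :* h :* (f :+ f) := h :* f) refl (½ ^ k) g ⟩
      ½ ^ k * g                        ≤⟨ hf≤1 k ⟩
      1ℚ                               ∎
      where g = fromℕ (suc k)

  ½^-antimono : ∀ {N k} → N ℕ.≤ k → ½ ^ k ≤ fromℕ (suc N) ⁻¹
  ½^-antimono {N} {k} N≤k = ≤-trans (½^k≤ k) (⁻¹-antimono (fromℕ-pos N) (fromℕ-mono (ℕ.s≤s N≤k)))

  riemann-converges : ∀ {δ b} → 0ℚ < δ → δ ≤ 1ℚ → δ ≤ b → ∀ {k l} → k ℕ.≤ l →
    let W = ((b - 1ℚ) * (b - 1ℚ)) * (δ ⁻¹ * δ ⁻¹) in
    ∣ riemann k 1ℚ b - riemann l 1ℚ b ∣ ≤ (W + W) * ½ ^ k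
  riemann-converges {δ} {b} 0<δ δ≤1 δ≤b {k} {l} k≤l = begin
    ∣ f k - f l ∣                  ≡⟨ ∣-∣-sym (f k) (f l) ⟩
    ∣ f l - f k ∣                  ≡⟨ cong (λ l → ∣ f l - f k ∣) (ℕ.m∸n+n≡m k≤l) ⟨
    ∣ f (j ℕ.+ k) - f k ∣          ≤⟨ geometric f {W} (λ k → riemann-refine 0<δ k δ≤1 δ≤b) k j ⟩
    (W + W) * (½ ^ k - q)          ≤⟨ *-monoˡ-≤-nonNeg (W + W) {{nonNegative (+-mono-≤ 0≤W 0≤W)}} p-q≤p ⟩
    (W + W) * ½ ^ k                ∎
    where
    f = λ k → riemann k 1ℚ b
    j = l ℕ.∸ k
    q = ½ ^ (j ℕ.+ k)
    W = ((b - 1ℚ) * (b - 1ℚ)) * (δ ⁻¹ * δ ⁻¹)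
    0≤W : 0ℚ ≤ W
    0≤W = *-nonneg (0≤p*p (b - 1ℚ)) (0≤p*p (δ ⁻¹))
    p-q≤p : ½ ^ k - q ≤ ½ ^ k
    p-q≤p = ≤-trans (+-monoʳ-≤ (½ ^ k) (neg-antimono-≤ (pow-nonneg (<⇒≤ 0<½) (j ℕ.+ k))))
                    (≤-reflexive (+-identityʳ (½ ^ k)))

  cauchy-log : ∀ {s} → Cauchy s → EventuallyPos s → Cauchy (λ n → riemann n 1ℚ (s n))
  cauchy-log {s} cs (δ₀ , 0<δ₀ , N₁ , hδ) =
    let B , 0<B , N₂ , hB = bounded {λ n → s n - 1ℚ} (cauchy-+ {s} {λ _ → - 1ℚ} cs (cauchy-const (- 1ℚ)))
        V = (B * B) * (D * D)
        K = (D + B * (D * D)) + (V + V)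
        0<V = *-pos (*-pos 0<B 0<B) (*-pos 0<D 0<D)
    in cauchy-scale {λ n → riemann n 1ℚ (s n)} K (+-pos (+-pos 0<D (*-pos 0<B (*-pos 0<D 0<D))) (+-pos 0<V 0<V)) λ ε 0<ε →
    let N₃ , hs = cs ε 0<ε
        N₄ , hN = archimedean 0<ε
        N = (N₁ ℕ.⊔ N₂) ℕ.⊔ (N₃ ℕ.⊔ N₄)

        close : ∀ m n → N ℕ.≤ m → m ℕ.≤ n → ∣ riemann m 1ℚ (s m) - riemann n 1ℚ (s n) ∣ ≤ K * ε
        close m n hm m≤n =
          let hn  = ℕ.≤-trans hm m≤n
              δ≤m = ≤-trans δ≤δ₀ (hδ m (m≤ {N₁} (m≤ hm)))
              δ≤n = ≤-trans δ≤δ₀ (hδ n (m≤ {N₁} (m≤ hn)))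
              smn = hs m n (m≤ {N₃} (n≤ {N₁ ℕ.⊔ N₂} hm)) (m≤ {N₃} (n≤ {N₁ ℕ.⊔ N₂} hn))
              b   = hB n (n≤ {N₁} (m≤ hn))
              w   = s n - 1ℚ
              w²≤ : w * w ≤ B * B
              w²≤ = begin
                w * w           ≡⟨ 0≤p⇒∣p∣≡p (0≤p*p w) ⟨
                ∣ w * w ∣       ≡⟨ ∣p*q∣≡∣p∣*∣q∣ w w ⟩
                ∣ w ∣ * ∣ w ∣   ≤⟨ *-mono (0≤∣p∣ w) b (0≤∣p∣ w) b ⟩
                B * B           ∎
              W≤V : (w * w) * (D * D) ≤ V
              W≤V = *-monoʳ-≤-nonNeg (D * D) {{nonNegative (0≤p*p D)}} w²≤
              0≤W = *-nonneg (0≤p*p w) (0≤p*p D)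
          in begin
            ∣ riemann m 1ℚ (s m) - riemann n 1ℚ (s n) ∣
              ≤⟨ ∣-∣-triangle (riemann m 1ℚ (s m)) (riemann m 1ℚ (s n)) (riemann n 1ℚ (s n)) ⟩
            ∣ riemann m 1ℚ (s m) - riemann m 1ℚ (s n) ∣ + ∣ riemann m 1ℚ (s n) - riemann n 1ℚ (s n) ∣
              ≤⟨ +-mono-≤
                   (riemann-continuous 0<δ m {1ℚ} {s m} {1ℚ} {s n} δ≤1 δ≤m δ≤1 δ≤n (<⇒≤ 0<ε) smn
                     (≤-trans (≤-reflexive (cong ∣_∣ (solve 2 (λ a b → (a :- con 1ℚ) :- (b :- con 1ℚ) := a :- b) refl (s m) (s n)))) smn) b)
                   (≤-trans (riemann-converges 0<δ δ≤1 δ≤n m≤n)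
                     (*-mono (+-mono-≤ 0≤W 0≤W) (+-mono-≤ W≤V W≤V) (pow-nonneg (<⇒≤ 0<½) m)
                       (≤-trans (½^-antimono (n≤ {N₃} (n≤ {N₁ ℕ.⊔ N₂} hm))) hN))) ⟩
            (ε * D + B * (ε * (D * D))) + (V + V) * ε
              ≡⟨ solve 4 (λ e d b v → (e :* d :+ b :* (e :* (d :* d))) :+ (v :+ v) :* e
                           := ((d :+ b :* (d :* d)) :+ (v :+ v)) :* e) refl ε D B V ⟩
            K * ε ∎
    in N , λ m n hm hn → either {λ n → riemann n 1ℚ (s n)} m n hm hn close
    where
    δ = δ₀ ⊓ 1ℚ
    D = δ ⁻¹
    δ≤δ₀ : δ ≤ δ₀
    δ≤δ₀ = p⊓q≤p δ₀ 1ℚ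
    δ≤1 : δ ≤ 1ℚ
    δ≤1 = p⊓q≤q δ₀ 1ℚ
    0<δ : 0ℚ < δ
    0<δ with ⊓-sel δ₀ 1ℚ
    ... | inj₁ e = <-≤-trans 0<δ₀ (≤-reflexive (sym e))
    ... | inj₂ e = <-≤-trans 0<1 (≤-reflexive (sym e))
    0<D = ⁻¹-pos 0<δ
    either : ∀ {f : ℕ → ℚ} {N E} m n → N ℕ.≤ m → N ℕ.≤ n →
      (∀ m n → N ℕ.≤ m → m ℕ.≤ n → ∣ f m - f n ∣ ≤ E) → ∣ f m - f n ∣ ≤ E
    either {f} m n hm hn h with ℕ.≤-total m n
    ... | inj₁ m≤n = h m n hm m≤n
    ... | inj₂ n≤m = ≤-trans (≤-reflexive (∣-∣-sym (f m) (f n))) (h n m hn n≤m)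

  -- zetaSum s n = Σ_{k=1}^{n} 1/kˢ
  zetaSum : ℕ → ℕ → ℚ
  zetaSum s zero    = 0ℚ
  zetaSum s (suc n) = zetaSum s n + (fromℕ (suc n) ⁻¹) ^ s

  pow≤square : ∀ {p} → 0ℚ ≤ p → p ≤ 1ℚ → ∀ {s} → 2 ℕ.≤ s → p ^ s ≤ p * p
  pow≤square {p} 0≤p p≤1 {suc (suc s)} (ℕ.s≤s (ℕ.s≤s _)) =
    *-monoˡ-≤-nonNeg p {{nonNegative 0≤p}} (begin
      p * p ^ s ≤⟨ *-monoˡ-≤-nonNeg p {{nonNegative 0≤p}} (pow≤1 s) ⟩
      p * 1ℚ    ≡⟨ *-identityʳ p ⟩
      p         ∎)
    where
    pow≤1 : ∀ s → p ^ s ≤ 1ℚ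
    pow≤1 zero    = ≤-refl
    pow≤1 (suc s) = begin
      p * p ^ s ≤⟨ *-mono 0≤p p≤1 (pow-nonneg 0≤p s) (pow≤1 s) ⟩
      1ℚ * 1ℚ   ≡⟨ *-identityˡ 1ℚ ⟩
      1ℚ        ∎

  zetaSum-mono : ∀ s j k → zetaSum s k ≤ zetaSum s (j ℕ.+ k)
  zetaSum-mono s zero    k = ≤-refl
  zetaSum-mono s (suc j) k = begin
    zetaSum s k                ≤⟨ zetaSum-mono s j k ⟩
    zetaSum s (j ℕ.+ k)        ≡⟨ +-identityʳ (zetaSum s (j ℕ.+ k)) ⟨
    zetaSum s (j ℕ.+ k) + 0ℚ   ≤⟨ +-monoʳ-≤ (zetaSum s (j ℕ.+ k)) (pow-nonneg (<⇒≤ (⁻¹-pos (fromℕ-pos (j ℕ.+ k)))) s) ⟩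
    zetaSum s (suc (j ℕ.+ k))  ∎

  zetaSum-tail : ∀ {s} → 2 ℕ.≤ s → ∀ j k → let u = λ n → fromℕ (suc n) ⁻¹ in
    zetaSum s (j ℕ.+ suc k) - zetaSum s (suc k) ≤ u k - u (j ℕ.+ k)
  zetaSum-tail {s} 2≤s zero k =
    ≤-reflexive (trans (+-inverseʳ (zetaSum s (suc k))) (sym (+-inverseʳ (fromℕ (suc k) ⁻¹))))
  zetaSum-tail {s} 2≤s (suc j) k = begin
    (z′ + q ^ s) - z    ≡⟨ solve 3 (λ a b c → (a :+ b) :- c := (a :- c) :+ b) refl z′ (q ^ s) z ⟩
    (z′ - z) + q ^ s    ≤⟨ +-mono-≤ (zetaSum-tail 2≤s j k) q^s≤ ⟩
    (u k - p) + (p - r) ≡⟨ solve 3 (λ a b c → (a :- b) :+ (b :- c) := a :- c) refl (u k) p r ⟩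
    u k - r             ∎
    where
    u : ℕ → ℚ
    u n = fromℕ (suc n) ⁻¹
    z  = zetaSum s (suc k)
    z′ = zetaSum s (j ℕ.+ suc k)
    p  = u (j ℕ.+ k)
    q  = u (j ℕ.+ suc k)
    r  = u (suc (j ℕ.+ k))
    q≡r : q ≡ r
    q≡r = cong u (ℕ.+-suc j k)
    f = fromℕ (suc (j ℕ.+ k))
    g = fromℕ (suc (suc (j ℕ.+ k)))
    0<f = fromℕ-pos (j ℕ.+ k)
    0<g = fromℕ-pos (suc (j ℕ.+ k))
    0≤r = <⇒≤ (⁻¹-pos 0<g)
    q^s≤ : q ^ s ≤ p - r
    q^s≤ = begin
      q ^ s             ≡⟨ cong (_^ s) q≡r ⟩
      r ^ s             ≤⟨ pow≤square 0≤r (⁻¹-antimono {1ℚ} 0<1 (1≤fromℕ-suc (suc (j ℕ.+ k)))) 2≤s ⟩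
      r * r             ≤⟨ *-monoʳ-≤-nonNeg r {{nonNegative 0≤r}} (⁻¹-antimono 0<f (fromℕ-mono (ℕ.n≤1+n (suc (j ℕ.+ k))))) ⟩
      p * r             ≡⟨ *-identityˡ (p * r) ⟨
      1ℚ * (p * r)      ≡⟨ cong (_* (p * r)) (trans (cong (_- f) (fromℕ-suc (suc (j ℕ.+ k))))
                              (solve 1 (λ f → (con 1ℚ :+ f) :- f := con 1ℚ) refl f)) ⟨
      (g - f) * (p * r) ≡⟨ ⁻¹-diff 0<f 0<g ⟨
      p - r             ∎

  cauchy-zeta : ∀ {s} → 2 ℕ.≤ s → Cauchy (zetaSum s)
  cauchy-zeta {s} 2≤s = cauchy-scale {zetaSum s} (1ℚ + 1ℚ) (from-yes (0ℚ <? (1ℚ + 1ℚ))) λ ε 0<ε →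
    let N , hN = archimedean 0<ε
        near : ∀ m → suc N ℕ.≤ m → ∣ zetaSum s m - zetaSum s (suc N) ∣ ≤ ε
        near m h = begin
          ∣ zetaSum s m - z N ∣
            ≡⟨ cong (λ m → ∣ zetaSum s m - z N ∣) (ℕ.m∸n+n≡m h) ⟨
          ∣ zetaSum s (m ℕ.∸ suc N ℕ.+ suc N) - z N ∣
            ≡⟨ 0≤p⇒∣p∣≡p (0≤b-a (zetaSum-mono s (m ℕ.∸ suc N) (suc N))) ⟩
          zetaSum s (m ℕ.∸ suc N ℕ.+ suc N) - z N
            ≤⟨ zetaSum-tail 2≤s (m ℕ.∸ suc N) N ⟩
          fromℕ (suc N) ⁻¹ - fromℕ (suc (m ℕ.∸ suc N ℕ.+ N)) ⁻¹
            ≤⟨ +-monoʳ-≤ (fromℕ (suc N) ⁻¹) (neg-antimono-≤ (<⇒≤ (⁻¹-pos (fromℕ-pos (m ℕ.∸ suc N ℕ.+ N))))) ⟩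
          fromℕ (suc N) ⁻¹ + 0ℚ ≡⟨ +-identityʳ (fromℕ (suc N) ⁻¹) ⟩
          fromℕ (suc N) ⁻¹      ≤⟨ hN ⟩
          ε ∎
    in suc N , λ m n hm hn → begin
      ∣ zetaSum s m - zetaSum s n ∣ ≤⟨ ∣-∣-triangle (zetaSum s m) (z N) (zetaSum s n) ⟩
      ∣ zetaSum s m - z N ∣ + ∣ z N - zetaSum s n ∣ ≡⟨ cong (λ t → ∣ zetaSum s m - z N ∣ + t) (∣-∣-sym (z N) (zetaSum s n)) ⟩
      ∣ zetaSum s m - z N ∣ + ∣ zetaSum s n - z N ∣ ≤⟨ +-mono-≤ (near m hm) (near n hn) ⟩
      ε + ε         ≡⟨ solve 1 (λ e → e :+ e := (con 1ℚ :+ con 1ℚ) :* e) refl ε ⟩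
      (1ℚ + 1ℚ) * ε ∎
    where
    z : ℕ → ℚ
    z N = zetaSum s (suc N)

module Real where

  open Rational
    using (Cauchy; EventuallyPos; _⁻¹; riemann; zetaSum; cauchy-const; cauchy-+;
           cauchy-neg; cauchy-*; cauchy-⁻¹; cauchy-log; cauchy-zeta)
  open ℚ.≤-Reasoning
  open import Data.Rational.Solver using (module +-*-Solver)
  open +-*-Solver

  infix  9 #_
  infixr 8 _^_
  infixl 7 _*_ _/_
  infixl 6 _+_ _-_
  infix  4 _<_ _≤_

  -- Cauchy sequences of rationals.  Equality of reals, which is not needed here,
  -- would be x ≤ y together with y ≤ x.
  record ℝ : Set where
    no-eta-equality
    constructor mkℝ
    field
      seq    : ℕ → ℚ
      cauchy : Cauchy seq
  open ℝ public

  record _<_ (x y : ℝ) : Set where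
    constructor mk<
    field
      gap       : ℚ
      0<gap     : 0ℚ ℚ.< gap
      from      : ℕ
      separated : ∀ n → from ℕ.≤ n → seq x n ℚ.+ gap ℚ.≤ seq y n

  -- Equivalent to ¬ y < x.
  record _≤_ (x y : ℝ) : Set where
    constructor mk≤
    field
      approx : ∀ ε → 0ℚ ℚ.< ε → ∃[ N ] ∀ n → N ℕ.≤ n → seq x n ℚ.≤ seq y n ℚ.+ ε

  #_ : ℕ → ℝ
  seq    (# n) _ = Rational.fromℕ n
  cauchy (# n)   = cauchy-const (Rational.fromℕ n)

  _+_ _-_ _*_ : ℝ → ℝ → ℝ
  seq    (x + y) n = seq x n ℚ.+ seq y n
  cauchy (x + y)   = cauchy-+ {seq x} {seq y} (cauchy x) (cauchy y)
  seq    (x - y) n = seq x n ℚ.- seq y n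
  cauchy (x - y)   = cauchy-+ {seq x} {λ n → ℚ.- seq y n} (cauchy x) (cauchy-neg {seq y} (cauchy y))
  seq    (x * y) n = seq x n ℚ.* seq y n
  cauchy (x * y)   = cauchy-* {seq x} {seq y} (cauchy x) (cauchy y)

  _^_ : ℝ → ℕ → ℝ
  x ^ zero        = # 1
  x ^ suc zero    = x
  x ^ suc (suc n) = x * x ^ suc n

  eventuallyPos : ∀ {x} → # 0 < x → EventuallyPos (seq x)
  eventuallyPos {x} (mk< δ 0<δ N h) = δ , 0<δ , N , λ n hn →
    ℚ.≤-trans (ℚ.≤-reflexive (sym (ℚ.+-identityˡ δ))) (h n hn)

  _/_ : (x y : ℝ) {{0<y : # 0 < y}} → ℝ
  seq    (x / y) n = seq x n ℚ.* seq y n ⁻¹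
  cauchy (_/_ x y {{0<y}}) =
    cauchy-* {seq x} {λ n → seq y n ⁻¹} (cauchy x) (cauchy-⁻¹ {seq y} (cauchy y) (eventuallyPos 0<y))

  -- log x = ∫₁ˣ dt/t.  The n-th term of the sequence is the Riemann sum with 2ⁿ
  -- pieces, taken up to the n-th approximation of x.
  log : (x : ℝ) {{0<x : # 0 < x}} → ℝ
  seq    (log x) n = riemann n 1ℚ (seq x n)
  cauchy (log x {{0<x}}) = cauchy-log {seq x} (cauchy x) (eventuallyPos 0<x)

  -- The Riemann zeta function at the integers s ≥ 2.
  ζ : (s : ℕ) {2≤s : True (2 ℕ.≤? s)} → ℝ
  seq    (ζ s) = zetaSum s
  cauchy (ζ s {2≤s}) = cauchy-zeta (toWitness 2≤s)

  fromℕ-≤ : ∀ {m n} → m ℕ.≤ n → ∀ {x} → # n < x → # m < x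
  fromℕ-≤ m≤n (mk< δ 0<δ N h) = mk< δ 0<δ N λ k hk →
    ℚ.≤-trans (ℚ.+-monoˡ-≤ δ (Rational.fromℕ-mono m≤n)) (h k hk)

  <-trans : ∀ {x y z} → x < y → y < z → x < z
  <-trans {x} {y} {z} (mk< δ 0<δ N h) (mk< ε 0<ε K k) = mk< δ 0<δ (N ℕ.⊔ K) λ n hn → begin
    seq x n ℚ.+ δ ≤⟨ h n (Rational.m≤ hn) ⟩
    seq y n       ≡⟨ ℚ.+-identityʳ (seq y n) ⟨
    seq y n ℚ.+ 0ℚ ≤⟨ ℚ.+-monoʳ-≤ (seq y n) (ℚ.<⇒≤ 0<ε) ⟩
    seq y n ℚ.+ ε ≤⟨ k n (Rational.n≤ {N} hn) ⟩
    seq z n       ∎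

  #-pos : ∀ n → # 0 < # suc n
  #-pos n = mk< (Rational.fromℕ (suc n)) (Rational.fromℕ-pos n) 0 λ _ _ →
    ℚ.≤-reflexive (ℚ.+-identityˡ (Rational.fromℕ (suc n)))

  *-pos : ∀ {x y} → # 0 < x → # 0 < y → # 0 < x * y
  *-pos {x} {y} 0<x 0<y =
    let δ , 0<δ , N , h = eventuallyPos 0<x
        ε , 0<ε , K , k = eventuallyPos 0<y
    in mk< (δ ℚ.* ε) (Rational.*-pos 0<δ 0<ε) (N ℕ.⊔ K) λ n hn → begin
    0ℚ ℚ.+ δ ℚ.* ε      ≡⟨ ℚ.+-identityˡ (δ ℚ.* ε) ⟩
    δ ℚ.* ε             ≤⟨ Rational.*-mono (ℚ.<⇒≤ 0<δ) (h n (Rational.m≤ hn)) (ℚ.<⇒≤ 0<ε) (k n (Rational.n≤ {N} hn)) ⟩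
    seq x n ℚ.* seq y n ∎

  <⇒0<- : ∀ {x y} → x < y → # 0 < y - x
  <⇒0<- {x} {y} (mk< δ 0<δ N h) = mk< δ 0<δ N λ n hn → begin
    0ℚ ℚ.+ δ                    ≡⟨ solve 2 (λ d x → con 0ℚ :+ d := (x :+ d) :- x) refl δ (seq x n) ⟩
    (seq x n ℚ.+ δ) ℚ.- seq x n ≤⟨ ℚ.+-monoˡ-≤ (ℚ.- seq x n) (h n hn) ⟩
    seq y n ℚ.- seq x n         ∎

  x<2x : ∀ {x} → # 0 < x → x < # 2 * x
  x<2x {x} 0<x = let δ , 0<δ , N , h = eventuallyPos 0<x in mk< δ 0<δ N λ n hn → begin
    seq x n ℚ.+ δ       ≤⟨ ℚ.+-monoʳ-≤ (seq x n) (h n hn) ⟩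
    seq x n ℚ.+ seq x n ≡⟨ solve 1 (λ x → x :+ x := (con 1ℚ :+ con 1ℚ) :* x) refl (seq x n) ⟩
    seq (# 2 * x) n     ∎

  <half⇒2*< : ∀ {x y} → x < _/_ y (# 2) {{#-pos 1}} → # 2 * x < y
  <half⇒2*< {x} {y} (mk< δ 0<δ N h) = mk< δ 0<δ N λ n hn → begin
    two ℚ.* seq x n ℚ.+ δ           ≤⟨ ℚ.+-monoʳ-≤ (two ℚ.* seq x n) δ≤2δ ⟩
    two ℚ.* seq x n ℚ.+ two ℚ.* δ   ≡⟨ ℚ.*-distribˡ-+ two (seq x n) δ ⟨
    two ℚ.* (seq x n ℚ.+ δ)         ≤⟨ ℚ.*-monoˡ-≤-nonNeg two (h n hn) ⟩
    two ℚ.* (seq y n ℚ.* two ⁻¹)    ≡⟨ solve 3 (λ t y i → t :* (y :* i) := y :* (t :* i)) refl two (seq y n) (two ⁻¹) ⟩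
    seq y n ℚ.* (two ℚ.* two ⁻¹)    ≡⟨ cong (seq y n ℚ.*_) (Rational.⁻¹-inverse (Rational.fromℕ-pos 1)) ⟩
    seq y n ℚ.* 1ℚ                  ≡⟨ ℚ.*-identityʳ (seq y n) ⟩
    seq y n                         ∎
    where
    two = Rational.fromℕ 2
    δ≤2δ : δ ℚ.≤ two ℚ.* δ
    δ≤2δ = ℚ.≤-trans (ℚ.≤-reflexive (sym (ℚ.*-identityˡ δ)))
      (ℚ.*-monoʳ-≤-nonNeg δ {{ℚ.nonNegative (ℚ.<⇒≤ 0<δ)}} (Rational.1≤fromℕ-suc 1))

  log-pos : ∀ {x} {{0<x : # 0 < x}} → # 1 < x → # 0 < log x
  log-pos {x} (mk< δ 0<δ N h) =
    let B , 0<B , K , k = Rational.bounded {seq x} (cauchy x)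
    in mk< (δ ℚ.* B ⁻¹) (Rational.*-pos 0<δ (Rational.⁻¹-pos 0<B)) (N ℕ.⊔ K) λ n hn →
    let hδ = h n (Rational.m≤ hn) in begin
    0ℚ ℚ.+ δ ℚ.* B ⁻¹        ≡⟨ ℚ.+-identityˡ (δ ℚ.* B ⁻¹) ⟩
    δ ℚ.* B ⁻¹               ≤⟨ ℚ.*-monoʳ-≤-nonNeg (B ⁻¹) {{ℚ.nonNegative (ℚ.<⇒≤ (Rational.⁻¹-pos 0<B))}} (δ≤ hδ) ⟩
    (seq x n ℚ.- 1ℚ) ℚ.* B ⁻¹ ≤⟨ Rational.riemann-lower n Rational.0<1
                                   (ℚ.≤-trans (ℚ.≤-reflexive (sym (ℚ.+-identityʳ 1ℚ))) (ℚ.≤-trans (ℚ.+-monoʳ-≤ 1ℚ (ℚ.<⇒≤ 0<δ)) hδ))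
                                   (ℚ.≤-trans (Rational.p≤∣p∣ (seq x n)) (k n (Rational.n≤ {N} hn))) ⟩
    riemann n 1ℚ (seq x n)   ∎
    where
    δ≤ : ∀ {p} → 1ℚ ℚ.+ δ ℚ.≤ p → δ ℚ.≤ p ℚ.- 1ℚ
    δ≤ {p} le = begin
      δ                    ≡⟨ solve 1 (λ d → d := (con 1ℚ :+ d) :- con 1ℚ) refl δ ⟩
      (1ℚ ℚ.+ δ) ℚ.- 1ℚ    ≤⟨ ℚ.+-monoˡ-≤ (ℚ.- 1ℚ) le ⟩
      p ℚ.- 1ℚ             ∎

module Arithmetic where

  open import Data.Nat
  open import Data.Nat.Coprimality using (coprime?)
  open import Data.Nat.Divisibility using (_∣_; _∣?_)
  open import Data.Nat.Primality using (prime?)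
  open import Data.List using (length; filter; upTo)
  open import Data.List.Extrema.Nat using (max; ⊥≤max)
  open import Relation.Nullary.Decidable using (_×-dec_)

  -- Both counts take the residues 0, …, n ∸ 1 as representatives of ℤ/nℤ.
  φ : ℕ → ℕ
  φ n = length (filter (λ b → coprime? b n) (upTo n))

  -- n ∣ ∣ b ^ (n ∸ 1) - 1 ∣ says that b ^ (n ∸ 1) ≡ 1 (mod n).
  F : ℕ → ℕ
  F n = length (filter (λ b → coprime? b n ×-dec n ∣? ∣ b ^ (n ∸ 1) - 1 ∣) (upTo n))

  -- The largest prime factor of m > 1; P⁺ 0 = P⁺ 1 = 1.
  P⁺ : ℕ → ℕ
  P⁺ m = max 1 (filter (λ p → prime? p ×-dec p ∣? m) (upTo (suc m)))

  P⁺-nonZero : ∀ m → NonZero (P⁺ m)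
  P⁺-nonZero m = >-nonZero (⊥≤max 1 (filter (λ p → prime? p ×-dec p ∣? m) (upTo (suc m))))

open Real public
open Arithmetic public using (φ; F; P⁺; P⁺-nonZero)

open import Data.Nat.Divisibility using (_∣_)
open import Data.Nat.Primality using (Composite)
open import Data.Nat.ListAction using (sum)
open import Data.List using (map)
open import Data.List.Relation.Unary.All using (All)
open import Data.List.Relation.Unary.Unique.Propositional using (Unique)

instance
  positive-numeral : ∀ {n} → # 0 < # suc n
  positive-numeral {n} = #-pos n

-- Σ_{n ∈ A} f(n) ≤ B, i.e. every sum of values of f over finitely many distinct
-- elements of A is at most B.  As f ≥ 0, for finite A this is the bound for the
-- sum over all of A.  A list of all elements of A is not asked for, because A
-- may be cut out by undecidable inequalities between reals.
infix 4 ∑[_]_≤_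
∑[_]_≤_ : (ℕ → Set) → (ℕ → ℕ) → ℝ → Set
∑[ A ] f ≤ B = ∀ ns → Unique ns → All A ns → # sum (map f ns) ≤ B

𝒩 : (L₁ L M x : ℝ) {{0<L₁ : # 0 < L₁}} → ℕ → Set
𝒩 L₁ L M x n =
  let P = P⁺ n
      Q = P⁺ (ℕ._/_ n P {{P⁺-nonZero n}})
  in ¬ 2 ∣ n × Composite n × # n ≤ x
     × # P ≤ L × M < # (P ℕ.* Q) × # φ n / L₁ ≤ # F n

C : (L₁ L M x : ℝ)
    {{_ : # 0 < L₁}} {{_ : # 0 < L}} {{_ : # 0 < M}} {{_ : # 0 < x}}
    {{_ : # 0 < log M}} {{_ : # 0 < M - # 2 * L}} → ℝ
C L₁ L M x =
    L ^ 2 / (# 2 * x) * (# 1 + log L₁)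
  + # 2 * (# 1 + log L₁) ^ 2 / (M * log M)
  + # 1 / (# 12 * (M - # 2 * L)) * (# 1 + log L) * (# 4 + log L₁) ^ 4
      * (# 5 / # 12 + (ζ 3 - # 1) * (# 1 + log L))
  where
  instance
    0<ab : ∀ {a b} {{_ : # 0 < a}} {{_ : # 0 < b}} → # 0 < a * b
    0<ab {{p}} {{q}} = *-pos p q

-- Positivity of everything that is divided by or whose logarithm is taken.
module Positivity {L₁ L M x : ℝ}
  (10<L₁ : # 10 < L₁) (L₁<L : L₁ < L) (L<M/2 : L < M / # 2)
  (L²<x : L ^ 2 < x) (M<L² : M < L ^ 2) where

  private
    1<L₁ : # 1 < L₁
    1<L₁ = fromℕ-≤ (ℕ.s≤s ℕ.z≤n) 10<L₁
    1<L  = <-trans 1<L₁ L₁<L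
    2L<M = <half⇒2*< L<M/2

  instance
    0<L₁ : # 0 < L₁
    0<L₁ = fromℕ-≤ ℕ.z≤n 10<L₁
    0<L : # 0 < L
    0<L = <-trans 0<L₁ L₁<L
    0<M : # 0 < M
    0<M = <-trans 0<L (<-trans (x<2x 0<L) 2L<M)
    0<x : # 0 < x
    0<x = <-trans 0<M (<-trans M<L² L²<x)
    0<logM : # 0 < log M
    0<logM = log-pos (<-trans 1<L (<-trans (x<2x 0<L) 2L<M))
    0<M-2L : # 0 < M - # 2 * L
    0<M-2L = <⇒0<- 2L<M

{-# OPTIONS --safe #-}
-- Write P = P⁺(n), Q = P⁺(n / P).  If P = Q, a solution of bⁿ⁻¹ ≡ 1 modulo P² is determined by its
-- residue modulo P, because b ≡ bⁿ; hence F(n) ≤ n / P.  If Q < P, put u = gcd(P - 1, n - 1) and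
-- v = gcd(Q - 1, n - 1), with P - 1 = d u and Q - 1 = e v.  Then F(n) ≤ n / (d e), and d, e ≤ φ(n) / F(n) ≤ L₁.
-- Given d, u, e, v, the conditions P Q ∣ n and u, v ∣ n - 1 fix n modulo R = P Q lcm(u, v).
-- The n ≤ R contribute at most x Σ 1 / (d e) over e v < d u ≤ L, that is, half of the full square
-- x (L Σ 1 / d²)²; this is the first term of C since (Σ 1 / d²)² ≤ H₁₀ ≤ 1 + log L₁.
-- For the n ≥ R write u = g a, v = g b with g = gcd(u, v).  They contribute at most
-- x² Σ 1 / (g³ d² a² e² b²) over g² d a e b = (P - 1)(Q - 1) > M - 2 L, and summing over b first
-- gives 2 x² (1 + log L)² (1 + log L₁)² / (M - 2 L).  Together with x² (1 + log L) / (M - 2 L) for the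
-- case P = Q this is below the third term of C, since (4 + ℓ)² ≥ 12 (1 + ℓ) and ζ(3) - 1 ≥ 1/6.
-- Of the second term of C only the sign matters.

module Submission where

-- The order of the reals is undecidable, so floors of L, L₁ or M - 2 L cannot be formed. As the
-- claim concerns an arbitrary finite list of members, four natural numbers are read off from that
-- list instead: X, the largest n; ℓ, the largest P; K, the largest of 10 and all d and e; T, the
-- least of the values P² or (P - 1)(Q - 1). The counting takes place in `ℕ` and `ℚ` with these
-- four, and only at the end are they compared with x, L, L₁ and M - 2 L. The cut at n = R avoids
-- rounding errors. A residue class modulo R meets [1, R] at most once and [R, X] at most X / R
-- times, with no extra 1. The isolated members, which no bound of the form X / R could control when
-- R is large, are exactly what the first term of `C` pays for. The bounds on d and e rest on
-- comparing F(n) and φ(n) one prime q at a time: modulo the full power of q dividing n, solutions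
-- are determined modulo q, so F(n) gets at most gcd(q - 1, n - 1) from this prime while φ(n) gets
-- at least q - 1.

-- Counting with duplicate-free lists

module Counting where

  open import Data.Nat using (_+_; _*_; _≤_; z<s)
  open import Data.Nat.Properties
  open import Data.List
  open import Data.List.Properties
  open import Data.List.Membership.Propositional using (_∈_)
  open import Data.List.Membership.Propositional.Properties
  open import Data.List.Relation.Binary.Permutation.Propositional using (_↭_; ↭-refl; ↭-trans; prep; ↭-reflexive)
  open import Data.List.Relation.Binary.Permutation.Propositional.Properties using (shift; ∈-resp-↭; ↭-length)
  open import Data.List.Relation.Unary.All as All using (All; []; _∷_)
  import Data.List.Relation.Unary.All.Properties as All
  open import Data.List.Relation.Unary.AllPairs using ([]; _∷_)
  open import Data.List.Relation.Unary.Any using (here; there)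
  open import Data.List.Relation.Unary.Unique.Propositional using (Unique)
  open import Data.Product using (∃-syntax; _,_)
  open import Relation.Binary.PropositionalEquality
  open import Relation.Nullary using (contradiction)

  private variable
    A B : Set

  ∈⇒↭ : ∀ {x : A} {xs} → x ∈ xs → ∃[ zs ] xs ↭ x ∷ zs
  ∈⇒↭ {x = x} x∈xs with ys , zs , refl ← ∈-∃++ x∈xs = ys ++ zs , shift x ys zs

  -- The head of `xs` is moved to the front of `ys` by a permutation; the other elements of `xs`
  -- differ from it, so they survive in the rest. No decidable equality on `A` is used.
  unique-⊆⇒↭ : ∀ {xs ys : List A} → Unique xs → (∀ {x} → x ∈ xs → x ∈ ys) →
    ∃[ zs ] ys ↭ xs ++ zs
  unique-⊆⇒↭ {ys = ys} [] _ = ys , ↭-refl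
  unique-⊆⇒↭ {xs = x ∷ xs} (x≢ ∷ u) sub with ∈⇒↭ (sub (here refl))
  ... | ws , ys↭ = let zs , ws↭ = unique-⊆⇒↭ u sub′ in zs , ↭-trans ys↭ (prep x ws↭)
    where
    sub′ : ∀ {y} → y ∈ xs → y ∈ ws
    sub′ y∈ with ∈-resp-↭ ys↭ (sub (there y∈))
    ... | here refl = contradiction refl (All.lookup x≢ y∈)
    ... | there y∈ws = y∈ws

  unique-⊆⇒length≤ : ∀ {xs ys : List A} → Unique xs → (∀ {x} → x ∈ xs → x ∈ ys) → length xs ≤ length ys
  unique-⊆⇒length≤ {xs = xs} {ys} u sub with unique-⊆⇒↭ u sub
  ... | zs , ys↭ = begin
    length xs             ≤⟨ m≤m+n (length xs) (length zs) ⟩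
    length xs + length zs ≡⟨ length-++ xs ⟨
    length (xs ++ zs)     ≡⟨ ↭-length ys↭ ⟨
    length ys             ∎
    where open ≤-Reasoning

  -- Needed for Fermat's little theorem, where an injective self-map of the units has to be
  -- recognised as a permutation so that products can be compared.
  unique-⊆-length⇒↭ : ∀ {xs ys : List A} → Unique xs → (∀ {x} → x ∈ xs → x ∈ ys) →
    length ys ≤ length xs → ys ↭ xs
  unique-⊆-length⇒↭ {xs = xs} {ys} u sub len with unique-⊆⇒↭ u sub
  ... | [] , ys↭ = ↭-trans ys↭ (↭-reflexive (++-identityʳ xs))
  ... | z ∷ zs , ys↭ = contradiction len (<⇒≱ (begin-strict
    length xs                   <⟨ m<m+n (length xs) z<s ⟩
    length xs + length (z ∷ zs) ≡⟨ length-++ xs ⟨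
    length (xs ++ z ∷ zs)       ≡⟨ ↭-length ys↭ ⟨
    length ys                   ∎))
    where open ≤-Reasoning

  -- Restricted to members of the list because the maps counted with are residues and quotients,
  -- which are injective only on solutions of the congruences at hand.
  InjectiveOn : (A → B) → List A → Set
  InjectiveOn f xs = ∀ {x y} → x ∈ xs → y ∈ xs → f x ≡ f y → x ≡ y

  map-unique : ∀ {f : A → B} {xs} → Unique xs → InjectiveOn f xs → Unique (map f xs)
  map-unique [] _ = []
  map-unique (x≢ ∷ u) inj =
    All.map⁺ (All.tabulate λ y∈ fx≡fy → All.lookup x≢ y∈ (inj (here refl) (there y∈) fx≡fy))
    ∷ map-unique u λ x∈ y∈ → inj (there x∈) (there y∈)

  injection⇒length≤ : ∀ {xs : List A} {ys : List B} → Unique xs → (f : A → B) →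
    (∀ {x} → x ∈ xs → f x ∈ ys) → InjectiveOn f xs → length xs ≤ length ys
  injection⇒length≤ {xs = xs} {ys} u f into inj =
    subst (_≤ length ys) (length-map f xs) (unique-⊆⇒length≤ (map-unique u inj) sub)
    where
    sub : ∀ {y} → y ∈ map f xs → y ∈ ys
    sub y∈ with _ , x∈ , refl ← ∈-map⁻ f y∈ = into x∈

  length-cartesianProduct : ∀ (xs : List A) (ys : List B) → length (cartesianProduct xs ys) ≡ length xs * length ys
  length-cartesianProduct []       ys = refl
  length-cartesianProduct (x ∷ xs) ys = trans (length-++ (map (x ,_) ys))
    (cong₂ _+_ (length-map (x ,_) ys) (length-cartesianProduct xs ys))

-- Congruences between integers and the Chinese remainder theorem

module Congruence where

  open import Data.Nat as ℕ using (ℕ; zero; suc; NonZero)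
  import Data.Nat.Properties as ℕ
  import Data.Nat.Divisibility as ℕ
  import Data.Nat.DivMod as ℕ
  open import Data.Nat.Coprimality as Coprime using (Coprime)
  open import Data.Nat.GCD using (module Bézout)
  open import Data.Integer hiding (NonZero; suc)
  open import Data.Integer.Properties
  open import Data.Integer.Divisibility.Signed
  open import Data.Integer.DivMod using (_%ℕ_; _/ℕ_; a≡a%ℕn+[a/ℕn]*n; n%ℕd<d)
  open import Data.Integer.Tactic.RingSolver using (solve-∀)
  open import Data.Product using (∃-syntax; _×_; _,_)
  open import Relation.Binary.PropositionalEquality
  open import Relation.Nullary using (contradiction)

  infix 4 _≡_[mod_]

  -- Wrapped in a record so that `a` and `b` can be inferred from the type, which the bare
  -- difference `a - b` would not allow.
  record _≡_[mod_] (a b : ℤ) (m : ℕ) : Set where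
    constructor mkMod
    field m∣a-b : + m ∣ a - b
  open _≡_[mod_] public

  private variable
    a b c d : ℤ
    m n : ℕ

  refl-mod : ∀ a → a ≡ a [mod m ]
  refl-mod a = mkMod (divides (+ 0) (+-inverseʳ a))

  sym-mod : a ≡ b [mod m ] → b ≡ a [mod m ]
  sym-mod {a} {b} (mkMod h) = mkMod (subst (_ ∣_) (lemma a b) (∣m⇒∣-m h))
    where
    lemma : ∀ a b → - (a - b) ≡ b - a
    lemma = solve-∀

  trans-mod : a ≡ b [mod m ] → b ≡ c [mod m ] → a ≡ c [mod m ]
  trans-mod {a} {b} {c = c} (mkMod h) (mkMod k) = mkMod (subst (_ ∣_) (lemma a b c) (∣m∣n⇒∣m+n h k))
    where
    lemma : ∀ a b c → (a - b) + (b - c) ≡ a - c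
    lemma = solve-∀

  *-mod : a ≡ b [mod m ] → c ≡ d [mod m ] → a * c ≡ b * d [mod m ]
  *-mod {a} {b} {c = c} {d} (mkMod h) (mkMod k) =
    mkMod (subst (_ ∣_) (lemma a b c d) (∣m∣n⇒∣m+n (∣m⇒∣m*n c h) (∣n⇒∣m*n b k)))
    where
    lemma : ∀ a b c d → (a - b) * c + b * (c - d) ≡ a * c - b * d
    lemma = solve-∀

  ^-mod : ∀ k → a ≡ b [mod m ] → a ^ k ≡ b ^ k [mod m ]
  ^-mod zero    h = refl-mod (+ 1)
  ^-mod (suc k) h = *-mod h (^-mod k h)

  weaken-mod : m ℕ.∣ n → a ≡ b [mod n ] → a ≡ b [mod m ]
  weaken-mod m∣n (mkMod h) = mkMod (∣-trans (∣ᵤ⇒∣ m∣n) h)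

  ∣-∣≡ : ∀ a b → ∣ + a - + b ∣ ≡ ℕ.∣ a - b ∣
  ∣-∣≡ a b = trans (cong ∣_∣ (m-n≡m⊖n a b)) (lemma a b)
    where
    lemma : ∀ a b → ∣ a ⊖ b ∣ ≡ ℕ.∣ a - b ∣
    lemma zero    zero    = refl
    lemma zero    (suc b) = refl
    lemma (suc a) zero    = refl
    lemma (suc a) (suc b) = trans (cong ∣_∣ ([1+m]⊖[1+n]≡m⊖n a b)) (lemma a b)

  cast-mod : m ≡ n → a ≡ b [mod m ] → a ≡ b [mod n ]
  cast-mod refl h = h

  toℕ-mod : ∀ {a b} → + a ≡ + b [mod m ] → m ℕ.∣ ℕ.∣ a - b ∣
  toℕ-mod {m} {a} {b} (mkMod h) = subst (m ℕ.∣_) (∣-∣≡ a b) (∣⇒∣ᵤ h)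

  fromℕ-mod : ∀ {a b} → m ℕ.∣ ℕ.∣ a - b ∣ → + a ≡ + b [mod m ]
  fromℕ-mod {m} {a} {b} h = mkMod (∣ᵤ⇒∣ (subst (m ℕ.∣_) (sym (∣-∣≡ a b)) h))

  pos-^ : ∀ a k → + (a ℕ.^ k) ≡ (+ a) ^ k
  pos-^ a zero    = refl
  pos-^ a (suc k) = trans (pos-* a (a ℕ.^ k)) (cong (λ z → + a * z) (pos-^ a k))

  %-mod : ∀ a m .{{_ : NonZero m}} → + a ≡ + (a ℕ.% m) [mod m ]
  %-mod a m = mkMod (divides (+ (a ℕ./ m)) (begin
    + a - + (a ℕ.% m)                               ≡⟨ cong (λ x → + x - + (a ℕ.% m)) (ℕ.m≡m%n+[m/n]*n a m) ⟩
    + (a ℕ.% m ℕ.+ a ℕ./ m ℕ.* m) - + (a ℕ.% m)     ≡⟨ cong (_- + (a ℕ.% m)) (trans (pos-+ (a ℕ.% m) _) (cong (λ z → + (a ℕ.% m) + z) (pos-* (a ℕ./ m) m))) ⟩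
    + (a ℕ.% m) + + (a ℕ./ m) * + m - + (a ℕ.% m)   ≡⟨ lemma (+ (a ℕ.% m)) (+ (a ℕ./ m) * + m) ⟩
    + (a ℕ./ m) * + m                               ∎))
    where
    open ≡-Reasoning
    lemma : ∀ x y → x + y - x ≡ y
    lemma = solve-∀

  %≡⇒mod : ∀ {a b} m .{{_ : NonZero m}} → a ℕ.% m ≡ b ℕ.% m → + a ≡ + b [mod m ]
  %≡⇒mod {a} {b} m eq = trans-mod (%-mod a m)
    (subst (λ r → + r ≡ + b [mod m ]) (sym eq) (sym-mod (%-mod b m)))

  ∣-dist∧<⇒≡ : ∀ {a b} → m ℕ.∣ ℕ.∣ a - b ∣ → a ℕ.< m → b ℕ.< m → a ≡ b
  ∣-dist∧<⇒≡ {m} {a} {b} h a<m b<m with ℕ.∣ a - b ∣ in eq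
  ... | zero  = ℕ.∣m-n∣≡0⇒m≡n eq
  ... | suc k = contradiction (ℕ.∣⇒≤ h) (ℕ.<⇒≱ (begin-strict
    suc k           ≡⟨ eq ⟨
    ℕ.∣ a - b ∣     ≤⟨ ℕ.∣m-n∣≤m⊔n a b ⟩
    a ℕ.⊔ b         <⟨ ℕ.⊔-lub a<m b<m ⟩
    m               ∎))
    where open ℕ.≤-Reasoning

  mod∧<⇒≡ : ∀ {a b} → + a ≡ + b [mod m ] → a ℕ.< m → b ℕ.< m → a ≡ b
  mod∧<⇒≡ h = ∣-dist∧<⇒≡ (toℕ-mod h)

  mod⇒%≡ : ∀ {a b} m .{{_ : NonZero m}} → + a ≡ + b [mod m ] → a ℕ.% m ≡ b ℕ.% m
  mod⇒%≡ {a} {b} m h =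
    mod∧<⇒≡ (trans-mod (sym-mod (%-mod a m)) (trans-mod h (%-mod b m))) (ℕ.m%n<n a m) (ℕ.m%n<n b m)

  coprime-∣⇒*∣ : Coprime m n → ∀ {k} → m ℕ.∣ k → n ℕ.∣ k → m ℕ.* n ℕ.∣ k
  coprime-∣⇒*∣ {m} {n} c {k} (ℕ.divides q refl) n∣k
    with ℕ.divides r refl ← Coprime.coprime-divisor (Coprime.sym c) (subst (n ℕ.∣_) (ℕ.*-comm q m) n∣k)
    = ℕ.divides r (trans (ℕ.*-assoc r n m) (cong (r ℕ.*_) (ℕ.*-comm n m)))

  mod-* : Coprime m n → a ≡ b [mod m ] → a ≡ b [mod n ] → a ≡ b [mod m ℕ.* n ]
  mod-* c (mkMod h) (mkMod k) = mkMod (∣ᵤ⇒∣ (coprime-∣⇒*∣ c (∣⇒∣ᵤ h) (∣⇒∣ᵤ k)))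

  coprime-resp-mod : ∀ {a b} → + a ≡ + b [mod m ] → Coprime b m → Coprime a m
  coprime-resp-mod {m} {a} {b} (mkMod h) c {d} (d∣a , d∣m) = c (∣⇒∣ᵤ (subst (+ d ∣_) (lemma (+ a) (+ b))
    (∣m∣n⇒∣m-n {m = + a} {n = + a - + b} (∣ᵤ⇒∣ d∣a) (∣-trans (∣ᵤ⇒∣ d∣m) h))) , d∣m)
    where
    lemma : ∀ a b → a - (a - b) ≡ b
    lemma = solve-∀

  coprime-* : ∀ {k} → Coprime k m → Coprime k n → Coprime k (m ℕ.* n)
  coprime-* {m} {n} c c′ {d} (d∣k , d∣mn) = c′ (d∣k , Coprime.coprime-divisor d⊥m d∣mn)
    where
    d⊥m : Coprime d m
    d⊥m (e∣d , e∣m) = c (ℕ.∣-trans e∣d d∣k , e∣m)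

  coprime-^ : ∀ {k} i → Coprime k m → Coprime k (m ℕ.^ i)
  coprime-^ zero    c (_ , d∣1) = ℕ.∣1⇒≡1 d∣1
  coprime-^ (suc i) c = coprime-* c (coprime-^ i c)

  bézout : Coprime m n → ∃[ x ] ∃[ y ] x * + m + y * + n ≡ + 1
  bézout {m} {n} c with Coprime.coprime-Bézout c
  ... | Bézout.+- x y eq = + x , - + y , (begin
    + x * + m + - + y * + n            ≡⟨ cong (_+ - + y * + n) (pos-* x m) ⟨
    + (x ℕ.* m) + - + y * + n          ≡⟨ cong (λ z → + z + - + y * + n) eq ⟨
    + (1 ℕ.+ y ℕ.* n) + - + y * + n    ≡⟨ cong (_+ - + y * + n) (trans (pos-+ 1 _) (cong (λ z → + 1 + z) (pos-* y n))) ⟩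
    + 1 + + y * + n + - + y * + n      ≡⟨ lemma (+ y) (+ n) ⟩
    + 1                                ∎)
    where
    open ≡-Reasoning
    lemma : ∀ y n → + 1 + y * n + - y * n ≡ + 1
    lemma = solve-∀
  ... | Bézout.-+ x y eq = - + x , + y , (begin
    - + x * + m + + y * + n            ≡⟨ cong (λ z → - + x * + m + z) (pos-* y n) ⟨
    - + x * + m + + (y ℕ.* n)          ≡⟨ cong (λ z → - + x * + m + + z) eq ⟨
    - + x * + m + + (1 ℕ.+ x ℕ.* m)    ≡⟨ cong (λ z → - + x * + m + z) (trans (pos-+ 1 _) (cong (λ z → + 1 + z) (pos-* x m))) ⟩
    - + x * + m + (+ 1 + + x * + m)    ≡⟨ lemma (+ x) (+ m) ⟩
    + 1                                ∎)
    where
    open ≡-Reasoning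
    lemma : ∀ x m → - x * m + (+ 1 + x * m) ≡ + 1
    lemma = solve-∀

  -- From x k + y m = 1 the coefficient x is an inverse of `k` modulo `m`.
  cancel-mod : ∀ {k} → Coprime k m → + k * a ≡ + k * b [mod m ] → a ≡ b [mod m ]
  cancel-mod {m} {a} {b} {k} c (mkMod h) with bézout c
  ... | x , y , eq = mkMod (subst (+ m ∣_) (begin
    x * (+ k * a - + k * b) + y * (a - b) * + m ≡⟨ lemma x y (+ k) (+ m) a b ⟩
    (x * + k + y * + m) * (a - b)               ≡⟨ cong (_* (a - b)) eq ⟩
    + 1 * (a - b)                               ≡⟨ *-identityˡ (a - b) ⟩
    a - b ∎) (∣m∣n⇒∣m+n (∣n⇒∣m*n x h) (divides (y * (a - b)) refl)))
    where
    open ≡-Reasoning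
    lemma : ∀ x y k m a b → x * (k * a - k * b) + y * (a - b) * m ≡ (x * k + y * m) * (a - b)
    lemma = solve-∀

  -- With x m + y n = 1, the number y n is 1 modulo `m` and 0 modulo `n`, and x m the reverse, so
  -- `z` has the required residues. It is then reduced modulo m n to give a natural representative
  -- below the modulus.
  crt : .{{_ : NonZero m}} .{{_ : NonZero n}} → Coprime m n → ∀ r s →
    ∃[ x ] x ℕ.< m ℕ.* n × + x ≡ r [mod m ] × + x ≡ s [mod n ]
  crt {m} {n} c r s with bézout c
  ... | x , y , eq = z %ℕ k , n%ℕd<d z k ,
      trans-mod (weaken-mod (ℕ.m∣m*n n) z≡) (mkMod (divides ((s - r) * x) (begin
        z - r                                                       ≡⟨ cong (λ u → z - u) (*-identityʳ r) ⟨
        z - r * + 1                                                 ≡⟨ cong (λ u → z - r * u) eq ⟨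
        r * (y * + n) + s * (x * + m) - r * (x * + m + y * + n)     ≡⟨ lemma₁ r s (+ m) (+ n) x y ⟩
        (s - r) * x * + m                                           ∎))) ,
      trans-mod (weaken-mod (ℕ.n∣m*n m) z≡) (mkMod (divides ((r - s) * y) (begin
        z - s                                                       ≡⟨ cong (λ u → z - u) (*-identityʳ s) ⟨
        z - s * + 1                                                 ≡⟨ cong (λ u → z - s * u) eq ⟨
        r * (y * + n) + s * (x * + m) - s * (x * + m + y * + n)     ≡⟨ lemma₂ r s (+ m) (+ n) x y ⟩
        (r - s) * y * + n                                           ∎)))
    where
    open ≡-Reasoning
    k = m ℕ.* n
    instance
      _ : NonZero k
      _ = ℕ.m*n≢0 m n
    z = r * (y * + n) + s * (x * + m)
    z≡ : + (z %ℕ k) ≡ z [mod k ]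
    z≡ = sym-mod (mkMod (divides (z /ℕ k) (trans (cong (_- + (z %ℕ k)) (a≡a%ℕn+[a/ℕn]*n z k)) (lemma (+ (z %ℕ k)) _))))
      where
      lemma : ∀ x y → x + y - x ≡ y
      lemma = solve-∀
    lemma₁ : ∀ r s m n x y → r * (y * n) + s * (x * m) - r * (x * m + y * n) ≡ (s - r) * x * m
    lemma₁ = solve-∀
    lemma₂ : ∀ r s m n x y → r * (y * n) + s * (x * m) - s * (x * m + y * n) ≡ (r - s) * y * n
    lemma₂ = solve-∀

-- Roots of unity modulo a prime and their lifting to prime powers

module PowerRoots where

  open import Data.Nat as ℕ using (ℕ; zero; suc; NonZero; _∸_; s≤s)
  import Data.Nat.Properties as ℕ
  import Data.Nat.Divisibility as ℕ
  import Data.Nat.DivMod as ℕ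
  open import Data.Nat.GCD using (gcd; gcd-GCD; module Bézout; gcd[m,n]≢0)
  open import Data.Nat.Coprimality as Coprime using (Coprime)
  open import Data.Nat.Primality using (Prime; prime⇒nonZero; prime⇒nonTrivial; prime⇒irreducible; euclidsLemma)
  open import Data.Nat.ListAction using (product)
  open import Data.Nat.ListAction.Properties using (product-↭)
  open import Data.Integer hiding (NonZero; suc)
  open import Data.Integer.Properties
  open import Data.Integer.Divisibility.Signed
  open import Data.Integer.Tactic.RingSolver using (solve-∀)
  open import Data.List using (List; []; _∷_; map; length; upTo)
  open import Data.List.Properties using (length-map; length-upTo)
  open import Data.List.Membership.Propositional using (_∈_)
  open import Data.List.Membership.Propositional.Properties using (∈-map⁻; ∈-map⁺; ∈-upTo⁺; ∈-upTo⁻)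
  open import Data.List.Relation.Unary.All as All using (All; []; _∷_)
  open import Data.List.Relation.Unary.AllPairs using ([]; _∷_)
  open import Data.List.Relation.Unary.Unique.Propositional using (Unique)
  open import Data.List.Relation.Unary.Unique.Propositional.Properties using (upTo⁺; map⁺)
  open import Data.Product using (∃-syntax; _×_; _,_)
  open import Data.Sum using (inj₁; inj₂)
  open import Relation.Binary.PropositionalEquality
  open import Function using (case_of_)
  open import Data.List.Relation.Binary.Permutation.Propositional using (↭-sym)
  open import Relation.Nullary using (¬_; contradiction)
  open Counting
  open Congruence

  -- Polynomial functions of degree < k, described by iterated divided differences.
  data Degree< : ℕ → (ℤ → ℤ) → Set where
    null : ∀ {f} → (∀ x → f x ≡ + 0) → Degree< 0 f
    step : ∀ {k f} → (∀ a → ∃[ h ] Degree< k h × ∀ x → f x - f a ≡ (x - a) * h x) → Degree< (suc k) f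

  degree-suc : ∀ {k f} → Degree< k f → Degree< (suc k) f
  degree-suc (null z) = step λ a → (λ _ → + 0) , null (λ _ → refl) , λ x →
    trans (cong₂ _-_ (z x) (z a)) (sym (*-zeroʳ (x - a)))
  degree-suc (step s) = step λ a → let h , d , e = s a in h , degree-suc d , e

  degree-+ : ∀ {k f g} → Degree< k f → Degree< k g → ∀ c → Degree< k (λ x → f x + c * g x)
  degree-+ (null z) (null w) c = null λ x → trans (cong₂ (λ u v → u + c * v) (z x) (w x)) (trans (+-identityˡ _) (*-zeroʳ c))
  degree-+ {f = f} {g} (step s) (step t) c = step λ a →
    let h , d , e = s a
        i , d′ , e′ = t a
    in (λ x → h x + c * i x) , degree-+ d d′ c , λ x → begin
      f x + c * g x - (f a + c * g a)         ≡⟨ lemma₁ (f x) (g x) (f a) (g a) c ⟩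
      (f x - f a) + c * (g x - g a)           ≡⟨ cong₂ (λ u v → u + c * v) (e x) (e′ x) ⟩
      (x - a) * h x + c * ((x - a) * i x)     ≡⟨ lemma₂ (x - a) (h x) (i x) c ⟩
      (x - a) * (h x + c * i x)               ∎
    where
    open ≡-Reasoning
    lemma₁ : ∀ p q r s c → p + c * q - (r + c * s) ≡ (p - r) + c * (q - s)
    lemma₁ = solve-∀
    lemma₂ : ∀ p q r c → p * q + c * (p * r) ≡ p * (q + c * r)
    lemma₂ = solve-∀

  degree-^ : ∀ k → Degree< (suc k) (_^ k)
  degree-^ zero = step λ a → (λ _ → + 0) , null (λ _ → refl) , λ x → sym (*-zeroʳ (x - a))
  degree-^ (suc k) with degree-^ k
  ... | d@(step s) = step λ a →
    let h , d′ , e = s a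
    in (λ x → x ^ k + a * h x) , degree-+ d (degree-suc d′) a , λ x → begin
      x * x ^ k - a * a ^ k                   ≡⟨ lemma₁ x a (x ^ k) (a ^ k) ⟩
      (x - a) * x ^ k + a * (x ^ k - a ^ k)   ≡⟨ cong (λ u → (x - a) * x ^ k + a * u) (e x) ⟩
      (x - a) * x ^ k + a * ((x - a) * h x)   ≡⟨ lemma₂ (x - a) a (x ^ k) (h x) ⟩
      (x - a) * (x ^ k + a * h x)             ∎
    where
    open ≡-Reasoning
    lemma₁ : ∀ x a p q → x * p - a * q ≡ (x - a) * p + a * (p - q)
    lemma₁ = solve-∀
    lemma₂ : ∀ y a p q → y * p + a * (y * q) ≡ y * (p + a * q)
    lemma₂ = solve-∀

  prime-∣* : ∀ {p} → Prime p → ∀ a {b} → + p ∣ a * b → ¬ + p ∣ a → + p ∣ b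
  prime-∣* pp a {b} h p∤a with euclidsLemma ∣ a ∣ ∣ b ∣ pp (subst (_ ℕ.∣_) (abs-* a b) (∣⇒∣ᵤ h))
  ... | inj₁ p∣a = contradiction (∣ᵤ⇒∣ p∣a) p∤a
  ... | inj₂ p∣b = ∣ᵤ⇒∣ p∣b

  -- Lagrange's theorem: division by x - r for the first root r leaves a function of smaller degree
  -- that vanishes modulo `p` at the remaining roots, because these differ from r, all lie below
  -- `p`, and `p` is prime. Stating the conclusion for values instead of coefficients keeps
  -- polynomials as mere functions.
  many-roots⇒vanishes : ∀ {p} → Prime p → ∀ {k f} → Degree< k f → ∀ {rs} → Unique rs →
    All (ℕ._< p) rs → All (λ r → + p ∣ f (+ r)) rs → k ℕ.≤ length rs → ∀ x → + p ∣ f x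
  many-roots⇒vanishes pp (null z) _ _ _ _ x = divides (+ 0) (z x)
  many-roots⇒vanishes {p} pp {f = f} (step s) {r ∷ rs} (r≢ ∷ u) (r< ∷ rs<) (root ∷ roots) (s≤s len) x =
    let h , d , e = s (+ r)
        root-h : ∀ {b} → b ∈ rs → + p ∣ h (+ b)
        root-h {b} b∈ = prime-∣* pp (+ b - + r)
          (subst (+ p ∣_) (e (+ b)) (∣m∣n⇒∣m-n {m = f (+ b)} (All.lookup roots b∈) root))
          (λ p∣ → All.lookup r≢ b∈ (sym (mod∧<⇒≡ (mkMod p∣) (All.lookup rs< b∈) r<)))
    in subst (+ p ∣_) (lemma (f x) (f (+ r))) (∣m∣n⇒∣m+n root
         (subst (+ p ∣_) (sym (e x)) (∣n⇒∣m*n (x - + r) (many-roots⇒vanishes pp d u rs< (All.tabulate root-h) len x))))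
    where
    lemma : ∀ a b → b + (a - b) ≡ a
    lemma = solve-∀

  prime∤1 : ∀ {p} → Prime p → ¬ p ℕ.∣ 1
  prime∤1 pp p∣1 = ℕ.nonTrivial⇒≢1 {{prime⇒nonTrivial pp}} (ℕ.∣1⇒≡1 p∣1)

  -- More than `k` roots would make x ^ k - 1 vanish modulo `p` everywhere, but its value at 0 is
  -- -1.
  roots-of-unity-bound : ∀ {p} → Prime p → ∀ k .{{_ : NonZero k}} {rs} → Unique rs → All (ℕ._< p) rs →
    All (λ r → (+ r) ^ k ≡ + 1 [mod p ]) rs → length rs ℕ.≤ k
  roots-of-unity-bound {p} pp k {rs} u rs< roots with ℕ.≤-<-connex (length rs) k
  ... | inj₁ ≤k = ≤k
  ... | inj₂ k< = contradiction (∣⇒∣ᵤ (subst (+ p ∣_) (at0 k) (many-roots⇒vanishes pp deg u rs<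
          (All.map (λ { (mkMod h) → h }) roots) k< (+ 0)))) (prime∤1 pp)
    where
    deg : Degree< (suc k) (λ x → x ^ k + - + 1)
    deg = degree-+ (degree-^ k) one (- + 1)
      where
      one : Degree< (suc k) (λ _ → + 1)
      one = raise k (step λ a → (λ _ → + 0) , null (λ _ → refl) , λ x → sym (*-zeroʳ (x - a)))
        where
        raise : ∀ k → Degree< 1 (λ _ → + 1) → Degree< (suc k) (λ _ → + 1)
        raise zero    d = d
        raise (suc k) d = degree-suc (raise k d)
    at0 : ∀ k .{{_ : NonZero k}} → (+ 0) ^ k + - + 1 ≡ - + 1
    at0 (suc k) = refl

  prime⇒coprime-∤ : ∀ {p a} → Prime p → ¬ p ℕ.∣ a → Coprime a p
  prime⇒coprime-∤ {p} pp p∤a {d} (d∣a , d∣p) with prime⇒irreducible pp d∣p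
  ... | inj₁ d≡1 = d≡1
  ... | inj₂ refl = contradiction d∣a p∤a

  nonzero<p⇒∤ : ∀ {p a} .{{_ : NonZero a}} → a ℕ.< p → ¬ p ℕ.∣ a
  nonzero<p⇒∤ a<p p∣a = ℕ.<⇒≱ a<p (ℕ.∣⇒≤ p∣a)

  module _ {p a : ℕ} (pp : Prime p) (p∤a : ¬ p ℕ.∣ a) where

    private
      instance
        _ = prime⇒nonZero pp
      units : List ℕ
      units = map suc (upTo (p ∸ 1))
      shifted : List ℕ
      shifted = map (λ x → a ℕ.* x ℕ.% p) units
      a⊥p : Coprime a p
      a⊥p = prime⇒coprime-∤ pp p∤a
      suc-pred-p : suc (p ∸ 1) ≡ p
      suc-pred-p = ℕ.suc-pred p

      ∈units⇒< : ∀ {x} → x ∈ units → x ℕ.< p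
      ∈units⇒< x∈ with i , i∈ , refl ← ∈-map⁻ suc x∈ =
        subst (suc i ℕ.<_) suc-pred-p (s≤s (∈-upTo⁻ i∈))

      ∈units⇒∤ : ∀ {x} → x ∈ units → ¬ p ℕ.∣ x
      ∈units⇒∤ x∈ with i , i∈ , refl ← ∈-map⁻ suc x∈ =
        nonzero<p⇒∤ {a = suc i} (∈units⇒< x∈)

      ∈units : ∀ {x} → ¬ p ℕ.∣ x → x ℕ.< p → x ∈ units
      ∈units {zero}  p∤x _   = contradiction (p ℕ.∣0) p∤x
      ∈units {suc x} _   x<p = ∈-map⁺ suc (∈-upTo⁺ (ℕ.≤-pred (subst (suc x ℕ.<_) (sym suc-pred-p) x<p)))

      length-units : length units ≡ p ∸ 1
      length-units = trans (length-map suc (upTo (p ∸ 1))) (length-upTo (p ∸ 1))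

      injective : InjectiveOn (λ x → a ℕ.* x ℕ.% p) units
      injective {x} {y} x∈ y∈ eq = mod∧<⇒≡ (cancel-mod a⊥p
        (subst₂ (_≡_[mod p ]) (pos-* a x) (pos-* a y) (%≡⇒mod p eq))) (∈units⇒< x∈) (∈units⇒< y∈)

      shifted⊆ : ∀ {x} → x ∈ shifted → x ∈ units
      shifted⊆ x∈ with y , y∈ , refl ← ∈-map⁻ (λ x → a ℕ.* x ℕ.% p) x∈ = ∈units
        (λ p∣ → case euclidsLemma a y pp (ℕ.m%n≡0⇒n∣m (a ℕ.* y) p (∣%⇒%≡0 p∣)) of λ where
          (inj₁ p∣a) → p∤a p∣a
          (inj₂ p∣y) → ∈units⇒∤ y∈ p∣y)
        (ℕ.m%n<n (a ℕ.* y) p)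
        where
        ∣%⇒%≡0 : ∀ {m} → p ℕ.∣ m ℕ.% p → m ℕ.% p ≡ 0
        ∣%⇒%≡0 {m} h = trans (sym (ℕ.m%n%n≡m%n m p)) (ℕ.n∣m⇒m%n≡0 (m ℕ.% p) p h)

      product-shifted : ∀ xs → + product (map (λ x → a ℕ.* x ℕ.% p) xs) ≡ (+ a) ^ length xs * + product xs [mod p ]
      product-shifted []       = refl-mod (+ 1)
      product-shifted (x ∷ xs) = subst₂ (_≡_[mod p ]) (sym (pos-* (a ℕ.* x ℕ.% p) _)) rearrange
        (*-mod (sym-mod (%-mod (a ℕ.* x) p)) (product-shifted xs))
        where
        lemma : ∀ a x y z → (a * x) * (y * z) ≡ (a * y) * (x * z)
        lemma = solve-∀
        rearrange : + (a ℕ.* x) * ((+ a) ^ length xs * + product xs) ≡ (+ a) ^ length (x ∷ xs) * + product (x ∷ xs)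
        rearrange = trans (cong (_* ((+ a) ^ length xs * + product xs)) (pos-* a x))
          (trans (lemma (+ a) (+ x) _ _) (cong ((+ a) ^ length (x ∷ xs) *_) (sym (pos-* x (product xs)))))

      ∤product : ∀ xs → All (λ x → ¬ p ℕ.∣ x) xs → ¬ p ℕ.∣ product xs
      ∤product []       []       h = prime∤1 pp h
      ∤product (x ∷ xs) (n ∷ ns) h with euclidsLemma x (product xs) pp h
      ... | inj₁ p∣x = n p∣x
      ... | inj₂ p∣r = ∤product xs ns p∣r

    -- Multiplication by `a` permutes the residues 1, ..., p - 1. Comparing the products before and
    -- after leaves a factor a ^ (p - 1), since the product of the residues is prime to `p` and
    -- cancels.
    fermat-little : (+ a) ^ (p ∸ 1) ≡ + 1 [mod p ]
    fermat-little = subst (λ k → (+ a) ^ k ≡ + 1 [mod p ]) length-units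
      (cancel-mod (prime⇒coprime-∤ pp (∤product units (All.tabulate ∈units⇒∤)))
        (subst₂ (_≡_[mod p ]) (*-comm _ (+ product units))
          (trans (cong +_ (product-↭ perm)) (sym (*-identityʳ (+ product units))))
          (sym-mod (product-shifted units))))
      where
      perm = ↭-sym (unique-⊆-length⇒↭ (map-unique (map⁺ ℕ.suc-injective (upTo⁺ (p ∸ 1))) injective) shifted⊆
        (ℕ.≤-reflexive (sym (length-map _ units))))

  pow-1-multiple : ∀ a {m} k → a ^ k ≡ + 1 [mod m ] → ∀ j → a ^ (j ℕ.* k) ≡ + 1 [mod m ]
  pow-1-multiple a k h zero = refl-mod (+ 1)
  pow-1-multiple a {m} k h (suc j) =
    subst (_≡ + 1 [mod m ]) (sym (^-distribˡ-+-* a k (j ℕ.* k))) (*-mod h (pow-1-multiple a k h j))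

  -- As a ^ v is a ^ g times a ^ u, no inverse of `a` has to be formed. Bézout's identity over the
  -- naturals delivers exponents in precisely this form.
  pow-1-cancel : ∀ a g {m u v} → g ℕ.+ u ≡ v → a ^ u ≡ + 1 [mod m ] → a ^ v ≡ + 1 [mod m ] → a ^ g ≡ + 1 [mod m ]
  pow-1-cancel a g {m} {u} refl hu hv = trans-mod
    (subst (_≡ a ^ g * a ^ u [mod m ]) (*-identityʳ _) (*-mod (refl-mod (a ^ g)) (sym-mod {a ^ u} hu)))
    (subst (_≡ + 1 [mod m ]) (^-distribˡ-+-* a g u) hv)

  pow-1-gcd : ∀ {a m} j k → a ^ j ≡ + 1 [mod m ] → a ^ k ≡ + 1 [mod m ] → a ^ gcd j k ≡ + 1 [mod m ]
  pow-1-gcd {a} {m} j k hj hk with Bézout.identity (gcd-GCD j k)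
  ... | Bézout.+- x y eq = pow-1-cancel a (gcd j k) eq (pow-1-multiple a k hk y) (pow-1-multiple a j hj x)
  ... | Bézout.-+ x y eq = pow-1-cancel a (gcd j k) eq (pow-1-multiple a j hj x) (pow-1-multiple a k hk y)

  -- Solutions of y ^ k ≡ 1 are also (p - 1)-th roots of unity.
  unit-roots-bound : ∀ {p} → Prime p → ∀ k {rs} → Unique rs → All (ℕ._< p) rs → All (λ r → ¬ p ℕ.∣ r) rs →
    All (λ r → (+ r) ^ k ≡ + 1 [mod p ]) rs → length rs ℕ.≤ gcd (p ∸ 1) k
  unit-roots-bound {p} pp k u rs< units roots = roots-of-unity-bound pp (gcd (p ∸ 1) k) u rs<
    (All.zipWith (λ (p∤r , root) → pow-1-gcd {+ _} (p ∸ 1) k (fermat-little pp p∤r) root) (units , roots))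
    where
    instance
      _ : NonZero (gcd (p ∸ 1) k)
      _ = ℕ.≢-nonZero (gcd[m,n]≢0 (p ∸ 1) k (inj₁ (ℕ.>⇒≢ (ℕ.m<n⇒0<n∸m (ℕ.nonTrivial⇒n>1 p {{prime⇒nonTrivial pp}})))))

  -- The Taylor expansion about `c`, with everything beyond the linear term collected into a
  -- multiple of the squared difference.
  ^-first-order : ∀ b c k → ∃[ t ] b ^ suc k ≡ c ^ suc k + + suc k * c ^ k * (b - c) + t * ((b - c) * (b - c))
  ^-first-order b c zero = + 0 , lemma b c
    where
    lemma : ∀ b c → b * + 1 ≡ c * + 1 + + 1 * + 1 * (b - c) + + 0 * ((b - c) * (b - c))
    lemma = solve-∀
  ^-first-order b c (suc k) with ^-first-order b c k
  ... | t , eq = b * t + + suc k * c ^ k , (begin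
    b * b ^ suc k
      ≡⟨ cong (b *_) eq ⟩
    b * (c ^ suc k + + suc k * c ^ k * (b - c) + t * ((b - c) * (b - c)))
      ≡⟨ lemma b c (c ^ k) (+ suc k) t ⟩
    c * (c * c ^ k) + (+ 1 + + suc k) * (c * c ^ k) * (b - c) + (b * t + + suc k * c ^ k) * ((b - c) * (b - c)) ∎)
    where
    open ≡-Reasoning
    lemma : ∀ b c q s t → b * (c * q + s * q * (b - c) + t * ((b - c) * (b - c)))
      ≡ c * (c * q) + (+ 1 + s) * (c * q) * (b - c) + (b * t + s * q) * ((b - c) * (b - c))
    lemma = solve-∀

  -- The linear term of the expansion carries the factor `n`, hence `q`, next to b - c; the
  -- quadratic term carries b - c twice. Either way one more power of `q` appears. The exponent
  -- starts at 1 because modulo q ^ 0 the square would gain nothing.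
  ^-lift : ∀ {q n b c} → q ℕ.∣ n → ∀ i → b ≡ c [mod q ℕ.^ suc i ] → b ^ n ≡ c ^ n [mod q ℕ.^ suc (suc i) ]
  ^-lift {n = zero} _ _ _ = refl-mod (+ 1)
  ^-lift {q} {suc k} {b} {c} q∣n i (mkMod h) with ^-first-order b c k
  ... | t , eq = mkMod (subst (_∣_ (+ (q ℕ.^ suc (suc i)))) (sym diff)
      (∣m∣n⇒∣m+n (subst (_∣ + suc k * c ^ k * (b - c)) (sym (pos-* q (q ℕ.^ suc i)))
          (*-mono-∣ {+ q} {+ suc k * c ^ k} {+ (q ℕ.^ suc i)} {b - c} (∣m⇒∣m*n {m = + suc k} (c ^ k) (∣ᵤ⇒∣ q∣n)) h))
        (∣n⇒∣m*n t (subst (_∣ (b - c) * (b - c)) (sym (pos-* q (q ℕ.^ suc i)))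
          (*-mono-∣ {+ q} {_} {+ (q ℕ.^ suc i)} {_} (∣-trans (∣ᵤ⇒∣ (ℕ.m∣m*n (q ℕ.^ i))) h) h)))))
    where
    *-mono-∣ : ∀ {a b c d} → a ∣ b → c ∣ d → a * c ∣ b * d
    *-mono-∣ {a} {b} {c} {d} h k = ∣-trans (*-monoˡ-∣ c h) (*-monoʳ-∣ b k)
    diff : b ^ suc k - c ^ suc k ≡ + suc k * c ^ k * (b - c) + t * ((b - c) * (b - c))
    diff = trans (cong (_- c ^ suc k) eq) (lemma (c ^ suc k) _ _)
      where
      lemma : ∀ x y z → x + y + z - x ≡ y + z
      lemma = solve-∀

  -- b ≡ bⁿ modulo qᵃ, and raising to the n-th power improves a congruence by one power of q.
  unit-root-lift : ∀ {q n a b c} .{{_ : NonZero n}} → q ℕ.∣ n →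
    b ^ (n ∸ 1) ≡ + 1 [mod q ℕ.^ a ] → c ^ (n ∸ 1) ≡ + 1 [mod q ℕ.^ a ] →
    b ≡ c [mod q ] → b ≡ c [mod q ℕ.^ a ]
  unit-root-lift {q} {n} {a} {b} {c} q∣n hb hc b≡c = go a ℕ.≤-refl
    where
    pow-n : ∀ {x} → x ^ (n ∸ 1) ≡ + 1 [mod q ℕ.^ a ] → x ≡ x ^ n [mod q ℕ.^ a ]
    pow-n {x} h = subst₂ (_≡_[mod q ℕ.^ a ]) (*-identityʳ x) (cong (x ^_) (ℕ.suc-pred n)) (*-mod (refl-mod x) (sym-mod {x ^ (n ∸ 1)} h))
    ^-∣ : ∀ {i} → i ℕ.≤ a → q ℕ.^ i ℕ.∣ q ℕ.^ a
    ^-∣ {i} i≤a = subst (λ k → q ℕ.^ i ℕ.∣ q ℕ.^ k) (ℕ.m+[n∸m]≡n i≤a)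
      (subst (q ℕ.^ i ℕ.∣_) (sym (ℕ.^-distribˡ-+-* q i (a ∸ i))) (ℕ.m∣m*n _))
    go : ∀ i → i ℕ.≤ a → b ≡ c [mod q ℕ.^ i ]
    go zero          _ = mkMod (divides (b - c) (sym (*-identityʳ (b - c))))
    go (suc zero)    _ = cast-mod (sym (ℕ.*-identityʳ q)) b≡c
    go (suc (suc i)) h = trans-mod (weaken-mod (^-∣ h) (pow-n hb))
      (trans-mod (^-lift {b = b} {c} q∣n i (go (suc i) (ℕ.<⇒≤ h))) (sym-mod (weaken-mod (^-∣ h) (pow-n hc))))

-- Upper bounds for F(n) and its comparison with φ(n)

module LiarCounts where

  open import Defs using (F; φ)
  open import Data.Nat
  open import Data.Nat.Properties
  open import Data.Nat.Divisibility
  open import Data.Nat.DivMod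
  open import Data.Nat.GCD using (gcd)
  open import Data.Nat.Coprimality as Coprime using (Coprime; coprime?)
  open import Data.Nat.Induction using (<-rec)
  open import Data.Nat.Primality
  open import Data.Nat.Tactic.RingSolver using (solve-∀)
  open import Data.Integer as ℤ using (+_)
  open import Data.List using (List; map; length; upTo; filter; cartesianProduct)
  open import Data.List.Properties using (length-map; length-upTo)
  open import Data.List.Membership.Propositional using (_∈_)
  open import Data.List.Membership.Propositional.Properties
  open import Data.List.Relation.Unary.All as All using (All)
  open import Data.List.Relation.Unary.Unique.Propositional using (Unique)
  open import Data.List.Relation.Unary.Unique.Propositional.Properties using (upTo⁺; map⁺; filter⁺; cartesianProduct⁺)
  open import Data.Product using (∃-syntax; _×_; _,_; proj₁; proj₂)
  open import Data.Sum using (_⊎_; inj₁; inj₂)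
  open import Relation.Binary.PropositionalEquality
  open import Relation.Nullary using (¬_; contradiction; yes; no; ¬?)
  open import Relation.Nullary.Decidable using (_×-dec_)
  open Counting
  open Congruence
  open PowerRoots

  -- Repeats the filter in the definition of `F`, so that `F n` is the length of this list by
  -- computation.
  liars : ℕ → List ℕ
  liars n = filter (λ b → coprime? b n ×-dec n ∣? ∣ b ^ (n ∸ 1) - 1 ∣) (upTo n)

  liars-unique : ∀ n → Unique (liars n)
  liars-unique n = filter⁺ _ (upTo⁺ n)

  record Liar (n b : ℕ) : Set where
    field
      b<n    : b < n
      b⊥n    : Coprime b n
      b^n-1≡1 : (+ b) ℤ.^ (n ∸ 1) ≡ + 1 [mod n ]
  open Liar

  ∈liars⇒Liar : ∀ {n b} → b ∈ liars n → Liar n b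
  ∈liars⇒Liar {n} {b} b∈ with b∈up , b⊥n , h ← ∈-filter⁻ (λ b → coprime? b n ×-dec n ∣? ∣ b ^ (n ∸ 1) - 1 ∣) b∈ = record
    { b<n = ∈-upTo⁻ b∈up ; b⊥n = b⊥n
    ; b^n-1≡1 = subst (_≡ + 1 [mod n ]) (pos-^ b (n ∸ 1)) (fromℕ-mod h) }

  unitRoots : ℕ → ℕ → List ℕ
  unitRoots p k = filter (λ r → ¬? (p ∣? r) ×-dec p ∣? ∣ r ^ k - 1 ∣) (upTo p)

  length-unitRoots≤ : ∀ {p} → Prime p → ∀ k → length (unitRoots p k) ≤ gcd (p ∸ 1) k
  length-unitRoots≤ {p} pp k = unit-roots-bound pp k (filter⁺ _ (upTo⁺ p))
    (All.tabulate λ r∈ → ∈-upTo⁻ (proj₁ (mem r∈)))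
    (All.tabulate λ r∈ → proj₁ (proj₂ (mem r∈)))
    (All.tabulate λ {r} r∈ → subst (_≡ + 1 [mod p ]) (pos-^ r k) (fromℕ-mod (proj₂ (proj₂ (mem r∈)))))
    where
    mem : ∀ {r} → r ∈ unitRoots p k → r ∈ upTo p × ¬ p ∣ r × p ∣ ∣ r ^ k - 1 ∣
    mem = ∈-filter⁻ (λ r → ¬? (p ∣? r) ×-dec p ∣? ∣ r ^ k - 1 ∣)

  liar%∈unitRoots : ∀ {p n b} .{{_ : NonZero p}} → Prime p → p ∣ n → b ∈ liars n → b % p ∈ unitRoots p (n ∸ 1)
  liar%∈unitRoots {p} {n} {b} pp p∣n b∈ = ∈-filter⁺ _ (∈-upTo⁺ (m%n<n b p))
    ( (λ p∣ → prime∤1 pp (∣-reflexive (b⊥n ℓ (m%n≡0⇒n∣m b p (trans (sym (m%n%n≡m%n b p)) (n∣m⇒m%n≡0 (b % p) p p∣)) , p∣n))))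
    , toℕ-mod (subst (_≡ + 1 [mod p ]) (sym (pos-^ (b % p) (n ∸ 1)))
        (trans-mod (^-mod (n ∸ 1) (sym-mod (%-mod b p))) (weaken-mod p∣n (b^n-1≡1 ℓ)))))
    where ℓ = ∈liars⇒Liar b∈

  %∧/⇒≡ : ∀ {b c} k .{{_ : NonZero k}} → b % k ≡ c % k → b / k ≡ c / k → b ≡ c
  %∧/⇒≡ {b} {c} k r q = trans (m≡m%n+[m/n]*n b k)
    (trans (cong₂ (λ x y → x + y * k) r q) (sym (m≡m%n+[m/n]*n c k)))

  distinct-primes-coprime : ∀ {p q} → Prime p → Prime q → p ≢ q → Coprime p q
  distinct-primes-coprime {p} pp pq p≢q = prime⇒coprime-∤ pq λ q∣p → case-irr (prime⇒irreducible pp q∣p)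
    where
    case-irr : _ ⊎ _ → _
    case-irr (inj₁ refl) = prime∤1 pq ∣-refl
    case-irr (inj₂ q≡p)  = p≢q (sym q≡p)

  -- A liar is recovered from its residues modulo `p` and `q`, which fix it modulo p q, and its
  -- quotient by p q, which is below `m`. Each residue is a root of unity of exponent n - 1 and so
  -- ranges over at most a gcd of values.
  F≤-two-primes : ∀ {p q n m} → Prime p → Prime q → p ≢ q → n ≡ m * (p * q) →
    F n ≤ gcd (p ∸ 1) (n ∸ 1) * gcd (q ∸ 1) (n ∸ 1) * m
  F≤-two-primes {p} {q} {n} {m} pp pq p≢q n≡ = begin
    length (liars n)
      ≤⟨ injection⇒length≤ (liars-unique n) f into inj ⟩
    length (cartesianProduct (cartesianProduct A B) (upTo m))
      ≡⟨ length-cartesianProduct (cartesianProduct A B) (upTo m) ⟩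
    length (cartesianProduct A B) * length (upTo m)
      ≡⟨ cong₂ _*_ (length-cartesianProduct A B) (length-upTo m) ⟩
    length A * length B * m
      ≤⟨ *-monoˡ-≤ m (*-mono-≤ (length-unitRoots≤ pp (n ∸ 1)) (length-unitRoots≤ pq (n ∸ 1))) ⟩
    gcd (p ∸ 1) (n ∸ 1) * gcd (q ∸ 1) (n ∸ 1) * m ∎
    where
    open ≤-Reasoning
    instance
      _ = prime⇒nonZero pp
      _ = prime⇒nonZero pq
      pq≢0 : NonZero (p * q)
      pq≢0 = m*n≢0 p q
    A = unitRoots p (n ∸ 1)
    B = unitRoots q (n ∸ 1)
    p∣n : p ∣ n
    p∣n = subst (p ∣_) (sym n≡) (∣n⇒∣m*n m (m∣m*n q))
    q∣n : q ∣ n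
    q∣n = subst (q ∣_) (sym n≡) (∣n⇒∣m*n m (n∣m*n p))
    f : ℕ → (ℕ × ℕ) × ℕ
    f b = (b % p , b % q) , b / (p * q)
    into : ∀ {b} → b ∈ liars n → f b ∈ cartesianProduct (cartesianProduct A B) (upTo m)
    into b∈ = ∈-cartesianProduct⁺ (∈-cartesianProduct⁺ (liar%∈unitRoots pp p∣n b∈) (liar%∈unitRoots pq q∣n b∈))
      (∈-upTo⁺ (m<n*o⇒m/o<n (subst (_ <_) n≡ (b<n (∈liars⇒Liar b∈)))))
    inj : InjectiveOn f (liars n)
    inj {b} {c} _ _ eq = %∧/⇒≡ (p * q)
      (mod⇒%≡ (p * q) (mod-* (distinct-primes-coprime pp pq p≢q)
        (%≡⇒mod p (cong (λ x → proj₁ (proj₁ x)) eq)) (%≡⇒mod q (cong (λ x → proj₂ (proj₁ x)) eq))))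
      (cong proj₂ eq)

  -- Here the residues modulo `p` are counted trivially, as `p` many. The saving is that they
  -- already determine the residue modulo p p, by `unit-root-lift`, so with the quotient there are
  -- at most p m possibilities where n = m p p.
  F-square-bound : ∀ {p n} → Prime p → .{{_ : NonZero n}} → p * p ∣ n → F n * p ≤ n
  F-square-bound {p} {n} pp pp∣n@(divides m n≡) = begin
    F n * p                                       ≤⟨ *-monoˡ-≤ p (injection⇒length≤ (liars-unique n) f into inj) ⟩
    length (cartesianProduct (upTo p) (upTo m)) * p
      ≡⟨ cong (_* p) (trans (length-cartesianProduct (upTo p) (upTo m)) (cong₂ _*_ (length-upTo p) (length-upTo m))) ⟩
    p * m * p                                     ≡⟨ lemma p m ⟩
    m * (p * p)                                   ≡⟨ n≡ ⟨
    n                                             ∎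
    where
    open ≤-Reasoning
    lemma : ∀ p m → p * m * p ≡ m * (p * p)
    lemma = solve-∀
    instance
      _ = prime⇒nonZero pp
      _ : NonZero (p * p)
      _ = m*n≢0 p p
    p²≡ : p ^ 2 ≡ p * p
    p²≡ = cong (p *_) (*-identityʳ p)
    f : ℕ → ℕ × ℕ
    f b = b % p , b / (p * p)
    into : ∀ {b} → b ∈ liars n → f b ∈ cartesianProduct (upTo p) (upTo m)
    into {b} b∈ = ∈-cartesianProduct⁺ (∈-upTo⁺ (m%n<n b p))
      (∈-upTo⁺ (m<n*o⇒m/o<n (subst (_ <_) n≡ (b<n (∈liars⇒Liar b∈)))))
    root : ∀ {b} → b ∈ liars n → (+ b) ℤ.^ (n ∸ 1) ≡ + 1 [mod p ^ 2 ]
    root b∈ = weaken-mod (subst (_∣ n) (sym p²≡) pp∣n) (b^n-1≡1 (∈liars⇒Liar b∈))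
    inj : InjectiveOn f (liars n)
    inj b∈ c∈ eq = %∧/⇒≡ (p * p)
      (mod⇒%≡ (p * p) (cast-mod p²≡
        (unit-root-lift {p} {n} {2} (∣-trans (m∣m*n p) pp∣n) (root b∈) (root c∈) (%≡⇒mod p (cong proj₁ eq)))))
      (cong proj₂ eq)

  split-prime-power : ∀ {q} → Prime q → ∀ n → .{{_ : NonZero n}} → ∃[ a ] ∃[ k ] n ≡ q ^ a * k × ¬ q ∣ k
  split-prime-power {q} pq = <-rec (λ n → .{{_ : NonZero n}} → ∃[ a ] ∃[ k ] n ≡ q ^ a * k × ¬ q ∣ k) go
    where
    go : ∀ n → (∀ {m} → m < n → .{{_ : NonZero m}} → ∃[ a ] ∃[ k ] m ≡ q ^ a * k × ¬ q ∣ k) →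
      .{{_ : NonZero n}} → ∃[ a ] ∃[ k ] n ≡ q ^ a * k × ¬ q ∣ k
    go n rec with q ∣? n
    ... | no q∤n = 0 , n , sym (*-identityˡ n) , q∤n
    ... | yes q∣n@(divides m refl) with rec {m} (m<m*n m q {{m*n≢0⇒m≢0 m}} (nonTrivial⇒n>1 q {{prime⇒nonTrivial pq}})) {{m*n≢0⇒m≢0 m}}
    ... | a , k , refl , q∤k = suc a , k , lemma (q ^ a) k q , q∤k
      where
      lemma : ∀ x k q → x * k * q ≡ q * x * k
      lemma = solve-∀

  totatives : ℕ → List ℕ
  totatives n = filter (λ b → coprime? b n) (upTo n)

  ∈totatives⁻ : ∀ {n b} → b ∈ totatives n → b < n × Coprime b n
  ∈totatives⁻ {n} b∈ with b∈up , c ← ∈-filter⁻ (λ b → coprime? b n) b∈ = ∈-upTo⁻ b∈up , c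

  module _ {q n : ℕ} .{{n≢0 : NonZero n}} (pq : Prime q) (q∣n : q ∣ n) where

    private
      instance
        _ = prime⇒nonZero pq

      residues : List ℕ
      residues = map suc (upTo (q ∸ 1))

      module Split (a k : ℕ) (n≡ : n ≡ q ^ suc a * k) (q∤k : ¬ q ∣ k) where
        instance
          k≢0 : NonZero k
          k≢0 = m*n≢0⇒n≢0 (q ^ suc a) {{subst NonZero n≡ n≢0}}
          qᵃ≢0 : NonZero (q ^ suc a)
          qᵃ≢0 = m^n≢0 q (suc a)
        Q = q ^ suc a
        Q⊥k : Coprime Q k
        Q⊥k = Coprime.sym (coprime-^ (suc a) (prime⇒coprime-∤ pq q∤k))
        Q∣n : Q ∣ n
        Q∣n = subst (Q ∣_) (sym n≡) (m∣m*n k)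
        k∣n : k ∣ n
        k∣n = subst (k ∣_) (sym n≡) (n∣m*n Q)

        -- Liars that agree modulo `q` agree modulo the full power `Q`, so at `Q` they take no more
        -- values than there are roots of unity modulo `q`. At the cofactor `k` nothing is used but
        -- that a liar is a unit.
        F≤ : F n ≤ gcd (q ∸ 1) (n ∸ 1) * φ k
        F≤ = begin
          length (liars n)                              ≤⟨ injection⇒length≤ (liars-unique n) f into inj ⟩
          length (cartesianProduct roots (totatives k)) ≡⟨ length-cartesianProduct roots (totatives k) ⟩
          length roots * φ k                            ≤⟨ *-monoˡ-≤ (φ k) (length-unitRoots≤ pq (n ∸ 1)) ⟩
          gcd (q ∸ 1) (n ∸ 1) * φ k                     ∎
          where
          open ≤-Reasoning
          roots = unitRoots q (n ∸ 1)
          f : ℕ → ℕ × ℕ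
          f b = b % q , b % k
          into : ∀ {b} → b ∈ liars n → f b ∈ cartesianProduct roots (totatives k)
          into {b} b∈ = ∈-cartesianProduct⁺ (liar%∈unitRoots pq q∣n b∈)
            (∈-filter⁺ (λ b → coprime? b k) (∈-upTo⁺ (m%n<n b k)) (coprime-resp-mod (sym-mod (%-mod b k))
              λ (d∣b , d∣k) → b⊥n (∈liars⇒Liar b∈) (d∣b , ∣-trans d∣k k∣n)))
          inj : InjectiveOn f (liars n)
          inj b∈ c∈ eq = mod∧<⇒≡
            (cast-mod (sym n≡) (mod-* Q⊥k
              (unit-root-lift {q} {n} {suc a} q∣n (weaken-mod Q∣n (b^n-1≡1 ℓ)) (weaken-mod Q∣n (b^n-1≡1 ℓ′))
                (%≡⇒mod q (cong proj₁ eq)))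
              (%≡⇒mod k (cong proj₂ eq))))
            (b<n ℓ) (b<n ℓ′)
            where
            ℓ = ∈liars⇒Liar b∈
            ℓ′ = ∈liars⇒Liar c∈

        -- The Chinese remainder theorem sends pairs of units injectively to units modulo `n`. Only
        -- the residues 1, ..., q - 1 modulo `Q` are taken, one for each unit modulo `q`, which
        -- matches the loss-free count in `F≤`.
        φ≥ : (q ∸ 1) * φ k ≤ φ n
        φ≥ = begin
          (q ∸ 1) * φ k                                    ≡⟨ cong (_* φ k) (trans (length-map suc (upTo (q ∸ 1))) (length-upTo (q ∸ 1))) ⟨
          length residues * φ k                            ≡⟨ length-cartesianProduct residues (totatives k) ⟨
          length (cartesianProduct residues (totatives k)) ≤⟨ injection⇒length≤ unique f into inj ⟩
          φ n                                              ∎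
          where
          open ≤-Reasoning
          unique : Unique (cartesianProduct residues (totatives k))
          unique = cartesianProduct⁺ (map⁺ suc-injective (upTo⁺ (q ∸ 1))) (filter⁺ _ (upTo⁺ k))
          f : ℕ × ℕ → ℕ
          f (r , c) = proj₁ (crt Q⊥k (+ r) (+ c))
          f<n : ∀ rc → f rc < n
          f<n (r , c) = subst (f (r , c) <_) (sym n≡) (proj₁ (proj₂ (crt Q⊥k (+ r) (+ c))))
          f≡r : ∀ r c → + f (r , c) ≡ + r [mod Q ]
          f≡r r c = proj₁ (proj₂ (proj₂ (crt Q⊥k (+ r) (+ c))))
          f≡c : ∀ r c → + f (r , c) ≡ + c [mod k ]
          f≡c r c = proj₂ (proj₂ (proj₂ (crt Q⊥k (+ r) (+ c))))
          mem : ∀ {r c} → (r , c) ∈ cartesianProduct residues (totatives k) → r < q × ¬ q ∣ r × c < k × Coprime c k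
          mem rc∈ with r∈ , c∈ ← ∈-cartesianProduct⁻ residues (totatives k) rc∈ with i , i∈ , refl ← ∈-map⁻ suc r∈ =
            let i<q = subst (suc i <_) (suc-pred q) (s≤s (∈-upTo⁻ i∈))
            in i<q , nonzero<p⇒∤ i<q , ∈totatives⁻ c∈
          into : ∀ {rc} → rc ∈ cartesianProduct residues (totatives k) → f rc ∈ totatives n
          into {r , c} rc∈ with r<q , q∤r , c<k , c⊥k ← mem rc∈ = ∈-filter⁺ (λ b → coprime? b n) (∈-upTo⁺ (f<n (r , c)))
            (subst (Coprime (f (r , c))) (sym n≡) (coprime-*
              (coprime-resp-mod (f≡r r c) (coprime-^ (suc a) (prime⇒coprime-∤ pq q∤r)))
              (coprime-resp-mod (f≡c r c) c⊥k)))
          inj : InjectiveOn f (cartesianProduct residues (totatives k))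
          inj {r , c} {r′ , c′} rc∈ rc′∈ eq with r<q , _ , c<k , _ ← mem rc∈ | r′<q , _ , c′<k , _ ← mem rc′∈ = cong₂ _,_
            (mod∧<⇒≡ (weaken-mod (m∣m*n (q ^ a)) (trans-mod (sym-mod (f≡r r c)) (subst (λ x → + x ≡ + r′ [mod Q ]) (sym eq) (f≡r r′ c′)))) r<q r′<q)
            (mod∧<⇒≡ (trans-mod (sym-mod (f≡c r c)) (subst (λ x → + x ≡ + c′ [mod k ]) (sym eq) (f≡c r′ c′))) c<k c′<k)

    -- Both `F≤` and `φ≥` contain φ(k), so this factor drops out of the comparison. With q - 1 = d g
    -- it says d F(n) ≤ φ(n), the form in which the hypothesis F(n) ≥ φ(n) / L₁ caps d.
    F-φ-ratio : F n * (q ∸ 1) ≤ gcd (q ∸ 1) (n ∸ 1) * φ n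
    F-φ-ratio with split-prime-power pq n
    ... | zero  , k , n≡ , q∤k = contradiction (subst (q ∣_) (trans n≡ (*-identityˡ k)) q∣n) q∤k
    ... | suc a , k , n≡ , q∤k = begin
      F n * (q ∸ 1)           ≤⟨ *-monoˡ-≤ (q ∸ 1) F≤ ⟩
      g * φ k * (q ∸ 1)       ≡⟨ lemma g (φ k) (q ∸ 1) ⟩
      g * ((q ∸ 1) * φ k)     ≤⟨ *-monoʳ-≤ g φ≥ ⟩
      g * φ n                 ∎
      where
      open ≤-Reasoning
      open Split a k n≡ q∤k
      g = gcd (q ∸ 1) (n ∸ 1)
      lemma : ∀ x y z → x * y * z ≡ x * (z * y)
      lemma = solve-∀

-- The two largest prime factors of a composite number

module Profile where

  open import Defs using (F; φ; P⁺; P⁺-nonZero)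
  open import Data.Nat
  open import Data.Nat.Properties
  open import Data.Nat.Divisibility
  open import Data.Nat.DivMod
  open import Data.Nat.GCD using (gcd; gcd[m,n]∣m; gcd[m,n]∣n)
  open import Data.Nat.Coprimality using (coprime?; 1-coprimeTo)
  open import Data.Nat.Primality
  open import Data.Nat.Primality.Factorisation using (factorise)
  open import Data.Nat.Tactic.RingSolver using (solve-∀)
  open import Data.List using ([]; _∷_; upTo; filter)
  open import Data.List.Extrema.Nat using (xs≤max; argmax-sel)
  open import Data.List.Membership.Propositional using (_∈_)
  open import Data.List.Membership.Propositional.Properties
  open import Data.List.Relation.Unary.All as All using (All; []; _∷_)
  open import Data.Product using (∃-syntax; _×_; _,_; proj₁; proj₂)
  open import Data.Sum using (_⊎_; inj₁; inj₂)
  open import Function using (id)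
  open import Relation.Binary.PropositionalEquality
  open import Relation.Nullary using (Dec; contradiction; yes; no)
  open import Relation.Nullary.Decidable using (_×-dec_)
  open LiarCounts

  ∃-prime-divisor : ∀ m → 1 < m → ∃[ p ] Prime p × p ∣ m
  ∃-prime-divisor m 1<m with factorise m {{>-nonZero (<-trans z<s 1<m)}}
  ... | record { factors = [] ; isFactorisation = refl } = contradiction 1<m (<-irrefl refl)
  ... | record { factors = p ∷ ps ; isFactorisation = refl ; factorsPrime = pp ∷ _ } = p , pp , m∣m*n _

  private
    ∈candidates : ∀ {m p} .{{_ : NonZero m}} → Prime p → p ∣ m →
      p ∈ filter (λ p → prime? p ×-dec p ∣? m) (upTo (suc m))
    ∈candidates {m} pp p∣m = ∈-filter⁺ (λ p → prime? p ×-dec p ∣? m) (∈-upTo⁺ (s≤s (∣⇒≤ p∣m))) (pp , p∣m)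

  prime-divisor≤P⁺ : ∀ {m p} .{{_ : NonZero m}} → Prime p → p ∣ m → p ≤ P⁺ m
  prime-divisor≤P⁺ pp p∣m = All.lookup (xs≤max 1 _) (∈candidates pp p∣m)

  P⁺-prime-divisor : ∀ {m} → 1 < m → Prime (P⁺ m) × P⁺ m ∣ m
  P⁺-prime-divisor {m} 1<m with argmax-sel id 1 (filter (λ p → prime? p ×-dec p ∣? m) (upTo (suc m)))
  ... | inj₂ P∈ = proj₂ (∈-filter⁻ (λ p → prime? p ×-dec p ∣? m) {xs = upTo (suc m)} P∈)
  -- The default value 1 of the maximum is ruled out: some prime divisor is on the list and exceeds
  -- 1.
  ... | inj₁ P≡1 with p , pp , p∣m ← ∃-prime-divisor m 1<m = contradiction
    (prime-divisor≤P⁺ {{>-nonZero (<-trans z<s 1<m)}} pp p∣m)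
    (<⇒≱ (subst (_< p) (sym P≡1) (nonTrivial⇒n>1 p {{prime⇒nonTrivial pp}})))

  -- The residue 1 is always counted. Positivity is what later permits division by F(n) in bounding
  -- d and e.
  F-positive : ∀ {n} → 1 < n → 0 < F n
  F-positive {n} 1<n = ∈-length {x = 1} (∈-filter⁺ (λ b → coprime? b n ×-dec n ∣? ∣ b ^ (n ∸ 1) - 1 ∣) (∈-upTo⁺ 1<n)
    ((λ {d} → 1-coprimeTo n {d}) , subst (λ k → n ∣ ∣ k - 1 ∣) (sym (^-zeroˡ (n ∸ 1))) (n ∣0)))

  record Square (n P : ℕ) : Set where
    field
      P²∣n : P * P ∣ n
      FP≤n : F n * P ≤ n

  -- Only the consequences that the counting uses are kept; that `u` and `v` arise as greatest
  -- common divisors is forgotten, and they become plain divisors of n - 1.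
  record TwoPrimes (n P Q : ℕ) : Set where
    field
      d u e v : ℕ
      d>0 : 0 < d
      u>0 : 0 < u
      e>0 : 0 < e
      v>0 : 0 < v
      P≡ : P ≡ suc (d * u)
      Q≡ : Q ≡ suc (e * v)
      Q<P : Q < P
      PQ∣n : P * Q ∣ n
      u∣n-1 : u ∣ n ∸ 1
      v∣n-1 : v ∣ n ∸ 1
      Fde≤n : F n * (d * e) ≤ n
      dF≤φ : d * F n ≤ φ n
      eF≤φ : e * F n ≤ φ n

  cofactor : ∀ {p} → Prime p → ∀ k → ∃[ d ] p ≡ suc (d * gcd (p ∸ 1) k) × 0 < d × 0 < gcd (p ∸ 1) k
  cofactor {p} pp k with gcd[m,n]∣m (p ∸ 1) k
  ... | divides d p-1≡ = d , p≡ , n≢0⇒n>0 (λ { refl → 0≢ refl }) , n≢0⇒n>0 (λ g≡0 → 0≢ (trans (cong (d *_) g≡0) (*-zeroʳ d)))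
    where
    p>1 = nonTrivial⇒n>1 p {{prime⇒nonTrivial pp}}
    p≡ : p ≡ suc (d * gcd (p ∸ 1) k)
    p≡ = trans (sym (suc-pred p {{prime⇒nonZero pp}})) (cong suc p-1≡)
    0≢ : d * gcd (p ∸ 1) k ≢ 0
    0≢ e = <⇒≢ (m<n⇒0<n∸m p>1) (sym (trans p-1≡ e))

  F-cofactor≤φ : ∀ {p n d} .{{_ : NonZero n}} → Prime p → p ∣ n → p ≡ suc (d * gcd (p ∸ 1) (n ∸ 1)) →
    0 < gcd (p ∸ 1) (n ∸ 1) → d * F n ≤ φ n
  F-cofactor≤φ {p} {n} {d} pp p∣n p≡ g>0 = *-cancelˡ-≤ g {{>-nonZero g>0}} (begin
    g * (d * F n)     ≡⟨ lemma g d (F n) ⟩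
    F n * (d * g)     ≡⟨ cong (λ x → F n * (x ∸ 1)) p≡ ⟨
    F n * (p ∸ 1)     ≤⟨ F-φ-ratio pp p∣n ⟩
    g * φ n           ∎)
    where
    open ≤-Reasoning
    g = gcd (p ∸ 1) (n ∸ 1)
    lemma : ∀ g d f → g * (d * f) ≡ f * (d * g)
    lemma = solve-∀

  square-profile : ∀ {n p} .{{_ : NonZero n}} → Prime p → p * p ∣ n → Square n p
  square-profile pp p²∣n = record { P²∣n = p²∣n ; FP≤n = F-square-bound pp p²∣n }

  two-primes-profile : ∀ {n p q} .{{_ : NonZero n}} → Prime p → Prime q → q < p → p * q ∣ n → TwoPrimes n p q
  two-primes-profile {n} {p} {q} pp pq q<p pq∣n@(divides k n≡)
    with cofactor pp (n ∸ 1) | cofactor pq (n ∸ 1)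
  ... | d , p≡ , d>0 , u>0 | e , q≡ , e>0 , v>0 = record
    { d = d ; u = u ; e = e ; v = v ; d>0 = d>0 ; u>0 = u>0 ; e>0 = e>0 ; v>0 = v>0
    ; P≡ = p≡ ; Q≡ = q≡ ; Q<P = q<p ; PQ∣n = pq∣n
    ; u∣n-1 = gcd[m,n]∣n (p ∸ 1) (n ∸ 1)
    ; v∣n-1 = gcd[m,n]∣n (q ∸ 1) (n ∸ 1)
    ; Fde≤n = begin
        F n * (d * e)                   ≤⟨ *-monoˡ-≤ (d * e) (F≤-two-primes pp pq (>⇒≢ q<p) n≡) ⟩
        u * v * k * (d * e)             ≡⟨ rearrange u v k d e ⟩
        k * ((d * u) * (e * v))         ≤⟨ *-monoʳ-≤ k (*-mono-≤ (n≤1+n (d * u)) (n≤1+n (e * v))) ⟩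
        k * (suc (d * u) * suc (e * v)) ≡⟨ cong₂ (λ x y → k * (x * y)) p≡ q≡ ⟨
        k * (p * q)                     ≡⟨ n≡ ⟨
        n                               ∎
    ; dF≤φ = F-cofactor≤φ {d = d} pp (∣-trans (m∣m*n q) pq∣n) p≡ u>0
    ; eF≤φ = F-cofactor≤φ {d = e} pq (∣-trans (n∣m*n p) pq∣n) q≡ v>0
    }
    where
    open ≤-Reasoning
    u = gcd (p ∸ 1) (n ∸ 1)
    v = gcd (q ∸ 1) (n ∸ 1)
    rearrange : ∀ u v k d e → u * v * k * (d * e) ≡ k * ((d * u) * (e * v))
    rearrange = solve-∀

  -- Compositeness makes the cofactor `m` exceed 1, so its largest prime factor is a genuine prime.
  -- Since `P` is the largest prime factor of `n`, that factor is either `P` itself or smaller.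
  largest-two-primes : ∀ {n P m} .{{_ : NonZero n}} → Composite n → Prime P → P ∣ n → (∀ {p} → Prime p → p ∣ n → p ≤ P) →
    n ≡ m * P → let Q = P⁺ m in (P ≡ Q × Square n P) ⊎ TwoPrimes n P Q
  largest-two-primes {n} {P} {m} cn pP P∣n P-largest n≡mP = split (P ≟ P⁺ m)
    where
    m>1 : 1 < m
    m>1 = ≤∧≢⇒< (n≢0⇒n>0 λ m≡0 → ≢-nonZero⁻¹ n (trans n≡mP (cong (_* P) m≡0)))
      λ 1≡m → composite⇒¬prime cn (subst Prime (sym (trans n≡mP (trans (cong (_* P) (sym 1≡m)) (*-identityˡ P)))) pP)
    pQ = proj₁ (P⁺-prime-divisor m>1)
    PQ∣n : P * P⁺ m ∣ n
    PQ∣n = subst₂ _∣_ (*-comm (P⁺ m) P) (sym n≡mP) (*-monoˡ-∣ P (proj₂ (P⁺-prime-divisor m>1)))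
    split : Dec (P ≡ P⁺ m) → (P ≡ P⁺ m × Square n P) ⊎ TwoPrimes n P (P⁺ m)
    split (yes P≡Q) = inj₁ (P≡Q , square-profile pP (subst (λ x → P * x ∣ n) (sym P≡Q) PQ∣n))
    split (no P≢Q)  = inj₂ (two-primes-profile pP pQ
      (≤∧≢⇒< (P-largest pQ (∣-trans (n∣m*n P) PQ∣n)) (≢-sym P≢Q)) PQ∣n)

  largest-primes : ∀ {n} → Composite n →
    let P = P⁺ n
        Q = P⁺ (_/_ n P {{P⁺-nonZero n}})
    in 1 < n × ((P ≡ Q × Square n P) ⊎ TwoPrimes n P Q)
  largest-primes {n} cn = n>1 ,
    largest-two-primes {m = _/_ n (P⁺ n) {{P⁺-nonZero n}}} cn (proj₁ (P⁺-prime-divisor n>1)) P∣n prime-divisor≤P⁺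
      (sym (m/n*n≡m {{P⁺-nonZero n}} P∣n))
    where
    n>1 : 1 < n
    n>1 = nonTrivial⇒n>1 n {{composite⇒nonTrivial cn}}
    instance
      n≢0 : NonZero n
      n≢0 = composite⇒nonZero cn
    P∣n = proj₂ (P⁺-prime-divisor n>1)

-- Finite sums and reciprocals in the rationals

module RationalSums where

  open import Defs using (module Rational)
  open Rational using (fromℕ; _⁻¹; fromℕ-suc; fromℕ-pos; fromℕ-mono; ⁻¹-inverse; ⁻¹-pos; ⁻¹-antimono; *-nonneg)
  open import Data.Nat as ℕ using (ℕ; zero; suc)
  import Data.Nat.Properties as ℕ
  open import Data.Nat.ListAction using (sum)
  open import Data.Rational
  open import Data.Rational.Properties
  open import Data.Rational.Solver using (module +-*-Solver)
  open +-*-Solver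
  open import Data.List using (List; []; _∷_; _++_; map; length; filter; cartesianProduct)
  open import Data.List.Membership.Propositional using (_∈_)
  open import Data.List.Relation.Unary.Any using (here; there)
  open import Data.Product using (∃-syntax; _×_; _,_)
  open import Function using (_∘_)
  open import Relation.Binary.PropositionalEquality
  open import Relation.Nullary using (Dec; yes; no; does; ¬_; contradiction)
  open import Data.Bool using (true; false; if_then_else_)
  open ≤-Reasoning

  private variable
    A B : Set

  ∑ : List A → (A → ℚ) → ℚ
  ∑ []       f = 0ℚ
  ∑ (x ∷ xs) f = f x + ∑ xs f

  when : {P : Set} → Dec P → ℚ → ℚ
  when P? w = if does P? then w else 0ℚ

  ∑-mono : ∀ (xs : List A) {f g} → (∀ {x} → x ∈ xs → f x ≤ g x) → ∑ xs f ≤ ∑ xs g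
  ∑-mono []       h = ≤-refl
  ∑-mono (x ∷ xs) h = +-mono-≤ (h (here refl)) (∑-mono xs (h ∘ there))

  ∑-cong : ∀ (xs : List A) {f g} → (∀ x → f x ≡ g x) → ∑ xs f ≡ ∑ xs g
  ∑-cong []       h = refl
  ∑-cong (x ∷ xs) h = cong₂ _+_ (h x) (∑-cong xs h)

  ∑-0 : ∀ (xs : List A) → ∑ xs (λ _ → 0ℚ) ≡ 0ℚ
  ∑-0 []       = refl
  ∑-0 (x ∷ xs) = trans (+-identityˡ _) (∑-0 xs)

  ∑-nonneg : ∀ (xs : List A) {f} → (∀ x → 0ℚ ≤ f x) → 0ℚ ≤ ∑ xs f
  ∑-nonneg xs h = ≤-trans (≤-reflexive (sym (∑-0 xs))) (∑-mono xs λ {x} _ → h x)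

  ∑-+ : ∀ (xs : List A) f g → ∑ xs (λ x → f x + g x) ≡ ∑ xs f + ∑ xs g
  ∑-+ []       f g = refl
  ∑-+ (x ∷ xs) f g = trans (cong (f x + g x +_) (∑-+ xs f g))
    (solve 4 (λ a b c d → (a :+ b) :+ (c :+ d) := (a :+ c) :+ (b :+ d)) refl (f x) (g x) (∑ xs f) (∑ xs g))

  ∑-*ˡ : ∀ (xs : List A) c f → ∑ xs (λ x → c * f x) ≡ c * ∑ xs f
  ∑-*ˡ []       c f = sym (*-zeroʳ c)
  ∑-*ˡ (x ∷ xs) c f = trans (cong (c * f x +_) (∑-*ˡ xs c f)) (sym (*-distribˡ-+ c (f x) (∑ xs f)))

  ∑-*ʳ : ∀ (xs : List A) c f → ∑ xs (λ x → f x * c) ≡ ∑ xs f * c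
  ∑-*ʳ xs c f = trans (∑-cong xs λ x → *-comm (f x) c) (trans (∑-*ˡ xs c f) (*-comm c (∑ xs f)))

  ∑-++ : ∀ (xs ys : List A) f → ∑ (xs ++ ys) f ≡ ∑ xs f + ∑ ys f
  ∑-++ []       ys f = sym (+-identityˡ _)
  ∑-++ (x ∷ xs) ys f = trans (cong (f x +_) (∑-++ xs ys f)) (sym (+-assoc (f x) _ _))

  ∑-map : ∀ (h : A → B) xs f → ∑ (map h xs) f ≡ ∑ xs (f ∘ h)
  ∑-map h []       f = refl
  ∑-map h (x ∷ xs) f = cong (f (h x) +_) (∑-map h xs f)

  ∑-filter : ∀ {P : A → Set} (P? : ∀ x → Dec (P x)) xs f → ∑ (filter P? xs) f ≡ ∑ xs (λ x → when (P? x) (f x))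
  ∑-filter P? []       f = refl
  ∑-filter P? (x ∷ xs) f with does (P? x)
  ... | true  = cong (f x +_) (∑-filter P? xs f)
  ... | false = trans (∑-filter P? xs f) (sym (+-identityˡ _))

  ∑-swap : ∀ (xs : List A) (ys : List B) (f : A → B → ℚ) → ∑ xs (λ x → ∑ ys (f x)) ≡ ∑ ys (λ y → ∑ xs (λ x → f x y))
  ∑-swap []       ys f = sym (∑-0 ys)
  ∑-swap (x ∷ xs) ys f = trans (cong (∑ ys (f x) +_) (∑-swap xs ys f)) (sym (∑-+ ys (f x) _))

  ∑-cartesianProduct : ∀ (xs : List A) (ys : List B) f →
    ∑ (cartesianProduct xs ys) f ≡ ∑ xs (λ x → ∑ ys (λ y → f (x , y)))
  ∑-cartesianProduct []       ys f = refl
  ∑-cartesianProduct (x ∷ xs) ys f = trans (∑-++ (map (x ,_) ys) _ f)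
    (cong₂ _+_ (∑-map (x ,_) ys f) (∑-cartesianProduct xs ys f))

  ∑-product : ∀ (xs : List A) (ys : List B) f g → ∑ xs (λ x → ∑ ys (λ y → f x * g y)) ≡ ∑ xs f * ∑ ys g
  ∑-product xs ys f g = trans (∑-cong xs λ x → ∑-*ˡ ys (f x) g) (∑-*ʳ xs (∑ ys g) f)

  ∑-const : ∀ (xs : List A) c → ∑ xs (λ _ → c) ≡ fromℕ (length xs) * c
  ∑-const []       c = sym (*-zeroˡ c)
  ∑-const (x ∷ xs) c = trans (cong (c +_) (∑-const xs c))
    (trans (solve 2 (λ c n → c :+ n :* c := (con 1ℚ :+ n) :* c) refl c (fromℕ (length xs)))
           (cong (_* c) (sym (fromℕ-suc (length xs)))))

  ∈⇒≤∑ : ∀ {xs : List A} {x} f → (∀ x → 0ℚ ≤ f x) → x ∈ xs → f x ≤ ∑ xs f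
  ∈⇒≤∑ {xs = y ∷ ys} f f≥0 (here refl) = ≤-trans (≤-reflexive (sym (+-identityʳ (f y)))) (+-monoʳ-≤ (f y) (∑-nonneg ys f≥0))
  ∈⇒≤∑ {xs = y ∷ ys} f f≥0 (there x∈) = ≤-trans (∈⇒≤∑ f f≥0 x∈)
    (≤-trans (≤-reflexive (sym (+-identityˡ _))) (+-monoˡ-≤ (∑ ys f) (f≥0 y)))

  when-yes : ∀ {P : Set} (P? : Dec P) {w} → P → when P? w ≡ w
  when-yes (yes _) _ = refl
  when-yes (no ¬p) p = contradiction p ¬p

  when-nonneg : ∀ {P : Set} (P? : Dec P) {w} → 0ℚ ≤ w → 0ℚ ≤ when P? w
  when-nonneg (yes _) h = h
  when-nonneg (no _)  h = ≤-refl

  when-≤ : ∀ {P : Set} (P? : Dec P) {w v} → 0ℚ ≤ v → (P → w ≤ v) → when P? w ≤ v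
  when-≤ (yes p) _   h = h p
  when-≤ (no _)  0≤v _ = 0≤v

  when-mono : ∀ {P : Set} (P? : Dec P) {w v} → (P → w ≤ v) → when P? w ≤ when P? v
  when-mono (yes p) h = h p
  when-mono (no _)  _ = ≤-refl

  when-* : ∀ {P : Set} (P? : Dec P) c w → when P? (c * w) ≡ c * when P? w
  when-* (yes _) c w = refl
  when-* (no _)  c w = sym (*-zeroʳ c)

  when-+-≤ : ∀ {P Q : Set} (P? : Dec P) (Q? : Dec Q) {w v} → (P → ¬ Q) → v ≡ w → 0ℚ ≤ w → when P? w + when Q? v ≤ w
  when-+-≤ (yes p) (yes q) ¬pq _ _ = contradiction q (¬pq p)
  when-+-≤ (yes _) (no _)  _ _ _   = ≤-reflexive (+-identityʳ _)
  when-+-≤ (no _)  (yes _) _ e _   = ≤-reflexive (trans (+-identityˡ _) e)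
  when-+-≤ (no _)  (no _)  _ _ 0≤w = 0≤w

  -- A union bound. The classes may overlap: with nonnegative weights, counting an element more than
  -- once only enlarges the right-hand side.
  ∑-cover : ∀ {R : B → A → Set} (R? : ∀ k x → Dec (R k x)) (xs : List A) (ks : List B) {w} → (∀ x → 0ℚ ≤ w x) →
    (∀ {x} → x ∈ xs → ∃[ k ] k ∈ ks × R k x) → ∑ xs w ≤ ∑ ks (λ k → ∑ (filter (R? k) xs) w)
  ∑-cover R? xs ks {w} w≥0 cover = begin
    ∑ xs w                                      ≤⟨ ∑-mono xs single ⟩
    ∑ xs (λ x → ∑ ks (λ k → when (R? k x) (w x))) ≡⟨ ∑-swap xs ks _ ⟩
    ∑ ks (λ k → ∑ xs (λ x → when (R? k x) (w x))) ≡⟨ ∑-cong ks (λ k → ∑-filter (R? k) xs w) ⟨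
    ∑ ks (λ k → ∑ (filter (R? k) xs) w)         ∎
    where
    single : ∀ {x} → x ∈ xs → w x ≤ ∑ ks (λ k → when (R? k x) (w x))
    single {x} x∈ with k , k∈ , r ← cover x∈ = ≤-trans (≤-reflexive (sym (when-yes (R? k x) r)))
      (∈⇒≤∑ (λ k → when (R? k x) (w x)) (λ k → when-nonneg (R? k x) (w≥0 x)) k∈)

  -- Exchanging x and y turns the sum into a disjoint part of the full square.
  ∑-ordered-pairs : ∀ (xs : List A) (val : A → ℕ) (w : A → ℚ) → (∀ x → 0ℚ ≤ w x) →
    let S = ∑ xs (λ x → ∑ xs (λ y → when (val y ℕ.<? val x) (w x * w y))) in S + S ≤ ∑ xs w * ∑ xs w
  ∑-ordered-pairs xs val w w≥0 = begin
    ∑ xs (λ x → ∑ xs (λ y → t x y)) + ∑ xs (λ x → ∑ xs (λ y → t x y))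
      ≡⟨ cong (∑ xs (λ x → ∑ xs (λ y → t x y)) +_) (∑-swap xs xs t) ⟩
    ∑ xs (λ x → ∑ xs (λ y → t x y)) + ∑ xs (λ x → ∑ xs (λ y → t y x))
      ≡⟨ ∑-+ xs _ _ ⟨
    ∑ xs (λ x → ∑ xs (λ y → t x y) + ∑ xs (λ y → t y x))
      ≡⟨ ∑-cong xs (λ x → ∑-+ xs _ _) ⟨
    ∑ xs (λ x → ∑ xs (λ y → t x y + t y x))
      ≤⟨ ∑-mono xs (λ {x} _ → ∑-mono xs λ {y} _ → pointwise x y) ⟩
    ∑ xs (λ x → ∑ xs (λ y → w x * w y))
      ≡⟨ ∑-product xs xs w w ⟩
    ∑ xs w * ∑ xs w ∎
    where
    t : _ → _ → ℚ
    t x y = when (val y ℕ.<? val x) (w x * w y)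
    pointwise : ∀ x y → t x y + t y x ≤ w x * w y
    pointwise x y = when-+-≤ (val y ℕ.<? val x) (val x ℕ.<? val y) ℕ.<⇒≯ (*-comm (w y) (w x)) (*-nonneg (w≥0 x) (w≥0 y))

  fromℕ-+ : ∀ m n → fromℕ (m ℕ.+ n) ≡ fromℕ m + fromℕ n
  fromℕ-+ zero    n = sym (+-identityˡ (fromℕ n))
  fromℕ-+ (suc m) n = trans (fromℕ-suc (m ℕ.+ n)) (trans (cong (1ℚ +_) (fromℕ-+ m n))
    (trans (sym (+-assoc 1ℚ (fromℕ m) (fromℕ n))) (cong (_+ fromℕ n) (sym (fromℕ-suc m)))))

  fromℕ-* : ∀ m n → fromℕ (m ℕ.* n) ≡ fromℕ m * fromℕ n
  fromℕ-* zero    n = sym (*-zeroˡ (fromℕ n))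
  fromℕ-* (suc m) n = trans (fromℕ-+ n (m ℕ.* n)) (trans (cong (fromℕ n +_) (fromℕ-* m n))
    (trans (solve 2 (λ m n → n :+ m :* n := (con 1ℚ :+ m) :* n) refl (fromℕ m) (fromℕ n)) (cong (_* fromℕ n) (sym (fromℕ-suc m)))))

  0≤fromℕ : ∀ n → 0ℚ ≤ fromℕ n
  0≤fromℕ n = fromℕ-mono {0} {n} ℕ.z≤n

  ∑-fromℕ : ∀ (w : A → ℕ) xs → ∑ xs (fromℕ ∘ w) ≡ fromℕ (sum (map w xs))
  ∑-fromℕ w []       = refl
  ∑-fromℕ w (x ∷ xs) = trans (cong (fromℕ (w x) +_) (∑-fromℕ w xs)) (sym (fromℕ-+ (w x) _))

  -- inv 0 = 0
  inv : ℕ → ℚ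
  inv n = fromℕ n ⁻¹

  inv-nonneg : ∀ n → 0ℚ ≤ inv n
  inv-nonneg zero    = ≤-refl
  inv-nonneg (suc n) = <⇒≤ (⁻¹-pos (fromℕ-pos n))

  inv-inverse : ∀ n .{{_ : ℕ.NonZero n}} → fromℕ n * inv n ≡ 1ℚ
  inv-inverse (suc n) = ⁻¹-inverse (fromℕ-pos n)

  inv-antimono : ∀ {m n} .{{_ : ℕ.NonZero m}} → m ℕ.≤ n → inv n ≤ inv m
  inv-antimono {suc m} m≤n = ⁻¹-antimono (fromℕ-pos m) (fromℕ-mono m≤n)

  -- Holds without positivity because of the convention for `inv 0`, which saves side conditions
  -- when products are split.
  inv-* : ∀ m n → inv (m ℕ.* n) ≡ inv m * inv n
  inv-* zero    n       = sym (*-zeroˡ (inv n))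
  inv-* (suc m) zero    = trans (cong inv (ℕ.*-zeroʳ m)) (sym (*-zeroʳ (inv (suc m))))
  inv-* m@(suc _) n@(suc _) = begin-equality
    inv (m ℕ.* n)
      ≡⟨ solve 1 (λ i → i := i :* con 1ℚ :* con 1ℚ) refl (inv (m ℕ.* n)) ⟩
    inv (m ℕ.* n) * 1ℚ * 1ℚ
      ≡⟨ cong₂ (λ x y → inv (m ℕ.* n) * x * y) (inv-inverse m) (inv-inverse n) ⟨
    inv (m ℕ.* n) * (fromℕ m * inv m) * (fromℕ n * inv n)
      ≡⟨ solve 5 (λ i a x b y → i :* (a :* x) :* (b :* y) := (a :* b) :* i :* (x :* y)) refl (inv (m ℕ.* n)) (fromℕ m) (inv m) (fromℕ n) (inv n) ⟩
    fromℕ m * fromℕ n * inv (m ℕ.* n) * (inv m * inv n)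
      ≡⟨ cong (λ x → x * inv (m ℕ.* n) * (inv m * inv n)) (fromℕ-* m n) ⟨
    fromℕ (m ℕ.* n) * inv (m ℕ.* n) * (inv m * inv n)
      ≡⟨ cong (_* (inv m * inv n)) (inv-inverse (m ℕ.* n)) ⟩
    1ℚ * (inv m * inv n)
      ≡⟨ *-identityˡ _ ⟩
    inv m * inv n ∎

  *-cancel-inv : ∀ {a b} c .{{_ : ℕ.NonZero c}} → a ℕ.* c ℕ.≤ b → fromℕ a ≤ fromℕ b * inv c
  *-cancel-inv {a} {b} c h = begin
    fromℕ a                     ≡⟨ *-identityʳ (fromℕ a) ⟨
    fromℕ a * 1ℚ                ≡⟨ cong (fromℕ a *_) (inv-inverse c) ⟨
    fromℕ a * (fromℕ c * inv c) ≡⟨ *-assoc (fromℕ a) (fromℕ c) (inv c) ⟨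
    fromℕ a * fromℕ c * inv c   ≡⟨ cong (_* inv c) (fromℕ-* a c) ⟨
    fromℕ (a ℕ.* c) * inv c     ≤⟨ *-monoʳ-≤-nonNeg (inv c) {{nonNegative (inv-nonneg c)}} (fromℕ-mono h) ⟩
    fromℕ b * inv c             ∎

-- Counting the members of a residue class

module CountingSums where

  open import Defs using (module Rational)
  open Rational using (fromℕ)
  open import Data.Nat
  open import Data.Nat.Properties
  open import Data.Nat.Divisibility
  open import Data.Nat.DivMod
  open import Data.Nat.ListAction using (sum)
  open import Data.Nat.Coprimality as Coprime using (Coprime)
  open import Data.Nat.Tactic.RingSolver using (solve-∀)
  import Data.Integer as ℤ
  import Data.Integer.Divisibility.Signed as ℤ
  open import Data.Integer.Tactic.RingSolver as ℤ using ()
  open import Data.Rational as ℚ using (ℚ)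
  import Data.Rational.Properties as ℚ
  open import Data.List using (List; []; _∷_; map; length; filter)
  open import Data.List.Properties using (length-filter; filter-reject)
  open import Data.List.Membership.Propositional using (_∈_)
  open import Data.List.Membership.Propositional.Properties
  open import Data.List.Relation.Unary.All as All using ([]; _∷_)
  open import Data.List.Relation.Unary.Any using (here; there)
  open import Data.List.Relation.Unary.Unique.Propositional using (Unique)
  open import Data.Product using (_×_; _,_; proj₁)
  open import Data.Sum using (inj₁; inj₂)
  open import Function using (_∘_)
  open import Relation.Binary.PropositionalEquality
  open import Relation.Nullary using (Dec; yes; no)
  open Counting
  open Congruence
  open RationalSums

  range : ℕ → List ℕ
  range zero    = []
  range (suc n) = suc n ∷ range n

  ∈-range⁺ : ∀ {i n} → 0 < i → i ≤ n → i ∈ range n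
  ∈-range⁺ {suc _} {zero}  _ ()
  ∈-range⁺ {i} {suc n} 0<i i≤ with m≤n⇒m<n∨m≡n i≤
  ... | inj₁ (s≤s i≤n) = there (∈-range⁺ 0<i i≤n)
  ... | inj₂ refl      = here refl

  ∈-range⁻ : ∀ {i n} → i ∈ range n → 0 < i × i ≤ n
  ∈-range⁻ {n = suc n} (here refl) = z<s , ≤-refl
  ∈-range⁻ {n = suc n} (there i∈)  = let 0<i , i≤n = ∈-range⁻ i∈ in 0<i , m≤n⇒m≤1+n i≤n

  length-range : ∀ n → length (range n) ≡ n
  length-range zero    = refl
  length-range (suc n) = cong suc (length-range n)

  -- Entries that fail the test are dropped from the top. At the first that passes, at most as many
  -- entries remain as its own value, and `d` times that value is at most `L`.
  length-filter-*≤ : ∀ d L m → length (filter (λ u → d * u ≤? L) (range m)) * d ≤ L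
  length-filter-*≤ d L zero = z≤n
  length-filter-*≤ d L (suc m) = by (d * suc m ≤? L)
    where
    open ≤-Reasoning
    by : Dec (d * suc m ≤ L) → length (filter (λ u → d * u ≤? L) (range (suc m))) * d ≤ L
    by (no ¬le) = subst (λ us → length us * d ≤ L) (sym (filter-reject (λ u → d * u ≤? L) ¬le)) (length-filter-*≤ d L m)
    by (yes le) = begin
      length (filter (λ u → d * u ≤? L) (range (suc m))) * d ≤⟨ *-monoˡ-≤ d (length-filter (λ u → d * u ≤? L) (range (suc m))) ⟩
      length (range (suc m)) * d                             ≡⟨ cong (_* d) (length-range (suc m)) ⟩
      suc m * d                                              ≡⟨ *-comm (suc m) d ⟩
      d * suc m                                              ≤⟨ le ⟩
      L                                                      ∎

  coprime-n-1 : ∀ {r s n} .{{_ : NonZero n}} → r ∣ n → s ∣ n ∸ 1 → Coprime r s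
  coprime-n-1 {n = suc n} r∣n s∣n-1 {d} (d∣r , d∣s) =
    ∣1⇒≡1 (∣m+n∣m⇒∣n (subst (d ∣_) (+-comm 1 n) (∣-trans d∣r r∣n)) (∣-trans d∣s s∣n-1))

  -- Members are congruent to 0 modulo `r` and to 1 modulo `s`. The coprimality that combines the
  -- two comes from any single member, because `r` divides it and `s` divides its predecessor.
  class-congruent : ∀ {r s m n} .{{_ : NonZero m}} .{{_ : NonZero n}} →
    r ∣ m × s ∣ m ∸ 1 → r ∣ n × s ∣ n ∸ 1 → ℤ.+ m ≡ ℤ.+ n [mod r * s ]
  class-congruent {r} {s} {suc m} {suc n} (r∣m , s∣m) (r∣n , s∣n) = mod-* (coprime-n-1 r∣m s∣m)
    (mkMod (ℤ.∣m∣n⇒∣m-n {m = ℤ.+ suc m} {n = ℤ.+ suc n} (ℤ.∣ᵤ⇒∣ r∣m) (ℤ.∣ᵤ⇒∣ r∣n)))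
    (mkMod (subst (ℤ._∣_ (ℤ.+ s)) (lemma (ℤ.+ m) (ℤ.+ n)) (ℤ.∣m∣n⇒∣m-n {m = ℤ.+ m} {n = ℤ.+ n} (ℤ.∣ᵤ⇒∣ s∣m) (ℤ.∣ᵤ⇒∣ s∣n))))
    where
    lemma : ∀ m n → m ℤ.- n ≡ (ℤ.+ 1 ℤ.+ m) ℤ.- (ℤ.+ 1 ℤ.+ n)
    lemma = ℤ.solve-∀

  module _ {r s : ℕ} {ns : List ℕ} (unique : Unique ns)
    (class : ∀ {n} → n ∈ ns → 0 < n × r ∣ n × s ∣ n ∸ 1) where

    private
      congruent : ∀ {m n} → m ∈ ns → n ∈ ns → ℤ.+ m ≡ ℤ.+ n [mod r * s ]
      congruent m∈ n∈ with m>0 , cm ← class m∈ | n>0 , cn ← class n∈ =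
        class-congruent {{>-nonZero m>0}} {{>-nonZero n>0}} cm cn

    small-class-length : (∀ {n} → n ∈ ns → n ≤ r * s) → length ns ≤ 1
    small-class-length small = injection⇒length≤ {ys = 0 ∷ []} unique (λ _ → 0) (λ _ → here refl)
      λ m∈ n∈ _ → pred-equal (proj₁ (class m∈)) (proj₁ (class n∈)) (small m∈) (small n∈) (congruent m∈ n∈)
      where
      -- The members lie in 1, ..., k and not in 0, ..., k - 1, so it is the predecessors that are
      -- below the modulus.
      pred-equal : ∀ {m n k} → 0 < m → 0 < n → m ≤ k → n ≤ k → ℤ.+ m ≡ ℤ.+ n [mod k ] → m ≡ n
      pred-equal {suc m} {suc n} _ _ m≤ n≤ h = cong suc (∣-dist∧<⇒≡ (toℕ-mod h) m≤ n≤)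

    -- The quotient by r s separates members of the class. Being at least r s, they have quotients
    -- starting at 1, so there are at most X / (r s) of them, without the usual extra 1.
    large-class-length : ∀ {X} .{{_ : NonZero (r * s)}} → (∀ {n} → n ∈ ns → r * s ≤ n × n ≤ X) → length ns * (r * s) ≤ X
    large-class-length {X} large = begin
      length ns * (r * s)        ≤⟨ *-monoˡ-≤ (r * s) (injection⇒length≤ unique (_/ (r * s)) into inj) ⟩
      length (range (X / (r * s))) * (r * s) ≡⟨ cong (_* (r * s)) (length-range (X / (r * s))) ⟩
      X / (r * s) * (r * s)      ≤⟨ m/n*n≤m X (r * s) ⟩
      X                          ∎
      where
      open ≤-Reasoning
      into : ∀ {n} → n ∈ ns → n / (r * s) ∈ range (X / (r * s))
      into n∈ = let rs≤n , n≤X = large n∈ in ∈-range⁺ (m≥n⇒m/n>0 rs≤n) (/-monoˡ-≤ (r * s) n≤X)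
      inj : InjectiveOn (_/ (r * s)) ns
      inj {m} {n} m∈ n∈ eq = trans (m≡m%n+[m/n]*n m (r * s))
        (trans (cong₂ (λ x y → x + y * (r * s)) (mod⇒%≡ (r * s) (congruent m∈ n∈)) eq) (sym (m≡m%n+[m/n]*n n (r * s))))

  sum-bound : ∀ (w : ℕ → ℕ) δ {X} ns → (∀ {n} → n ∈ ns → w n * δ ≤ X) → sum (map w ns) * δ ≤ length ns * X
  sum-bound w δ []       h = z≤n
  sum-bound w δ {X} (n ∷ ns) h = begin
    (w n + sum (map w ns)) * δ     ≡⟨ *-distribʳ-+ δ (w n) (sum (map w ns)) ⟩
    w n * δ + sum (map w ns) * δ   ≤⟨ +-mono-≤ (h (here refl)) (sum-bound w δ ns (h ∘ there)) ⟩
    X + length ns * X              ∎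
    where open ≤-Reasoning

  -- Each weight is at most X / δ and there are at most Y / k members. It serves the small classes
  -- with k = Y = 1 and the large ones with k = r s and Y = X.
  ∑-bound : ∀ (w : ℕ → ℕ) δ k .{{_ : NonZero δ}} .{{_ : NonZero k}} {X Y} ns →
    (∀ {n} → n ∈ ns → w n * δ ≤ X) → length ns * k ≤ Y → ∑ ns (fromℕ ∘ w) ℚ.≤ fromℕ (Y * X) ℚ.* inv (k * δ)
  ∑-bound w δ k {X} {Y} ns h len = ℚ.≤-trans (ℚ.≤-reflexive (∑-fromℕ w ns))
    (*-cancel-inv {sum (map w ns)} {Y * X} (k * δ) {{m*n≢0 k δ}} (begin
      sum (map w ns) * (k * δ)   ≡⟨ lemma (sum (map w ns)) k δ ⟩
      sum (map w ns) * δ * k     ≤⟨ *-monoˡ-≤ k (sum-bound w δ ns h) ⟩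
      length ns * X * k          ≡⟨ lemma′ (length ns) X k ⟩
      length ns * k * X          ≤⟨ *-monoˡ-≤ X len ⟩
      Y * X                      ∎))
    where
    open ≤-Reasoning
    lemma : ∀ s k d → s * (k * d) ≡ s * d * k
    lemma = solve-∀
    lemma′ : ∀ s k d → s * k * d ≡ s * d * k
    lemma′ = solve-∀

-- Harmonic sums and sums of inverse squares

module Harmonic where

  open import Defs using (module Rational)
  open Rational using (fromℕ; fromℕ-suc; fromℕ-mono; *-mono; *-nonneg)
  open import Data.Nat as ℕ using (ℕ; zero; suc; s≤s; z≤n)
  import Data.Nat.Properties as ℕ
  open import Data.Integer using (+_)
  open import Data.Rational
  open import Data.Rational.Properties
  open import Data.Rational.Solver using (module +-*-Solver)
  open +-*-Solver
  open import Data.Product using (proj₂)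
  open import Data.Sum using (inj₁; inj₂)
  open import Relation.Binary.PropositionalEquality
  open import Relation.Nullary using (contradiction)
  open import Relation.Nullary.Decidable using (from-yes)
  open RationalSums
  open CountingSums using (range; ∈-range⁻)
  open ≤-Reasoning

  H : ℕ → ℚ
  H n = ∑ (range n) inv

  H-nonneg : ∀ n → 0ℚ ≤ H n
  H-nonneg n = ∑-nonneg (range n) inv-nonneg

  1≤H : ∀ {n} → 1 ℕ.≤ n → 1ℚ ≤ H n
  1≤H {suc zero}    _ = ≤-refl
  1≤H {suc (suc n)} _ = begin
    1ℚ                        ≡⟨ +-identityˡ 1ℚ ⟨
    0ℚ + 1ℚ                   ≤⟨ +-mono-≤ (inv-nonneg (suc (suc n))) (1≤H {suc n} (s≤s z≤n)) ⟩
    inv (suc (suc n)) + H (suc n) ∎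

  H-mono : ∀ {m n} → m ℕ.≤ n → H m ≤ H n
  H-mono {m} {n} m≤n = subst (λ k → H m ≤ H k) (ℕ.m∸n+n≡m m≤n) (go (n ℕ.∸ m))
    where
    go : ∀ j → H m ≤ H (j ℕ.+ m)
    go zero    = ≤-refl
    go (suc j) = begin
      H m                            ≡⟨ +-identityˡ (H m) ⟨
      0ℚ + H m                       ≤⟨ +-mono-≤ (inv-nonneg (suc (j ℕ.+ m))) (go j) ⟩
      inv (suc (j ℕ.+ m)) + H (j ℕ.+ m) ∎

  -- 1/(n+1)² ≤ 1/n - 1/(n+1), with the subtraction moved.
  inv-square-step : ∀ n .{{_ : ℕ.NonZero n}} → inv (suc n) * inv (suc n) + inv (suc n) ≤ inv n
  inv-square-step n@(suc k) = begin
    r * r + r            ≤⟨ +-monoˡ-≤ r (*-monoˡ-≤-nonNeg r {{nonNegative (inv-nonneg (suc n))}} (inv-antimono {n} {suc n} (ℕ.n≤1+n n))) ⟩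
    r * p + r            ≡⟨ cong (λ x → r * p + x) (*-identityʳ r) ⟨
    r * p + r * 1ℚ       ≡⟨ cong (λ x → r * p + r * x) (inv-inverse n) ⟨
    r * p + r * (fromℕ n * p) ≡⟨ solve 3 (λ r p n → r :* p :+ r :* (n :* p) := (con 1ℚ :+ n) :* r :* p) refl r p (fromℕ n) ⟩
    (1ℚ + fromℕ n) * r * p ≡⟨ cong (λ x → x * r * p) (fromℕ-suc n) ⟨
    fromℕ (suc n) * r * p ≡⟨ cong (_* p) (inv-inverse (suc n)) ⟩
    1ℚ * p               ≡⟨ *-identityˡ p ⟩
    p                    ∎
    where
    p = inv n
    r = inv (suc n)

  -- The reciprocal on the left is the bound for the missing tail; keeping it there makes the
  -- telescoping an induction. The constant is 1 + 1/4 + 1/9 + 1/3, the value at 3.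
  inverse-squares : ∀ j → ∑ (range (j ℕ.+ 3)) (λ d → inv d * inv d) + inv (j ℕ.+ 3) ≤ + 61 / 36
  inverse-squares zero    = from-yes (∑ (range 3) (λ d → inv d * inv d) + inv 3 ≤? + 61 / 36)
  inverse-squares (suc j) = begin
    (r * r + s) + r   ≡⟨ solve 2 (λ r s → (r :* r :+ s) :+ r := s :+ (r :* r :+ r)) refl r s ⟩
    s + (r * r + r)   ≤⟨ +-monoʳ-≤ s (inv-square-step (j ℕ.+ 3) {{ℕ.>-nonZero (ℕ.≤-trans (s≤s z≤n) (ℕ.m≤n+m 3 j))}}) ⟩
    s + inv (j ℕ.+ 3) ≤⟨ inverse-squares j ⟩
    + 61 / 36         ∎
    where
    r = inv (suc (j ℕ.+ 3))
    s = ∑ (range (j ℕ.+ 3)) (λ d → inv d * inv d)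

  -- (61/36)² < H₁₀
  inverse-squares² : ∀ {K} → 10 ℕ.≤ K → let Z = ∑ (range K) (λ d → inv d * inv d) in Z * Z ≤ H K
  inverse-squares² {K} 10≤K = begin
    Z * Z               ≤⟨ *-mono 0≤Z Z≤ 0≤Z Z≤ ⟩
    + 61 / 36 * (+ 61 / 36) ≤⟨ from-yes (+ 61 / 36 * (+ 61 / 36) ≤? H 10) ⟩
    H 10                ≤⟨ H-mono 10≤K ⟩
    H K                 ∎
    where
    Z = ∑ (range K) (λ d → inv d * inv d)
    0≤Z : 0ℚ ≤ Z
    0≤Z = ∑-nonneg (range K) λ d → *-nonneg (inv-nonneg d) (inv-nonneg d)
    Z≤ : Z ≤ + 61 / 36
    Z≤ = begin
      Z                 ≡⟨ +-identityʳ Z ⟨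
      Z + 0ℚ            ≤⟨ +-monoʳ-≤ Z (inv-nonneg K) ⟩
      Z + inv K         ≤⟨ subst (λ k → ∑ (range k) (λ d → inv d * inv d) + inv k ≤ + 61 / 36)
                             (ℕ.m∸n+n≡m (ℕ.≤-trans (ℕ.m≤m+n 3 7) 10≤K)) (inverse-squares (K ℕ.∸ 3)) ⟩
      + 61 / 36         ∎

  module _ (c T : ℕ) .{{_ : ℕ.NonZero T}} where

    private
      term : ℕ → ℚ
      term b = when (T ℕ.≤? c ℕ.* b) (inv b * inv b)
      bound : ℚ
      bound = fromℕ c * inv T + fromℕ c * inv T
      0≤c/T : 0ℚ ≤ fromℕ c * inv T
      0≤c/T = *-nonneg (0≤fromℕ c) (inv-nonneg T)
      0≤bound : 0ℚ ≤ bound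
      0≤bound = +-mono-≤ 0≤c/T 0≤c/T

      inv≤c/T : ∀ n → T ℕ.≤ c ℕ.* suc n → inv (suc n) ≤ fromℕ c * inv T
      inv≤c/T n h = begin
        inv (suc n)                             ≡⟨ *-identityˡ (inv (suc n)) ⟨
        1ℚ * inv (suc n)                        ≡⟨ cong (_* inv (suc n)) (inv-inverse T) ⟨
        fromℕ T * inv T * inv (suc n)           ≤⟨ *-monoʳ-≤-nonNeg (inv (suc n)) {{nonNegative (inv-nonneg (suc n))}}
                                                    (*-monoʳ-≤-nonNeg (inv T) {{nonNegative (inv-nonneg T)}} (fromℕ-mono h)) ⟩
        fromℕ (c ℕ.* suc n) * inv T * inv (suc n) ≡⟨ cong (λ x → x * inv T * inv (suc n)) (fromℕ-* c (suc n)) ⟩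
        fromℕ c * fromℕ (suc n) * inv T * inv (suc n) ≡⟨ solve 4 (λ c n t r → c :* n :* t :* r := (c :* t) :* (n :* r)) refl (fromℕ c) (fromℕ (suc n)) (inv T) (inv (suc n)) ⟩
        (fromℕ c * inv T) * (fromℕ (suc n) * inv (suc n)) ≡⟨ cong (λ x → fromℕ c * inv T * x) (inv-inverse (suc n)) ⟩
        (fromℕ c * inv T) * 1ℚ                  ≡⟨ *-identityʳ _ ⟩
        fromℕ c * inv T                         ∎

      zero-below : ∀ n → c ℕ.* n ℕ.< T → ∑ (range n) term ≤ 0ℚ
      zero-below n c*n<T = begin
        ∑ (range n) term        ≤⟨ ∑-mono (range n) (λ {b} b∈ → when-≤ (T ℕ.≤? c ℕ.* b) ≤-refl λ T≤cb →
                                     contradiction (ℕ.≤-trans T≤cb (ℕ.*-monoʳ-≤ c (proj₂ (∈-range⁻ b∈)))) (ℕ.<⇒≱ c*n<T)) ⟩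
        ∑ (range n) (λ _ → 0ℚ)  ≡⟨ ∑-0 (range n) ⟩
        0ℚ                      ∎

      step : ∀ n → T ℕ.≤ c ℕ.* n → ∑ (range n) term + inv n ≤ bound
      step zero h = contradiction (ℕ.≤-trans h (ℕ.≤-reflexive (ℕ.*-zeroʳ c))) (ℕ.<⇒≱ (ℕ.>-nonZero⁻¹ T))
      step (suc n) h with ℕ.≤-<-connex T (c ℕ.* n)
      ... | inj₁ T≤cn = begin
        (term (suc n) + S) + r ≤⟨ +-monoˡ-≤ r (+-monoˡ-≤ S (when-≤ (T ℕ.≤? c ℕ.* suc n) (*-nonneg (inv-nonneg (suc n)) (inv-nonneg (suc n))) λ _ → ≤-refl)) ⟩
        (r * r + S) + r        ≡⟨ solve 2 (λ r s → (r :* r :+ s) :+ r := s :+ (r :* r :+ r)) refl r S ⟩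
        S + (r * r + r)        ≤⟨ +-monoʳ-≤ S (inv-square-step n {{n≢0}}) ⟩
        S + inv n              ≤⟨ step n T≤cn ⟩
        bound                  ∎
        where
        S = ∑ (range n) term
        r = inv (suc n)
        n≢0 : ℕ.NonZero n
        n≢0 = ℕ.≢-nonZero λ { refl → ℕ.<⇒≱ (ℕ.>-nonZero⁻¹ T) (ℕ.≤-trans T≤cn (ℕ.≤-reflexive (ℕ.*-zeroʳ c))) }
      -- Here suc n is the threshold, the first index whose term counts. Its square 1/(n+1)² and the
      -- tail reserve 1/(n+1) are each at most 1/(n+1), hence at most c/T.
      ... | inj₂ cn<T = begin
        (term (suc n) + S) + r ≤⟨ +-monoˡ-≤ r (+-mono-≤ (when-≤ (T ℕ.≤? c ℕ.* suc n) (*-nonneg 0≤r 0≤r) λ _ → ≤-refl) (zero-below n cn<T)) ⟩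
        (r * r + 0ℚ) + r       ≡⟨ cong (_+ r) (+-identityʳ (r * r)) ⟩
        r * r + r              ≤⟨ +-monoˡ-≤ r (*-monoˡ-≤-nonNeg r {{nonNegative 0≤r}} (inv-antimono {1} {suc n} (s≤s z≤n))) ⟩
        r * 1ℚ + r             ≡⟨ cong (_+ r) (*-identityʳ r) ⟩
        r + r                  ≤⟨ +-mono-≤ (inv≤c/T n h) (inv≤c/T n h) ⟩
        bound                  ∎
        where
        S = ∑ (range n) term
        r = inv (suc n)
        0≤r = inv-nonneg (suc n)

    -- If b is the first index with T ≤ c b, its own term is at most 1/b and the later ones
    -- telescope to at most 1/b, while 1/b ≤ c/T. This is the origin of the factor 2 in the sum over
    -- n ≥ R.
    inverse-squares-tail : ∀ n → ∑ (range n) (λ b → when (T ℕ.≤? c ℕ.* b) (inv b * inv b)) ≤ fromℕ c * inv T + fromℕ c * inv T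
    inverse-squares-tail n with ℕ.≤-<-connex T (c ℕ.* n)
    ... | inj₂ cn<T = ≤-trans (zero-below n cn<T) 0≤bound
    ... | inj₁ T≤cn = begin
      ∑ (range n) term         ≡⟨ +-identityʳ _ ⟨
      ∑ (range n) term + 0ℚ    ≤⟨ +-monoʳ-≤ (∑ (range n) term) (inv-nonneg n) ⟩
      ∑ (range n) term + inv n ≤⟨ step n T≤cn ⟩
      bound                    ∎

-- The combinatorial estimate with natural parameters

module Estimate where

  open import Defs using (module Rational)
  open Rational using (fromℕ; *-mono; *-nonneg)
  open import Data.Nat
  open import Data.Nat.Properties
  open import Data.Nat.Divisibility
  open import Data.Nat.LCM using (lcm; lcm-least; gcd*lcm)
  open import Data.Nat.GCD using (gcd; gcd[m,n]∣m; gcd[m,n]∣n; gcd[m,n]≢0)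
  open import Data.Nat.Tactic.RingSolver using (solve-∀)
  open import Data.Bool using (Bool; true; false)
  open import Data.Rational as ℚ using (ℚ; ½; 0ℚ; 1ℚ)
  import Data.Rational.Properties as ℚ
  open import Data.Rational.Solver using (module +-*-Solver)
  open import Data.List using (List; _++_; map; length; filter; cartesianProduct)
  open import Data.List.Membership.Propositional using (_∈_)
  open import Data.List.Membership.Propositional.Properties
  open import Data.List.Relation.Unary.Unique.Propositional using (Unique)
  open import Data.List.Relation.Unary.Unique.Propositional.Properties using (filter⁺)
  open import Data.Product using (∃-syntax; _×_; _,_; proj₁; proj₂)
  open import Data.Sum using (inj₁; inj₂)
  open import Function using (_∘_)
  open import Relation.Binary.PropositionalEquality
  open import Relation.Nullary using (Dec)
  open import Relation.Nullary.Decidable using (_×-dec_)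
  open RationalSums
  open CountingSums
  open Harmonic

  -- Natural stand-ins: `w` for F, `L` for the bound on primes, `K` for L₁, `T` for M - 2 L. In the
  -- second case P - 1 = d u and Q - 1 = e v, so the primes themselves only occur through their
  -- successors.
  data Shape (w : ℕ → ℕ) (L K T n : ℕ) : Set where
    square : ∀ p → 0 < p → p ≤ L → T ≤ p * p → p * p ∣ n → w n * p ≤ n → Shape w L K T n
    twoPrimes : ∀ d u e v → 0 < d → 0 < u → 0 < e → 0 < v → d ≤ K → e ≤ K → d * u ≤ L → e * v < d * u →
      T ≤ d * u * (e * v) → suc (d * u) * suc (e * v) ∣ n → u ∣ n ∸ 1 → v ∣ n ∸ 1 → w n * (d * e) ≤ n → Shape w L K T n

  -- Collects the n with r ∣ n, n ≡ 1 (mod s) and w n ≤ n / δ, either those up to r s or those from r s on.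
  record Key : Set where
    constructor key
    field
      r s δ : ℕ
      small : Bool
  open Key

  -- The boundary belongs to both sides; a number there may be counted twice, which an upper bound
  -- tolerates.
  Side : Bool → ℕ → ℕ → Set
  Side true  n k = n ≤ k
  Side false n k = k ≤ n

  side? : ∀ b n k → Dec (Side b n k)
  side? true  n k = n ≤? k
  side? false n k = k ≤? n

  module _ (w : ℕ → ℕ) (X L K T : ℕ) .{{T≢0 : NonZero T}} where

    InClass : Key → ℕ → Set
    InClass k n = (r k ∣ n × s k ∣ n ∸ 1) × w n * δ k ≤ n × Side (small k) n (r k * s k)

    inClass? : ∀ k n → Dec (InClass k n)
    inClass? k n = (r k ∣? n ×-dec s k ∣? n ∸ 1) ×-dec w n * δ k ≤? n ×-dec side? (small k) n (r k * s k)

    module _ {ns : List ℕ} (unique : Unique ns) (bounds : ∀ {n} → n ∈ ns → 0 < n × n ≤ X) where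

      private
        classSum : Key → ℚ
        classSum k = ∑ (filter (inClass? k) ns) (fromℕ ∘ w)

        member : ∀ k {n} → n ∈ filter (inClass? k) ns → n ∈ ns × InClass k n
        member k = ∈-filter⁻ (inClass? k)

        weight : ∀ k {n} → n ∈ filter (inClass? k) ns → w n * δ k ≤ X
        weight k n∈ = let n∈ns , _ , h , _ = member k n∈ in ≤-trans h (proj₂ (bounds n∈ns))

        classes : ∀ k {n} → n ∈ filter (inClass? k) ns → 0 < n × r k ∣ n × s k ∣ n ∸ 1
        classes k n∈ = let n∈ns , c , _ = member k n∈ in proj₁ (bounds n∈ns) , c

      small-bound : ∀ r s δ .{{_ : NonZero δ}} → classSum (key r s δ true) ℚ.≤ fromℕ X ℚ.* inv δ
      small-bound r s δ = subst₂ (λ x y → classSum k ℚ.≤ fromℕ x ℚ.* inv y) (*-identityˡ X) (*-identityˡ δ)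
        (∑-bound w δ 1 (filter (inClass? k) ns) (weight k) (≤-trans (≤-reflexive (*-identityʳ _))
          (small-class-length (filter⁺ (inClass? k) unique) (classes k) λ n∈ → proj₂ (proj₂ (proj₂ (member k n∈))))))
        where k = key r s δ true

      large-bound : ∀ r s δ .{{_ : NonZero δ}} .{{_ : NonZero (r * s)}} →
        classSum (key r s δ false) ℚ.≤ fromℕ (X * X) ℚ.* inv (r * s * δ)
      large-bound r s δ = ∑-bound w δ (r * s) (filter (inClass? k) ns) (weight k)
        (large-class-length (filter⁺ (inClass? k) unique) (classes k)
          λ n∈ → let n∈ns , _ , _ , h = member k n∈ in h , proj₂ (bounds n∈ns))
        where k = key r s δ false

      -- With s = 1 nothing is asked of n - 1. Divisibility by p p forces n ≥ p p, so the large side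
      -- alone covers this case.
      squareKey : ℕ → Key
      squareKey p = key (p * p) 1 p false

      squares : List ℕ
      squares = filter (λ p → T ≤? p * p) (range L)

      -- A class contributes at most X² / p³. Trading p² for its lower bound `T` leaves the sum of 1
      -- / p over `squares`, bounded by a harmonic sum.
      squares-bound : ∑ squares (classSum ∘ squareKey) ℚ.≤ fromℕ (X * X) ℚ.* inv T ℚ.* H L
      squares-bound = begin
        ∑ squares (classSum ∘ squareKey)
          ≤⟨ ∑-mono squares bound ⟩
        ∑ squares (λ p → fromℕ (X * X) ℚ.* inv T ℚ.* inv p)
          ≡⟨ ∑-*ˡ squares (fromℕ (X * X) ℚ.* inv T) inv ⟩
        fromℕ (X * X) ℚ.* inv T ℚ.* ∑ squares inv
          ≡⟨ cong (λ x → fromℕ (X * X) ℚ.* inv T ℚ.* x) (∑-filter (λ p → T ≤? p * p) (range L) inv) ⟩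
        fromℕ (X * X) ℚ.* inv T ℚ.* ∑ (range L) (λ p → when (T ≤? p * p) (inv p))
          ≤⟨ ℚ.*-monoˡ-≤-nonNeg (fromℕ (X * X) ℚ.* inv T) {{ℚ.nonNegative (*-nonneg (0≤fromℕ (X * X)) (inv-nonneg T))}}
               (∑-mono (range L) λ {p} _ → when-≤ (T ≤? p * p) (inv-nonneg p) λ _ → ℚ.≤-refl) ⟩
        fromℕ (X * X) ℚ.* inv T ℚ.* H L ∎
        where
        open ℚ.≤-Reasoning
        bound : ∀ {p} → p ∈ squares → classSum (squareKey p) ℚ.≤ fromℕ (X * X) ℚ.* inv T ℚ.* inv p
        bound {p} p∈ with p∈range , T≤p² ← ∈-filter⁻ (λ p → T ≤? p * p) {xs = range L} p∈ = begin
          classSum (squareKey p)                  ≤⟨ large-bound (p * p) 1 p {{p≢0}} {{m*n≢0 (p * p) 1 {{m*n≢0 p p {{p≢0}} {{p≢0}}}}}} ⟩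
          fromℕ (X * X) ℚ.* inv (p * p * 1 * p)   ≤⟨ ℚ.*-monoˡ-≤-nonNeg (fromℕ (X * X)) {{ℚ.nonNegative (0≤fromℕ (X * X))}}
                                                       (inv-antimono {T * p} {{m*n≢0 T p {{T≢0}} {{p≢0}}}} (*-monoˡ-≤ p (≤-trans T≤p² (≤-reflexive (sym (*-identityʳ (p * p))))))) ⟩
          fromℕ (X * X) ℚ.* inv (T * p)           ≡⟨ cong (fromℕ (X * X) ℚ.*_) (inv-* T p) ⟩
          fromℕ (X * X) ℚ.* (inv T ℚ.* inv p)     ≡⟨ ℚ.*-assoc (fromℕ (X * X)) (inv T) (inv p) ⟨
          fromℕ (X * X) ℚ.* inv T ℚ.* inv p       ∎
          where
          p≢0 : NonZero p
          p≢0 = >-nonZero (proj₁ (∈-range⁻ p∈range))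

      factorPairs : List (ℕ × ℕ)
      factorPairs = filter (λ (d , u) → d * u ≤? L) (cartesianProduct (range K) (range L))

      smallPairs : List ((ℕ × ℕ) × (ℕ × ℕ))
      smallPairs = filter (λ ((d , u) , (e , v)) → e * v <? d * u) (cartesianProduct factorPairs factorPairs)

      smallKey : (ℕ × ℕ) × (ℕ × ℕ) → Key
      smallKey ((d , u) , (e , v)) = key (suc (d * u) * suc (e * v)) (lcm u v) (d * e) true

      private
        W : ℚ
        W = ∑ factorPairs (inv ∘ proj₁)

        Z : ℚ
        Z = ∑ (range K) (λ d → inv d ℚ.* inv d)

        -- For fixed d there are at most L / d values of u, each of weight 1 / d.
        W≤ : W ℚ.≤ fromℕ L ℚ.* Z
        W≤ = begin
          W
            ≡⟨ ∑-filter (λ (d , u) → d * u ≤? L) (cartesianProduct (range K) (range L)) _ ⟩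
          ∑ (cartesianProduct (range K) (range L)) (λ (d , u) → when (d * u ≤? L) (inv d))
            ≡⟨ ∑-cartesianProduct (range K) (range L) _ ⟩
          ∑ (range K) (λ d → ∑ (range L) (λ u → when (d * u ≤? L) (inv d)))
            ≡⟨ ∑-cong (range K) (λ d → ∑-filter (λ u → d * u ≤? L) (range L) (λ _ → inv d)) ⟨
          ∑ (range K) (λ d → ∑ (filter (λ u → d * u ≤? L) (range L)) (λ _ → inv d))
            ≡⟨ ∑-cong (range K) (λ d → ∑-const (filter (λ u → d * u ≤? L) (range L)) (inv d)) ⟩
          ∑ (range K) (λ d → fromℕ (length (filter (λ u → d * u ≤? L) (range L))) ℚ.* inv d)
            ≤⟨ ∑-mono (range K) bound ⟩
          ∑ (range K) (λ d → fromℕ L ℚ.* (inv d ℚ.* inv d))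
            ≡⟨ ∑-*ˡ (range K) (fromℕ L) _ ⟩
          fromℕ L ℚ.* Z ∎
          where
          open ℚ.≤-Reasoning
          bound : ∀ {d} → d ∈ range K → fromℕ (length (filter (λ u → d * u ≤? L) (range L))) ℚ.* inv d ℚ.≤ fromℕ L ℚ.* (inv d ℚ.* inv d)
          bound {d} d∈ = ℚ.≤-trans (ℚ.*-monoʳ-≤-nonNeg (inv d) {{ℚ.nonNegative (inv-nonneg d)}}
              (*-cancel-inv {length (filter (λ u → d * u ≤? L) (range L))} d {{>-nonZero (proj₁ (∈-range⁻ d∈))}} (length-filter-*≤ d L L)))
            (ℚ.≤-reflexive (ℚ.*-assoc (fromℕ L) (inv d) (inv d)))

        0≤W : 0ℚ ℚ.≤ W
        0≤W = ∑-nonneg factorPairs (inv-nonneg ∘ proj₁)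

      smallPairs-bound : 10 ≤ K → ∑ smallPairs (classSum ∘ smallKey) ℚ.≤ fromℕ X ℚ.* (fromℕ L ℚ.* fromℕ L) ℚ.* (½ ℚ.* H K)
      smallPairs-bound 10≤K = begin
        ∑ smallPairs (classSum ∘ smallKey)
          ≤⟨ ∑-mono smallPairs bound ⟩
        ∑ smallPairs (λ ((d , _) , (e , _)) → fromℕ X ℚ.* (inv d ℚ.* inv e))
          ≡⟨ ∑-*ˡ smallPairs (fromℕ X) _ ⟩
        fromℕ X ℚ.* ∑ smallPairs (λ ((d , _) , (e , _)) → inv d ℚ.* inv e)
          ≡⟨ cong (fromℕ X ℚ.*_) (trans (∑-filter (λ ((d , u) , (e , v)) → e * v <? d * u) (cartesianProduct factorPairs factorPairs) _)
               (∑-cartesianProduct factorPairs factorPairs _)) ⟩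
        fromℕ X ℚ.* S
          ≤⟨ ℚ.*-monoˡ-≤-nonNeg (fromℕ X) {{ℚ.nonNegative (0≤fromℕ X)}} S≤ ⟩
        fromℕ X ℚ.* (½ ℚ.* ((fromℕ L ℚ.* Z) ℚ.* (fromℕ L ℚ.* Z)))
          ≡⟨ solve 3 (λ x l z → x :* (con ½ :* ((l :* z) :* (l :* z))) := x :* (l :* l) :* (con ½ :* (z :* z))) refl (fromℕ X) (fromℕ L) Z ⟩
        fromℕ X ℚ.* (fromℕ L ℚ.* fromℕ L) ℚ.* (½ ℚ.* (Z ℚ.* Z))
          ≤⟨ ℚ.*-monoˡ-≤-nonNeg (fromℕ X ℚ.* (fromℕ L ℚ.* fromℕ L)) {{ℚ.nonNegative (*-nonneg (0≤fromℕ X) (*-nonneg (0≤fromℕ L) (0≤fromℕ L)))}}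
               (ℚ.*-monoˡ-≤-nonNeg ½ (inverse-squares² 10≤K)) ⟩
        fromℕ X ℚ.* (fromℕ L ℚ.* fromℕ L) ℚ.* (½ ℚ.* H K) ∎
        where
        open ℚ.≤-Reasoning
        open +-*-Solver
        S : ℚ
        S = ∑ factorPairs (λ (d , u) → ∑ factorPairs (λ (e , v) → when (e * v <? d * u) (inv d ℚ.* inv e)))
        S≤ : S ℚ.≤ ½ ℚ.* ((fromℕ L ℚ.* Z) ℚ.* (fromℕ L ℚ.* Z))
        S≤ = begin
          S                  ≡⟨ solve 1 (λ s → s := con ½ :* (s :+ s)) refl S ⟩
          ½ ℚ.* (S ℚ.+ S)    ≤⟨ ℚ.*-monoˡ-≤-nonNeg ½ (∑-ordered-pairs factorPairs (λ (d , u) → d * u) (inv ∘ proj₁) (inv-nonneg ∘ proj₁)) ⟩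
          ½ ℚ.* (W ℚ.* W)    ≤⟨ ℚ.*-monoˡ-≤-nonNeg ½ (*-mono 0≤W W≤ 0≤W W≤) ⟩
          ½ ℚ.* ((fromℕ L ℚ.* Z) ℚ.* (fromℕ L ℚ.* Z)) ∎
        d≢0 : ∀ {d u} → (d , u) ∈ factorPairs → NonZero d
        d≢0 du∈ = >-nonZero (proj₁ (∈-range⁻ (proj₁ (∈-cartesianProduct⁻ (range K) (range L)
          (proj₁ (∈-filter⁻ (λ (d , u) → d * u ≤? L) {xs = cartesianProduct (range K) (range L)} du∈))))))
        bound : ∀ {k} → k ∈ smallPairs → classSum (smallKey k) ℚ.≤ fromℕ X ℚ.* (inv (proj₁ (proj₁ k)) ℚ.* inv (proj₁ (proj₂ k)))
        bound {(d , u) , (e , v)} k∈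
          with du∈ , ev∈ ← ∈-cartesianProduct⁻ factorPairs factorPairs (proj₁ (∈-filter⁻ (λ ((d , u) , (e , v)) → e * v <? d * u) {xs = cartesianProduct factorPairs factorPairs} k∈))
          = ℚ.≤-trans (small-bound (suc (d * u) * suc (e * v)) (lcm u v) (d * e) {{m*n≢0 d e {{d≢0 du∈}} {{d≢0 ev∈}}}})
              (ℚ.≤-reflexive (cong (fromℕ X ℚ.*_) (inv-* d e)))

      Tuple : Set
      Tuple = ℕ × ℕ × ℕ × ℕ × ℕ

      -- Parametrises u = g a and v = g b, for which g a b is the least common multiple once a and b
      -- are coprime. Coprimality is not imposed on the tuples; the additional ones only enlarge the
      -- sum.
      largeKey : Tuple → Key
      largeKey (g , d , a , e , b) = key (suc (d * (g * a)) * suc (e * (g * b))) (g * a * b) (d * e) false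

      -- The condition is T ≤ (P - 1)(Q - 1), grouped as a constant times b. With b as the innermost
      -- variable, `inverse-squares-tail` then applies directly.
      allTuples largeTuples : List Tuple
      allTuples = cartesianProduct (range L) (cartesianProduct (range K) (cartesianProduct (range L) (cartesianProduct (range K) (range L))))
      largeTuples = filter (λ (g , d , a , e , b) → T ≤? g * (g * (d * (a * e))) * b) allTuples

      private
        Y : ℚ
        Y = fromℕ (X * X)

        0≤Y : 0ℚ ℚ.≤ Y
        0≤Y = 0≤fromℕ (X * X)

        -- Lowering P Q to (P - 1)(Q - 1) turns the denominator into the monomial g³ d² a² e² b²;
        -- writing it as z² g b² isolates b.
        key-bound : ∀ g d a e b → 0 < g → 0 < d → 0 < a → 0 < e → 0 < b →
          let z = g * (d * (a * e)) in
          classSum (largeKey (g , d , a , e , b)) ℚ.≤ Y ℚ.* inv (z * z * g) ℚ.* (inv b ℚ.* inv b)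
        key-bound g@(suc _) d@(suc _) a@(suc _) e@(suc _) b@(suc _) _ _ _ _ _ = begin
          classSum (largeKey (g , d , a , e , b))
            ≤⟨ large-bound (suc (d * (g * a)) * suc (e * (g * b))) (g * a * b) (d * e) ⟩
          Y ℚ.* inv (suc (d * (g * a)) * suc (e * (g * b)) * (g * a * b) * (d * e))
            ≤⟨ ℚ.*-monoˡ-≤-nonNeg Y {{ℚ.nonNegative 0≤Y}} (inv-antimono {z * z * g * (b * b)}
                 (≤-trans (≤-reflexive (rearrange g d a e b))
                   (*-monoˡ-≤ (d * e) (*-monoˡ-≤ (g * a * b) (*-mono-≤ (n≤1+n (d * (g * a))) (n≤1+n (e * (g * b)))))))) ⟩
          Y ℚ.* inv (z * z * g * (b * b))
            ≡⟨ cong (Y ℚ.*_) (trans (inv-* (z * z * g) (b * b)) (cong (inv (z * z * g) ℚ.*_) (inv-* b b))) ⟩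
          Y ℚ.* (inv (z * z * g) ℚ.* (inv b ℚ.* inv b))
            ≡⟨ ℚ.*-assoc Y _ _ ⟨
          Y ℚ.* inv (z * z * g) ℚ.* (inv b ℚ.* inv b) ∎
          where
          open ℚ.≤-Reasoning
          z = g * (d * (a * e))
          rearrange : ∀ g d a e b → g * (d * (a * e)) * (g * (d * (a * e))) * g * (b * b) ≡ d * (g * a) * (e * (g * b)) * (g * a * b) * (d * e)
          rearrange = solve-∀

        -- The tail bound for b contributes c = g z in the numerator. Against z² g this leaves 1 /
        -- z, a product of four plain reciprocals.
        inv-cancel : ∀ z g .{{_ : NonZero z}} .{{_ : NonZero g}} → inv (z * z * g) ℚ.* fromℕ (g * z) ≡ inv z
        inv-cancel z g = begin
          inv (z * z * g) ℚ.* fromℕ (g * z)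
            ≡⟨ cong₂ ℚ._*_ (trans (inv-* (z * z) g) (cong (ℚ._* inv g) (inv-* z z))) (fromℕ-* g z) ⟩
          inv z ℚ.* inv z ℚ.* inv g ℚ.* (fromℕ g ℚ.* fromℕ z)
            ≡⟨ solve 4 (λ i j g z → i :* i :* j :* (g :* z) := i :* (g :* j) :* (z :* i)) refl (inv z) (inv g) (fromℕ g) (fromℕ z) ⟩
          inv z ℚ.* (fromℕ g ℚ.* inv g) ℚ.* (fromℕ z ℚ.* inv z)
            ≡⟨ cong₂ (λ x y → inv z ℚ.* x ℚ.* y) (inv-inverse g) (inv-inverse z) ⟩
          inv z ℚ.* 1ℚ ℚ.* 1ℚ
            ≡⟨ trans (ℚ.*-identityʳ _) (ℚ.*-identityʳ _) ⟩
          inv z ∎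
          where
          open ≡-Reasoning
          open +-*-Solver

        inner : ∀ g d a e → 0 < g → 0 < d → 0 < a → 0 < e →
          ∑ (range L) (λ b → when (T ≤? g * (g * (d * (a * e))) * b) (classSum (largeKey (g , d , a , e , b))))
          ℚ.≤ (Y ℚ.* inv T ℚ.+ Y ℚ.* inv T) ℚ.* (inv g ℚ.* (inv d ℚ.* (inv a ℚ.* inv e)))
        inner g d a e g>0 d>0 a>0 e>0 = begin
          ∑ (range L) (λ b → when (T ≤? c * b) (classSum (largeKey (g , d , a , e , b))))
            ≤⟨ ∑-mono (range L) (λ {b} b∈ → when-mono (T ≤? c * b) λ _ → key-bound g d a e b g>0 d>0 a>0 e>0 (proj₁ (∈-range⁻ b∈))) ⟩
          ∑ (range L) (λ b → when (T ≤? c * b) (Y ℚ.* I ℚ.* (inv b ℚ.* inv b)))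
            ≡⟨ ∑-cong (range L) (λ b → when-* (T ≤? c * b) (Y ℚ.* I) (inv b ℚ.* inv b)) ⟩
          ∑ (range L) (λ b → Y ℚ.* I ℚ.* when (T ≤? c * b) (inv b ℚ.* inv b))
            ≡⟨ ∑-*ˡ (range L) (Y ℚ.* I) _ ⟩
          Y ℚ.* I ℚ.* ∑ (range L) (λ b → when (T ≤? c * b) (inv b ℚ.* inv b))
            ≤⟨ ℚ.*-monoˡ-≤-nonNeg (Y ℚ.* I) {{ℚ.nonNegative (*-nonneg 0≤Y (inv-nonneg (z * z * g)))}} (inverse-squares-tail c T L) ⟩
          Y ℚ.* I ℚ.* (fromℕ c ℚ.* inv T ℚ.+ fromℕ c ℚ.* inv T)
            ≡⟨ solve 4 (λ y i c t → y :* i :* (c :* t :+ c :* t) := (y :* t :+ y :* t) :* (i :* c)) refl Y I (fromℕ c) (inv T) ⟩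
          (Y ℚ.* inv T ℚ.+ Y ℚ.* inv T) ℚ.* (I ℚ.* fromℕ c)
            ≡⟨ cong ((Y ℚ.* inv T ℚ.+ Y ℚ.* inv T) ℚ.*_) (trans (inv-cancel z g {{z≢0}} {{>-nonZero g>0}})
                 (trans (inv-* g (d * (a * e))) (cong (inv g ℚ.*_) (trans (inv-* d (a * e)) (cong (inv d ℚ.*_) (inv-* a e)))))) ⟩
          (Y ℚ.* inv T ℚ.+ Y ℚ.* inv T) ℚ.* (inv g ℚ.* (inv d ℚ.* (inv a ℚ.* inv e))) ∎
          where
          open ℚ.≤-Reasoning
          open +-*-Solver
          z = g * (d * (a * e))
          c = g * z
          I = inv (z * z * g)
          z≢0 : NonZero z
          z≢0 = m*n≢0 g _ {{>-nonZero g>0}} {{m*n≢0 d _ {{>-nonZero d>0}} {{m*n≢0 a e {{>-nonZero a>0}} {{>-nonZero e>0}}}}}}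

      -- After the sum over b the weight is 1 / (g d a e) up to the constant 2 X² / T, so the
      -- remaining sum splits into four harmonic sums, for g and a up to `L` and for d and e up to
      -- `K`.
      largeTuples-bound : ∑ largeTuples (classSum ∘ largeKey) ℚ.≤
        (Y ℚ.* inv T ℚ.+ Y ℚ.* inv T) ℚ.* (H L ℚ.* (H K ℚ.* (H L ℚ.* H K)))
      largeTuples-bound = begin
        ∑ largeTuples (classSum ∘ largeKey)
          ≡⟨ ∑-filter (λ (g , d , a , e , b) → T ≤? g * (g * (d * (a * e))) * b) allTuples _ ⟩
        ∑ allTuples f
          ≡⟨ nested ⟩
        ∑ (range L) (λ g → ∑ (range K) (λ d → ∑ (range L) (λ a → ∑ (range K) (λ e → ∑ (range L) (λ b → f (g , d , a , e , b))))))
          ≤⟨ ∑-mono (range L) (λ {g} g∈ → ∑-mono (range K) (λ {d} d∈ → ∑-mono (range L) (λ {a} a∈ → ∑-mono (range K) (λ {e} e∈ →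
               inner g d a e (pos g∈) (pos d∈) (pos a∈) (pos e∈))))) ⟩
        ∑ (range L) (λ g → ∑ (range K) (λ d → ∑ (range L) (λ a → ∑ (range K) (λ e → c ℚ.* (inv g ℚ.* (inv d ℚ.* (inv a ℚ.* inv e)))))))
          ≡⟨ factor ⟩
        c ℚ.* (H L ℚ.* (H K ℚ.* (H L ℚ.* H K))) ∎
        where
        open ℚ.≤-Reasoning
        c = Y ℚ.* inv T ℚ.+ Y ℚ.* inv T
        pos : ∀ {i n} → i ∈ range n → 0 < i
        pos i∈ = proj₁ (∈-range⁻ i∈)
        f : Tuple → ℚ
        f (g , d , a , e , b) = when (T ≤? g * (g * (d * (a * e))) * b) (classSum (largeKey (g , d , a , e , b)))
        nested : ∑ allTuples f ≡ ∑ (range L) (λ g → ∑ (range K) (λ d → ∑ (range L) (λ a → ∑ (range K) (λ e → ∑ (range L) (λ b → f (g , d , a , e , b))))))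
        nested = trans (∑-cartesianProduct (range L) _ f) (∑-cong (range L) λ g →
          trans (∑-cartesianProduct (range K) _ (λ x → f (g , x))) (∑-cong (range K) λ d →
          trans (∑-cartesianProduct (range L) _ (λ x → f (g , d , x))) (∑-cong (range L) λ a →
          ∑-cartesianProduct (range K) (range L) (λ x → f (g , d , a , x)))))
        factor : ∑ (range L) (λ g → ∑ (range K) (λ d → ∑ (range L) (λ a → ∑ (range K) (λ e → c ℚ.* (inv g ℚ.* (inv d ℚ.* (inv a ℚ.* inv e)))))))
          ≡ c ℚ.* (H L ℚ.* (H K ℚ.* (H L ℚ.* H K)))
        factor = trans (∑-cong (range L) λ g → trans (∑-cong (range K) λ d → trans (∑-cong (range L) λ a →
              trans (∑-*ˡ (range K) c _) (cong (c ℚ.*_) (trans (∑-*ˡ (range K) (inv g) _) (cong (inv g ℚ.*_) (∑-*ˡ (range K) (inv d) _)))))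
            (trans (∑-*ˡ (range L) c _) (cong (c ℚ.*_) (trans (∑-*ˡ (range L) (inv g) _) (cong (inv g ℚ.*_) (trans (∑-*ˡ (range L) (inv d) _) (cong (inv d ℚ.*_) (∑-product (range L) (range K) inv inv))))))))
            (trans (∑-*ˡ (range K) c _) (cong (c ℚ.*_) (trans (∑-*ˡ (range K) (inv g) _) (cong (inv g ℚ.*_) (∑-*ʳ (range K) (H L ℚ.* H K) inv))))))
          (trans (∑-*ˡ (range L) c _) (cong (c ℚ.*_) (∑-*ʳ (range L) (H K ℚ.* (H L ℚ.* H K)) inv)))

      keys : List Key
      keys = map squareKey squares ++ map smallKey smallPairs ++ map largeKey largeTuples

      private
        cover : ∀ {n} → 0 < n → Shape w L K T n → ∃[ k ] k ∈ keys × InClass k n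
        cover {n} n>0 (square p p>0 p≤L T≤p² p²∣n wp≤n) = squareKey p ,
          ∈-++⁺ˡ (∈-map⁺ squareKey (∈-filter⁺ (λ p → T ≤? p * p) (∈-range⁺ p>0 p≤L) T≤p²)) ,
          (p²∣n , 1∣ (n ∸ 1)) , wp≤n , ≤-trans (≤-reflexive (*-identityʳ (p * p))) (∣⇒≤ {{>-nonZero n>0}} p²∣n)
        cover {n} n>0 (twoPrimes d u e v d>0 u>0 e>0 v>0 d≤K e≤K du≤L ev<du T≤ pq∣n u∣ v∣ wde≤n)
          with ≤-total n (suc (d * u) * suc (e * v) * lcm u v)
        ... | inj₁ n≤ = smallKey ((d , u) , (e , v)) ,
          ∈-++⁺ʳ (map squareKey squares) (∈-++⁺ˡ (∈-map⁺ smallKey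
            (∈-filter⁺ (λ ((d , u) , (e , v)) → e * v <? d * u) (∈-cartesianProduct⁺ (pair d>0 u>0 d≤K du≤L) (pair e>0 v>0 e≤K ev≤L)) ev<du))) ,
          (pq∣n , lcm-least u∣ v∣) , wde≤n , n≤
          where
          ev≤L = ≤-trans (<⇒≤ ev<du) du≤L
          pair : ∀ {d u} → 0 < d → 0 < u → d ≤ K → d * u ≤ L → (d , u) ∈ factorPairs
          pair {d} {u} d>0 u>0 d≤K du≤L = ∈-filter⁺ (λ (d , u) → d * u ≤? L)
            (∈-cartesianProduct⁺ (∈-range⁺ d>0 d≤K) (∈-range⁺ u>0 (≤-trans (m≤n*m u d {{>-nonZero d>0}}) du≤L))) du≤L
        ... | inj₂ ≤n with gcd[m,n]∣m u v | gcd[m,n]∣n u v | gcd*lcm u v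
        -- Since g times the least common multiple is u v, cancelling g identifies it with g a b,
        -- and n falls under a `largeKey`.
        ... | divides a u≡ | divides b v≡ | gl≡ = largeKey (g , d , a , e , b) ,
          ∈-++⁺ʳ (map squareKey squares) (∈-++⁺ʳ (map smallKey smallPairs) (∈-map⁺ largeKey
            (∈-filter⁺ (λ (g , d , a , e , b) → T ≤? g * (g * (d * (a * e))) * b)
              (∈-cartesianProduct⁺ (∈-range⁺ g>0 (≤-trans g≤u u≤L)) (∈-cartesianProduct⁺ (∈-range⁺ d>0 d≤K)
                (∈-cartesianProduct⁺ (∈-range⁺ a>0 (≤-trans a≤u u≤L)) (∈-cartesianProduct⁺ (∈-range⁺ e>0 e≤K)
                  (∈-range⁺ b>0 (≤-trans b≤v v≤L))))))
              (≤-trans T≤ (≤-reflexive (trans (cong₂ (λ x y → d * x * (e * y)) u≡′ v≡′) (rearrange g d a e b))))))) ,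
          (subst₂ (λ x y → suc (d * x) * suc (e * y) ∣ n) u≡′ v≡′ pq∣n , subst (_∣ n ∸ 1) lcm≡ (lcm-least u∣ v∣)) , wde≤n ,
          ≤-trans (≤-reflexive (sym (trans (cong₂ (λ x y → suc (d * x) * suc (e * y) * lcm u v) u≡′ v≡′)
            (cong (suc (d * (g * a)) * suc (e * (g * b)) *_) lcm≡)))) ≤n
          where
          g = gcd u v
          u≡′ : u ≡ g * a
          u≡′ = trans u≡ (*-comm a g)
          v≡′ : v ≡ g * b
          v≡′ = trans v≡ (*-comm b g)
          g>0 : 0 < g
          g>0 = n≢0⇒n>0 (gcd[m,n]≢0 u v (inj₁ (>⇒≢ u>0)))
          a>0 : 0 < a
          a>0 = n≢0⇒n>0 λ { refl → >⇒≢ u>0 u≡ }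
          b>0 : 0 < b
          b>0 = n≢0⇒n>0 λ { refl → >⇒≢ v>0 v≡ }
          g≤u : g ≤ u
          g≤u = ≤-trans (m≤m*n g a {{>-nonZero a>0}}) (≤-reflexive (sym u≡′))
          a≤u : a ≤ u
          a≤u = ≤-trans (m≤m*n a g {{>-nonZero g>0}}) (≤-reflexive (sym u≡))
          b≤v : b ≤ v
          b≤v = ≤-trans (m≤m*n b g {{>-nonZero g>0}}) (≤-reflexive (sym v≡))
          u≤L : u ≤ L
          u≤L = ≤-trans (m≤n*m u d {{>-nonZero d>0}}) du≤L
          v≤L : v ≤ L
          v≤L = ≤-trans (m≤n*m v e {{>-nonZero e>0}}) (≤-trans (<⇒≤ ev<du) du≤L)
          lcm≡ : lcm u v ≡ g * a * b
          lcm≡ = *-cancelˡ-≡ (lcm u v) (g * a * b) g {{>-nonZero g>0}}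
            (trans gl≡ (trans (cong₂ _*_ u≡′ v≡′) (lemma g a b)))
            where
            lemma : ∀ g a b → g * a * (g * b) ≡ g * (g * a * b)
            lemma = solve-∀
          rearrange : ∀ g d a e b → d * (g * a) * (e * (g * b)) ≡ g * (g * (d * (a * e))) * b
          rearrange = solve-∀

      -- The weight is still arbitrary: all that enters about F is recorded in `Shape`. The three
      -- kinds of keys give the three contributions.
      ∑-shapes-bound : 10 ≤ K → (∀ {n} → n ∈ ns → Shape w L K T n) →
        ∑ ns (fromℕ ∘ w) ℚ.≤ fromℕ X ℚ.* (fromℕ L ℚ.* fromℕ L) ℚ.* (½ ℚ.* H K)
          ℚ.+ fromℕ (X * X) ℚ.* inv T ℚ.* (H L ℚ.+ ((H L ℚ.* H K) ℚ.* (H L ℚ.* H K) ℚ.+ (H L ℚ.* H K) ℚ.* (H L ℚ.* H K)))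
      ∑-shapes-bound 10≤K shapes = begin
        ∑ ns (fromℕ ∘ w)
          ≤⟨ ∑-cover inClass? ns keys (0≤fromℕ ∘ w) (λ n∈ → cover (proj₁ (bounds n∈)) (shapes n∈)) ⟩
        ∑ keys classSum
          ≡⟨ trans (∑-++ (map squareKey squares) _ classSum) (cong₂ ℚ._+_ (∑-map squareKey squares classSum)
               (trans (∑-++ (map smallKey smallPairs) _ classSum) (cong₂ ℚ._+_ (∑-map smallKey smallPairs classSum) (∑-map largeKey largeTuples classSum)))) ⟩
        ∑ squares (classSum ∘ squareKey) ℚ.+ (∑ smallPairs (classSum ∘ smallKey) ℚ.+ ∑ largeTuples (classSum ∘ largeKey))
          ≤⟨ ℚ.+-mono-≤ squares-bound (ℚ.+-mono-≤ (smallPairs-bound 10≤K) largeTuples-bound) ⟩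
        Y ℚ.* inv T ℚ.* H L ℚ.+ (B₁ ℚ.+ (Y ℚ.* inv T ℚ.+ Y ℚ.* inv T) ℚ.* (H L ℚ.* (H K ℚ.* (H L ℚ.* H K))))
          ≡⟨ solve 5 (λ y t l k b → y :* t :* l :+ (b :+ (y :* t :+ y :* t) :* (l :* (k :* (l :* k))))
                       := b :+ y :* t :* (l :+ ((l :* k) :* (l :* k) :+ (l :* k) :* (l :* k)))) refl Y (inv T) (H L) (H K) B₁ ⟩
        B₁ ℚ.+ Y ℚ.* inv T ℚ.* (H L ℚ.+ ((H L ℚ.* H K) ℚ.* (H L ℚ.* H K) ℚ.+ (H L ℚ.* H K) ℚ.* (H L ℚ.* H K))) ∎
        where
        open ℚ.≤-Reasoning
        open +-*-Solver
        B₁ = fromℕ X ℚ.* (fromℕ L ℚ.* fromℕ L) ℚ.* (½ ℚ.* H K)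

-- Harmonic numbers against Riemann sums of the logarithm

module LogHarmonic where

  open import Defs using (module Rational)
  open Rational using (fromℕ; _⁻¹; fromℕ-suc; fromℕ-mono; ⁻¹-pos; ⁻¹-antimono; *-mono; *-nonneg; 0<1; 0≤b-a; 1≤fromℕ-suc; riemann; mid≥; mid≤)
  open import Data.Nat as ℕ using (ℕ; zero; suc)
  import Data.Nat.Properties as ℕ
  open import Data.Rational
  open import Data.Rational.Properties
  open import Data.Rational.Solver using (module +-*-Solver)
  open +-*-Solver
  open import Data.Sum using (inj₁; inj₂)
  open import Relation.Binary.PropositionalEquality
  open RationalSums
  open Harmonic
  open ≤-Reasoning

  -- "The derivative of f at t is at most 1/t".
  SubLog : (ℚ → ℚ) → Set
  SubLog f = ∀ {a b} → 0ℚ < a → a ≤ b → f b - f a ≤ (b - a) * a ⁻¹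

  -- Increments of `f` add up over the two halves, and on a piece that is not divided further the
  -- left-endpoint term is exactly the bound that `SubLog` provides.
  subLog≤riemann : ∀ {f} → SubLog f → ∀ n {a b} → 0ℚ < a → a ≤ b → f b - f a ≤ riemann n a b
  subLog≤riemann sub zero 0<a a≤b = sub 0<a a≤b
  subLog≤riemann {f} sub (suc n) {a} {b} 0<a a≤b = begin
    f b - f a                         ≡⟨ solve 3 (λ a b c → b :- a := (c :- a) :+ (b :- c)) refl (f a) (f b) (f c) ⟩
    (f c - f a) + (f b - f c)         ≤⟨ +-mono-≤ (subLog≤riemann {f} sub n 0<a a≤c) (subLog≤riemann {f} sub n (<-≤-trans 0<a a≤c) (mid≤ a≤b ≤-refl)) ⟩
    riemann n a c + riemann n c b     ∎
    where
    c = ½ * (a + b)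
    a≤c = mid≥ ≤-refl a≤b

  -- Λ j t = ∫₁ᵗ ds/⌈s⌉ for t ≤ suc j, constant from there on.
  Λ : ℕ → ℚ → ℚ
  Λ zero    t = 0ℚ
  Λ (suc j) t = Λ j (t ⊓ k) + ((t ⊔ k) ⊓ fromℕ (suc (suc j)) - k) * inv (suc (suc j))
    where k = fromℕ (suc j)

  module _ (j : ℕ) where

    private
      k m c : ℚ
      k = fromℕ (suc j)
      m = fromℕ (suc (suc j))
      c = inv (suc (suc j))
      k≤m : k ≤ m
      k≤m = fromℕ-mono (ℕ.n≤1+n (suc j))
      0≤c = inv-nonneg (suc (suc j))

    Λ-below : ∀ {t} → t ≤ k → Λ (suc j) t ≡ Λ j t
    Λ-below {t} t≤k = begin-equality
      Λ j (t ⊓ k) + ((t ⊔ k) ⊓ m - k) * c ≡⟨ cong₂ (λ x y → Λ j x + (y ⊓ m - k) * c) (p≤q⇒p⊓q≡p t≤k) (p≤q⇒p⊔q≡q t≤k) ⟩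
      Λ j t + (k ⊓ m - k) * c             ≡⟨ cong (λ y → Λ j t + (y - k) * c) (p≤q⇒p⊓q≡p k≤m) ⟩
      Λ j t + (k - k) * c                 ≡⟨ solve 3 (λ a k c → a :+ (k :- k) :* c := a) refl (Λ j t) k c ⟩
      Λ j t                               ∎

    Λ-above : ∀ {t} → k ≤ t → Λ (suc j) t ≡ Λ j k + (t ⊓ m - k) * c
    Λ-above {t} k≤t = cong₂ (λ x y → Λ j x + (y ⊓ m - k) * c) (p≥q⇒p⊓q≡q k≤t) (p≥q⇒p⊔q≡p k≤t)

    private
      ⁻¹-nonneg : ∀ {a} → 0ℚ < a → 0ℚ ≤ a ⁻¹
      ⁻¹-nonneg 0<a = <⇒≤ (⁻¹-pos 0<a)

      -- Up to `m` the slope is 1 / m, at most 1 / a; beyond `m` nothing is added. A separate start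
      -- `a₀` is allowed because the interval may be cut at `k` while the bound still refers to the
      -- reciprocal of its original left end.
      clamp-step : ∀ {a a₀ b} → 0ℚ < a → a ≤ a₀ → a₀ ≤ b → (b ⊓ m - a₀ ⊓ m) * c ≤ (b - a₀) * a ⁻¹
      clamp-step {a} {a₀} {b} 0<a a≤a₀ a₀≤b with ≤-total a₀ m
      ... | inj₁ a₀≤m = begin
        (b ⊓ m - a₀ ⊓ m) * c ≡⟨ cong (λ x → (b ⊓ m - x) * c) (p≤q⇒p⊓q≡p a₀≤m) ⟩
        (b ⊓ m - a₀) * c     ≤⟨ *-mono (0≤b-a (⊓-glb a₀≤b a₀≤m)) (+-monoˡ-≤ (- a₀) (p⊓q≤p b m)) 0≤c (⁻¹-antimono 0<a (≤-trans a≤a₀ a₀≤m)) ⟩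
        (b - a₀) * a ⁻¹      ∎
      ... | inj₂ m≤a₀ = begin
        (b ⊓ m - a₀ ⊓ m) * c ≡⟨ cong₂ (λ x y → (x - y) * c) (p≥q⇒p⊓q≡q (≤-trans m≤a₀ a₀≤b)) (p≥q⇒p⊓q≡q m≤a₀) ⟩
        (m - m) * c          ≡⟨ solve 2 (λ m c → (m :- m) :* c := con 0ℚ) refl m c ⟩
        0ℚ                   ≤⟨ *-nonneg (0≤b-a a₀≤b) (⁻¹-nonneg 0<a) ⟩
        (b - a₀) * a ⁻¹      ∎

    -- If `k` lies inside the interval, the increment is split there: the part on the left obeys the
    -- bound for `Λ j`, the part on the right is a `clamp-step`.
    Λ-step-subLog : SubLog (Λ j) → SubLog (Λ (suc j))
    Λ-step-subLog sub {a} {b} 0<a a≤b with ≤-total b k | ≤-total k a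
    ... | inj₁ b≤k | _ = begin
      Λ (suc j) b - Λ (suc j) a ≡⟨ cong₂ _-_ (Λ-below b≤k) (Λ-below (≤-trans a≤b b≤k)) ⟩
      Λ j b - Λ j a             ≤⟨ sub 0<a a≤b ⟩
      (b - a) * a ⁻¹            ∎
    ... | inj₂ k≤b | inj₁ k≤a = begin
      Λ (suc j) b - Λ (suc j) a ≡⟨ cong₂ _-_ (Λ-above k≤b) (Λ-above k≤a) ⟩
      (Λ j k + (b ⊓ m - k) * c) - (Λ j k + (a ⊓ m - k) * c)
        ≡⟨ solve 5 (λ l b a k c → (l :+ (b :- k) :* c) :- (l :+ (a :- k) :* c) := (b :- a) :* c) refl (Λ j k) (b ⊓ m) (a ⊓ m) k c ⟩
      (b ⊓ m - a ⊓ m) * c       ≤⟨ clamp-step 0<a ≤-refl a≤b ⟩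
      (b - a) * a ⁻¹            ∎
    ... | inj₂ k≤b | inj₂ a≤k = begin
      Λ (suc j) b - Λ (suc j) a ≡⟨ cong₂ _-_ (Λ-above k≤b) (Λ-below a≤k) ⟩
      (Λ j k + (b ⊓ m - k) * c) - Λ j a
        ≡⟨ solve 3 (λ p q r → (p :+ q) :- r := (p :- r) :+ q) refl (Λ j k) ((b ⊓ m - k) * c) (Λ j a) ⟩
      (Λ j k - Λ j a) + (b ⊓ m - k) * c
        ≡⟨ cong (λ x → (Λ j k - Λ j a) + (b ⊓ m - x) * c) (p≤q⇒p⊓q≡p k≤m) ⟨
      (Λ j k - Λ j a) + (b ⊓ m - k ⊓ m) * c
        ≤⟨ +-mono-≤ (sub 0<a a≤k) (clamp-step 0<a a≤k k≤b) ⟩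
      (k - a) * a ⁻¹ + (b - k) * a ⁻¹
        ≡⟨ solve 4 (λ a b k i → (k :- a) :* i :+ (b :- k) :* i := (b :- a) :* i) refl a b k (a ⁻¹) ⟩
      (b - a) * a ⁻¹ ∎

  Λ-subLog : ∀ j → SubLog (Λ j)
  Λ-subLog zero    {a} {b} 0<a a≤b = *-nonneg (0≤b-a a≤b) (<⇒≤ (⁻¹-pos 0<a))
  Λ-subLog (suc j) = Λ-step-subLog j (Λ-subLog j)

  Λ-1 : ∀ j → Λ j 1ℚ ≡ 0ℚ
  Λ-1 zero    = refl
  Λ-1 (suc j) = trans (Λ-below j (1≤fromℕ-suc j)) (Λ-1 j)

  -- The unit interval ending at an integer contributes the reciprocal of that integer; starting
  -- from 1, this yields the harmonic sum without its first term.
  Λ-end : ∀ j {t} → fromℕ (suc j) ≤ t → Λ j t ≡ H (suc j) - 1ℚ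
  Λ-end zero    _ = refl
  Λ-end (suc j) {t} m≤t = begin-equality
    Λ (suc j) t                ≡⟨ Λ-above j (≤-trans k≤m m≤t) ⟩
    Λ j k + (t ⊓ m - k) * c    ≡⟨ cong₂ (λ x y → x + (y - k) * c) (Λ-end j ≤-refl) (p≥q⇒p⊓q≡q m≤t) ⟩
    (H (suc j) - 1ℚ) + (m - k) * c ≡⟨ cong (λ x → (H (suc j) - 1ℚ) + (x - k) * c) (fromℕ-suc (suc j)) ⟩
    (H (suc j) - 1ℚ) + (1ℚ + k - k) * c ≡⟨ solve 3 (λ h k c → (h :- con 1ℚ) :+ (con 1ℚ :+ k :- k) :* c := (c :+ h) :- con 1ℚ) refl (H (suc j)) k c ⟩
    H (suc (suc j)) - 1ℚ       ∎
    where
    k = fromℕ (suc j)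
    m = fromℕ (suc (suc j))
    c = inv (suc (suc j))
    k≤m : k ≤ m
    k≤m = fromℕ-mono (ℕ.n≤1+n (suc j))

  -- The tolerance is there because a real inequality K ≤ y bounds K by the approximations of y only
  -- up to ε. From y to the larger of y and K the function `Λ j` grows by at most the distance, as
  -- its slope is at most 1 there. The number of subdivisions is free, so it can be the index of the
  -- approximation of `log`.
  H≤1+riemann : ∀ j n {y ε} → 0ℚ ≤ ε → 1ℚ ≤ y → fromℕ (suc j) ≤ y + ε → H (suc j) ≤ 1ℚ + riemann n 1ℚ y + ε
  H≤1+riemann j n {y} {ε} 0≤ε 1≤y K≤y+ε = begin
    H (suc j)                                      ≡⟨ solve 2 (λ h l → h := con 1ℚ :+ (l :- con 0ℚ) :+ ((h :- con 1ℚ) :- l)) refl (H (suc j)) (Λ j y) ⟩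
    1ℚ + (Λ j y - 0ℚ) + ((H (suc j) - 1ℚ) - Λ j y) ≡⟨ cong₂ (λ u v → 1ℚ + (Λ j y - u) + (v - Λ j y)) (Λ-1 j) (Λ-end j (p≤q⊔p y K)) ⟨
    1ℚ + (Λ j y - Λ j 1ℚ) + (Λ j t - Λ j y)        ≤⟨ +-mono-≤ (+-monoʳ-≤ 1ℚ (subLog≤riemann {Λ j} (Λ-subLog j) n 0<1 1≤y)) last ⟩
    1ℚ + riemann n 1ℚ y + ε ∎
    where
    K = fromℕ (suc j)
    t = y ⊔ K
    0<y = <-≤-trans 0<1 1≤y
    y≤t = p≤p⊔q y K
    last : Λ j t - Λ j y ≤ ε
    last = begin
      Λ j t - Λ j y     ≤⟨ Λ-subLog j 0<y y≤t ⟩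
      (t - y) * y ⁻¹    ≤⟨ *-monoˡ-≤-nonNeg (t - y) {{nonNegative (0≤b-a y≤t)}} (⁻¹-antimono {1ℚ} 0<1 1≤y) ⟩
      (t - y) * 1ℚ      ≡⟨ *-identityʳ (t - y) ⟩
      t - y             ≤⟨ +-monoˡ-≤ (- y) (⊔-lub (≤-trans (≤-reflexive (sym (+-identityʳ y))) (+-monoʳ-≤ y 0≤ε)) K≤y+ε) ⟩
      (y + ε) - y       ≡⟨ solve 2 (λ y e → (y :+ e) :- y := e) refl y ε ⟩
      ε                 ∎

-- Inequalities between reals from eventual inequalities between approximations

module RealBounds where

  open import Defs
  open Rational using (fromℕ; _⁻¹; ⁻¹-inverse; ⁻¹-pos; 0<½; archimedean)
  open import Data.Nat as ℕ using (ℕ; zero; suc)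
  import Data.Nat.Properties as ℕ
  open import Data.Rational as ℚ using (ℚ; ½; 0ℚ; 1ℚ)
  import Data.Rational.Properties as ℚ
  open import Data.Rational.Solver using (module +-*-Solver)
  open +-*-Solver
  open import Data.Product using (∃-syntax; _×_; _,_; proj₁; proj₂)
  open import Relation.Binary.PropositionalEquality
  open import Relation.Nullary using (contradiction)
  open RationalSums using (inv; inv-nonneg; inv-inverse; 0≤fromℕ)
  open Harmonic using (H; H-nonneg)
  open LogHarmonic using (H≤1+riemann)
  open ℚ.≤-Reasoning

  Eventually : (ℕ → Set) → Set
  Eventually P = ∃[ N ] ∀ n → N ℕ.≤ n → P n

  infixr 2 _&_
  _&_ : ∀ {P Q} → Eventually P → Eventually Q → Eventually (λ n → P n × Q n)
  (N , h) & (M , k) = N ℕ.⊔ M , λ n hn → h n (ℕ.m⊔n≤o⇒m≤o N M hn) , k n (ℕ.m⊔n≤o⇒n≤o N M hn)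

  eventually-map : ∀ {P Q : ℕ → Set} → (∀ {n} → P n → Q n) → Eventually P → Eventually Q
  eventually-map f (N , h) = N , λ n hn → f (h n hn)

  ι : ℚ → ℝ
  ι q = mkℝ (λ _ → q) (Rational.cauchy-const q)

  eventually≤⇒≤ : ∀ {x y} → Eventually (λ n → seq x n ℚ.≤ seq y n) → x ≤ y
  eventually≤⇒≤ {x} {y} (N , h) = mk≤ λ ε 0<ε → N , λ n hn →
    ℚ.≤-trans (ℚ.≤-trans (h n hn) (ℚ.≤-reflexive (sym (ℚ.+-identityʳ (seq y n))))) (ℚ.+-monoʳ-≤ (seq y n) (ℚ.<⇒≤ 0<ε))

  pointwise≤⇒≤ : ∀ {x y} → (∀ n → seq x n ℚ.≤ seq y n) → x ≤ y
  pointwise≤⇒≤ h = eventually≤⇒≤ (0 , λ n _ → h n)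

  <⇒eventually≤ : ∀ {x y} → x < y → Eventually (λ n → seq x n ℚ.≤ seq y n)
  <⇒eventually≤ {x} {y} (mk< δ 0<δ N h) = N , λ n hn → begin
    seq x n          ≡⟨ ℚ.+-identityʳ (seq x n) ⟨
    seq x n ℚ.+ 0ℚ   ≤⟨ ℚ.+-monoʳ-≤ (seq x n) (ℚ.<⇒≤ 0<δ) ⟩
    seq x n ℚ.+ δ    ≤⟨ h n hn ⟩
    seq y n          ∎

  <⇒≤ : ∀ {x y} → x < y → x ≤ y
  <⇒≤ {x} {y} x<y = eventually≤⇒≤ (<⇒eventually≤ {x} {y} x<y)

  private
    halves : ∀ ε → ½ ℚ.* ε ℚ.+ ½ ℚ.* ε ≡ ε
    halves = solve 1 (λ e → con ½ :* e :+ con ½ :* e := e) refl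

  ≤-trans : ∀ {x y z} → x ≤ y → y ≤ z → x ≤ z
  ≤-trans {x} {y} {z} (mk≤ h) (mk≤ k) = mk≤ λ ε 0<ε →
    let 0<ε/2 = Rational.*-pos 0<½ 0<ε in
    eventually-map (λ {n} (hn , kn) → begin
      seq x n                                  ≤⟨ hn ⟩
      seq y n ℚ.+ ½ ℚ.* ε                      ≤⟨ ℚ.+-monoˡ-≤ (½ ℚ.* ε) kn ⟩
      (seq z n ℚ.+ ½ ℚ.* ε) ℚ.+ ½ ℚ.* ε        ≡⟨ ℚ.+-assoc (seq z n) _ _ ⟩
      seq z n ℚ.+ (½ ℚ.* ε ℚ.+ ½ ℚ.* ε)        ≡⟨ cong (seq z n ℚ.+_) (halves ε) ⟩
      seq z n ℚ.+ ε                            ∎) (h _ 0<ε/2 & k _ 0<ε/2)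

  +-mono-≤ : ∀ {x y u v} → x ≤ y → u ≤ v → x + u ≤ y + v
  +-mono-≤ {x} {y} {u} {v} (mk≤ h) (mk≤ k) = mk≤ λ ε 0<ε →
    let 0<ε/2 = Rational.*-pos 0<½ 0<ε in
    eventually-map (λ {n} (hn , kn) → begin
      seq x n ℚ.+ seq u n                                          ≤⟨ ℚ.+-mono-≤ hn kn ⟩
      (seq y n ℚ.+ ½ ℚ.* ε) ℚ.+ (seq v n ℚ.+ ½ ℚ.* ε)              ≡⟨ solve 3 (λ y v h → (y :+ h) :+ (v :+ h) := (y :+ v) :+ (h :+ h)) refl (seq y n) (seq v n) (½ ℚ.* ε) ⟩
      (seq y n ℚ.+ seq v n) ℚ.+ (½ ℚ.* ε ℚ.+ ½ ℚ.* ε)              ≡⟨ cong (λ t → (seq y n ℚ.+ seq v n) ℚ.+ t) (halves ε) ⟩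
      (seq y n ℚ.+ seq v n) ℚ.+ ε                                  ∎) (h _ 0<ε/2 & k _ 0<ε/2)

  -- Stronger than a real inequality: the approximations themselves are eventually nonnegative, with
  -- no tolerance, so rational monotonicity applies termwise.
  NonNeg : ℝ → Set
  NonNeg x = Eventually (λ n → 0ℚ ℚ.≤ seq x n)

  -- Multiplication magnifies the tolerance by at most an eventual bound B of `x`, so the hypothesis
  -- is used at ε / B.
  *-monoˡ-≤ : ∀ {x u v} → NonNeg x → u ≤ v → x * u ≤ x * v
  *-monoˡ-≤ {x} {u} {v} x≥0 (mk≤ k) = let B , 0<B , bound = Rational.bounded {seq x} (cauchy x) in mk≤ λ ε 0<ε →
    eventually-map (λ {n} (0≤x , x≤B , kn) → begin
      seq x n ℚ.* seq u n                              ≤⟨ ℚ.*-monoˡ-≤-nonNeg (seq x n) {{ℚ.nonNegative 0≤x}} kn ⟩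
      seq x n ℚ.* (seq v n ℚ.+ B ⁻¹ ℚ.* ε)             ≡⟨ ℚ.*-distribˡ-+ (seq x n) (seq v n) _ ⟩
      seq x n ℚ.* seq v n ℚ.+ seq x n ℚ.* (B ⁻¹ ℚ.* ε) ≤⟨ ℚ.+-monoʳ-≤ (seq x n ℚ.* seq v n) (ℚ.*-monoʳ-≤-nonNeg (B ⁻¹ ℚ.* ε)
                                                            {{ℚ.nonNegative (ℚ.<⇒≤ (Rational.*-pos (⁻¹-pos 0<B) 0<ε))}} (ℚ.≤-trans (Rational.p≤∣p∣ (seq x n)) x≤B)) ⟩
      seq x n ℚ.* seq v n ℚ.+ B ℚ.* (B ⁻¹ ℚ.* ε)       ≡⟨ cong (λ t → seq x n ℚ.* seq v n ℚ.+ t) (trans (sym (ℚ.*-assoc B (B ⁻¹) ε))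
                                                            (trans (cong (ℚ._* ε) (⁻¹-inverse 0<B)) (ℚ.*-identityˡ ε))) ⟩
      seq x n ℚ.* seq v n ℚ.+ ε                        ∎)
      (x≥0 & bound & k (B ⁻¹ ℚ.* ε) (Rational.*-pos (⁻¹-pos 0<B) 0<ε))

  infix 4 _⊑_

  -- The relation 0 ≤ x ≤ y, which is compatible with addition and multiplication.
  record _⊑_ (x y : ℝ) : Set where
    constructor mk⊑
    field
      lower : NonNeg x
      upper : NonNeg y
      le    : x ≤ y
  open _⊑_ public

  +-nonneg : ∀ {x y} → NonNeg x → NonNeg y → NonNeg (x + y)
  +-nonneg h k = eventually-map (λ (a , b) → ℚ.+-mono-≤ a b) (h & k)

  *-nonneg : ∀ {x y} → NonNeg x → NonNeg y → NonNeg (x * y)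
  *-nonneg h k = eventually-map (λ (a , b) → Rational.*-nonneg a b) (h & k)

  +-⊑ : ∀ {x y u v} → x ⊑ y → u ⊑ v → x + u ⊑ y + v
  +-⊑ {x} {y} {u} {v} (mk⊑ a b h) (mk⊑ c d k) = mk⊑ (+-nonneg {x} {u} a c) (+-nonneg {y} {v} b d) (+-mono-≤ h k)

  *-⊑ : ∀ {x y u v} → x ⊑ y → u ⊑ v → x * u ⊑ y * v
  *-⊑ {x} {y} {u} {v} (mk⊑ a b h) (mk⊑ c d k) = mk⊑ (*-nonneg {x} {u} a c) (*-nonneg {y} {v} b d)
    (≤-trans (*-monoˡ-≤ a k) (≤-trans (swap x v) (≤-trans (*-monoˡ-≤ d h) (swap v y))))
    where
    swap : ∀ x y → x * y ≤ y * x
    swap x y = pointwise≤⇒≤ λ n → ℚ.≤-reflexive (ℚ.*-comm (seq x n) (seq y n))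

  0<⇒nonneg : ∀ {x} → # 0 < x → NonNeg x
  0<⇒nonneg {x} 0<x = <⇒eventually≤ {# 0} {x} 0<x

  ι-nonneg : ∀ {q} → 0ℚ ℚ.≤ q → NonNeg (ι q)
  ι-nonneg h = 0 , λ _ _ → h

  ⊑-refl : ∀ {x} → NonNeg x → x ⊑ x
  ⊑-refl h = mk⊑ h h (pointwise≤⇒≤ λ _ → ℚ.≤-refl)

  #-⊑ : ∀ {n x} → # n ≤ x → # 0 < x → # n ⊑ x
  #-⊑ {n} {x} h 0<x = mk⊑ (ι-nonneg (0≤fromℕ n)) (0<⇒nonneg {x} 0<x) h

  eventually-positive : ∀ {x} → # 0 < x → Eventually (λ n → 0ℚ ℚ.< seq x n)
  eventually-positive {x} 0<x = let δ , 0<δ , N , h = eventuallyPos {x} 0<x in N , λ n hn → ℚ.<-≤-trans 0<δ (h n hn)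

  /-nonneg : ∀ {x y} {{0<y : # 0 < y}} → NonNeg x → NonNeg (x / y)
  /-nonneg {x} {y} {{0<y}} x≥0 = eventually-map (λ (a , b) → Rational.*-nonneg a (ℚ.<⇒≤ (⁻¹-pos b))) (x≥0 & eventually-positive {y} 0<y)

  -- For T = 0 the approximations would eventually be at least δ and at most δ / 2. The result makes
  -- `inv T` a true reciprocal.
  positive≤#⇒nonZero : ∀ {T x} → # 0 < x → x ≤ # T → ℕ.NonZero T
  positive≤#⇒nonZero {suc T} _ _ = _
  positive≤#⇒nonZero {zero} {x} 0<x (mk≤ h) = contradiction (ℚ.<-≤-trans ½δ<δ δ≤½δ) (ℚ.<-irrefl refl)
    where
    δ = proj₁ (eventuallyPos {x} 0<x)
    0<δ = proj₁ (proj₂ (eventuallyPos {x} 0<x))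
    0<½δ = Rational.*-pos 0<½ 0<δ
    ½δ<δ : ½ ℚ.* δ ℚ.< δ
    ½δ<δ = begin-strict
      ½ ℚ.* δ              ≡⟨ ℚ.+-identityʳ _ ⟨
      ½ ℚ.* δ ℚ.+ 0ℚ       <⟨ ℚ.+-monoʳ-< (½ ℚ.* δ) 0<½δ ⟩
      ½ ℚ.* δ ℚ.+ ½ ℚ.* δ  ≡⟨ halves δ ⟩
      δ                    ∎
    both : Eventually (λ n → δ ℚ.≤ seq x n × seq x n ℚ.≤ 0ℚ ℚ.+ ½ ℚ.* δ)
    both = proj₂ (proj₂ (eventuallyPos {x} 0<x)) & h (½ ℚ.* δ) 0<½δ
    δ≤½δ : δ ℚ.≤ ½ ℚ.* δ
    δ≤½δ = let lo , hi = proj₂ both (proj₁ both) ℕ.≤-refl in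
      ℚ.≤-trans (ℚ.≤-trans lo hi) (ℚ.≤-reflexive (ℚ.+-identityˡ _))

  -- Inverting D ≤ T termwise would meet the tolerance; instead 1 / T is written as (1 / T)(1 / D) D
  -- and D is replaced by T, which cancels.
  inv≤1/ : ∀ {T D} .{{_ : ℕ.NonZero T}} {{0<D : # 0 < D}} → D ≤ # T → ι (inv T) ⊑ # 1 / D
  inv≤1/ {T} {D} {{_}} {{0<D}} D≤T = mk⊑ (ι-nonneg (inv-nonneg T)) 1/D≥0
    (≤-trans (eventually≤⇒≤ (eventually-map (λ {n} → to {n}) (eventually-positive {D} 0<D)))
      (≤-trans (le (*-⊑ {ι (inv T) * (# 1 / D)} (⊑-refl {ι (inv T) * (# 1 / D)} (*-nonneg {ι (inv T)} {# 1 / D} (ι-nonneg (inv-nonneg T)) 1/D≥0))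
          (mk⊑ {D} {# T} (0<⇒nonneg {D} 0<D) (ι-nonneg (0≤fromℕ T)) D≤T)))
        (pointwise≤⇒≤ from)))
    where
    1/D≥0 : NonNeg (# 1 / D)
    1/D≥0 = /-nonneg {# 1} {D} (ι-nonneg (0≤fromℕ 1))
    to : ∀ {n} → 0ℚ ℚ.< seq D n → inv T ℚ.≤ (inv T ℚ.* (fromℕ 1 ℚ.* seq D n ⁻¹)) ℚ.* seq D n
    to {n} 0<d = ℚ.≤-reflexive (begin-equality
      inv T                                      ≡⟨ ℚ.*-identityʳ (inv T) ⟨
      inv T ℚ.* 1ℚ                               ≡⟨ cong (inv T ℚ.*_) (⁻¹-inverse 0<d) ⟨
      inv T ℚ.* (seq D n ℚ.* seq D n ⁻¹)         ≡⟨ solve 3 (λ t d i → t :* (d :* i) := (t :* (con 1ℚ :* i)) :* d) refl (inv T) (seq D n) (seq D n ⁻¹) ⟩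
      (inv T ℚ.* (fromℕ 1 ℚ.* seq D n ⁻¹)) ℚ.* seq D n ∎)
    from : ∀ n → (inv T ℚ.* (fromℕ 1 ℚ.* seq D n ⁻¹)) ℚ.* fromℕ T ℚ.≤ fromℕ 1 ℚ.* seq D n ⁻¹
    from n = ℚ.≤-reflexive (begin-equality
      (inv T ℚ.* (fromℕ 1 ℚ.* seq D n ⁻¹)) ℚ.* fromℕ T ≡⟨ solve 3 (λ t i f → (t :* i) :* f := (f :* t) :* i) refl (inv T) (fromℕ 1 ℚ.* seq D n ⁻¹) (fromℕ T) ⟩
      (fromℕ T ℚ.* inv T) ℚ.* (fromℕ 1 ℚ.* seq D n ⁻¹) ≡⟨ cong (ℚ._* (fromℕ 1 ℚ.* seq D n ⁻¹)) (inv-inverse T) ⟩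
      1ℚ ℚ.* (fromℕ 1 ℚ.* seq D n ⁻¹)                  ≡⟨ ℚ.*-identityˡ _ ⟩
      fromℕ 1 ℚ.* seq D n ⁻¹                           ∎)

  log-nonneg : ∀ {y} {{0<y : # 0 < y}} → # 1 < y → NonNeg (log y)
  log-nonneg {y} 1<y = 0<⇒nonneg {log y} (log-pos {y} 1<y)

  H⊑1+log : ∀ {k y} {{0<y : # 0 < y}} → 1 ℕ.≤ k → # k ≤ y → # 1 < y → ι (H k) ⊑ # 1 + log y
  H⊑1+log {suc j} {y} _ (mk≤ h) 1<y = mk⊑ (ι-nonneg (H-nonneg (suc j)))
    (+-nonneg {# 1} {log y} (ι-nonneg (0≤fromℕ 1)) (log-nonneg {y} 1<y))
    (mk≤ λ ε 0<ε → let N , k = h ε 0<ε & <⇒eventually≤ {# 1} {y} 1<y in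
      N , λ n hn → H≤1+riemann j n (ℚ.<⇒≤ 0<ε) (proj₂ (k n hn)) (proj₁ (k n hn)))

  natural-above : ∀ {q} → 0ℚ ℚ.< q → ∃[ T ] q ℚ.≤ fromℕ T
  natural-above {q} 0<q with archimedean (⁻¹-pos 0<q)
  ... | M , invM≤invq = suc M , (begin
      q                                    ≡⟨ ℚ.*-identityʳ q ⟨
      q ℚ.* 1ℚ                             ≡⟨ cong (q ℚ.*_) (inv-inverse (suc M)) ⟨
      q ℚ.* (fromℕ (suc M) ℚ.* inv (suc M)) ≤⟨ ℚ.*-monoˡ-≤-nonNeg q {{ℚ.nonNegative (ℚ.<⇒≤ 0<q)}}
                                                (ℚ.*-monoˡ-≤-nonNeg (fromℕ (suc M)) {{ℚ.nonNegative (0≤fromℕ (suc M))}} invM≤invq) ⟩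
      q ℚ.* (fromℕ (suc M) ℚ.* q ⁻¹)       ≡⟨ solve 3 (λ b m i → b :* (m :* i) := m :* (b :* i)) refl q (fromℕ (suc M)) (q ⁻¹) ⟩
      fromℕ (suc M) ℚ.* (q ℚ.* q ⁻¹)       ≡⟨ cong (fromℕ (suc M) ℚ.*_) (⁻¹-inverse 0<q) ⟩
      fromℕ (suc M) ℚ.* 1ℚ                 ≡⟨ ℚ.*-identityʳ _ ⟩
      fromℕ (suc M)                        ∎)

  ∃-natural-above : ∀ x → ∃[ T ] x ≤ # T
  ∃-natural-above x =
    let B , 0<B , N , bound = Rational.bounded {seq x} (cauchy x)
        T , B≤T = natural-above 0<B
    in T , eventually≤⇒≤ (N , λ n hn → ℚ.≤-trans (Rational.p≤∣p∣ (seq x n)) (ℚ.≤-trans (bound n hn) B≤T))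

-- Comparison with the three terms of the constant, in the rationals

module TermBounds where

  open import Defs using (module Rational)
  open Rational using (fromℕ; _⁻¹; ⁻¹-inverse; ⁻¹-pos; *-mono; *-nonneg; *-pos; 0≤p*p; 0≤b-a; 0≤b-a⇒a≤b; zetaSum; zetaSum-mono; 0<1; fromℕ-pos)
  open import Data.Nat as ℕ using (ℕ)
  import Data.Nat.Properties as ℕ
  open import Data.Rational
  open import Data.Rational.Properties
  open import Data.Rational.Solver using (module +-*-Solver)
  open +-*-Solver
  open import Relation.Binary.PropositionalEquality
  open import Relation.Nullary.Decidable using (from-yes)
  open ≤-Reasoning

  private
    two four five six twelve : ℚ
    two    = fromℕ 2
    four   = fromℕ 4
    five   = fromℕ 5
    six    = fromℕ 6
    twelve = fromℕ 12

  -- (4 + ℓ)² - 12 (1 + ℓ) = (ℓ - 2)²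
  fourth-power-bound : ∀ {ℓ} → 0ℚ ≤ ℓ → let A = 1ℚ + ℓ; P = four + ℓ in
    (twelve * A) * (twelve * A) ≤ P * (P * (P * P))
  fourth-power-bound {ℓ} 0≤ℓ = begin
    (twelve * (1ℚ + ℓ)) * (twelve * (1ℚ + ℓ)) ≤⟨ *-mono 0≤12A 12A≤ 0≤12A 12A≤ ⟩
    ((four + ℓ) * (four + ℓ)) * ((four + ℓ) * (four + ℓ)) ≡⟨ solve 1 (λ p → (p :* p) :* (p :* p) := p :* (p :* (p :* p))) refl (four + ℓ) ⟩
    (four + ℓ) * ((four + ℓ) * ((four + ℓ) * (four + ℓ))) ∎
    where
    0≤12A : 0ℚ ≤ twelve * (1ℚ + ℓ)
    0≤12A = *-nonneg (<⇒≤ (fromℕ-pos 11)) (+-mono-≤ (<⇒≤ 0<1) 0≤ℓ)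
    12A≤ : twelve * (1ℚ + ℓ) ≤ (four + ℓ) * (four + ℓ)
    12A≤ = 0≤b-a⇒a≤b (begin
      0ℚ                                                   ≤⟨ 0≤p*p (ℓ - two) ⟩
      (ℓ - two) * (ℓ - two)                                ≡⟨ solve 1 (λ l → (l :- con two) :* (l :- con two) := (con four :+ l) :* (con four :+ l) :- con twelve :* (con 1ℚ :+ l)) refl ℓ ⟩
      (four + ℓ) * (four + ℓ) - twelve * (1ℚ + ℓ)          ∎)

  term₁ : ∀ {x} → 0ℚ < x → ∀ L² A → x * L² * (½ * A) ≡ (x * x) * (L² * (two * x) ⁻¹ * A)
  term₁ {x} 0<x L² A = begin-equality
    x * L² * (½ * A)               ≡⟨ *-identityʳ _ ⟨
    x * L² * (½ * A) * 1ℚ          ≡⟨ cong (λ t → x * L² * (½ * A) * t) (⁻¹-inverse (*-pos (fromℕ-pos 1) 0<x)) ⟨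
    x * L² * (½ * A) * (two * x * (two * x) ⁻¹)
      ≡⟨ solve 4 (λ x l a i → x :* l :* (con ½ :* a) :* (con two :* x :* i) := (x :* x) :* (l :* i :* a)) refl x L² A ((two * x) ⁻¹) ⟩
    (x * x) * (L² * (two * x) ⁻¹ * A) ∎

  -- By `fourth-power-bound`, P⁴ is at least 144 A². With z ≥ 1/6 the right-hand side is then at
  -- least A² B (5 + 2 B) / D, whose part 2 A² B² is the contribution of two distinct primes.
  term₃ : ∀ {D ℓ μ z} → 0ℚ < D → 0ℚ ≤ ℓ → 0ℚ ≤ μ → six ⁻¹ ≤ z →
    let A = 1ℚ + ℓ; B = 1ℚ + μ; P = four + ℓ in
    (1ℚ * D ⁻¹) * (B + ((B * A) * (B * A) + (B * A) * (B * A)))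
    ≤ 1ℚ * (twelve * D) ⁻¹ * B * (P * (P * (P * P))) * (five * twelve ⁻¹ + z * B)
  term₃ {D} {ℓ} {μ} {z} 0<D 0≤ℓ 0≤μ z≥ = begin
    (1ℚ * D ⁻¹) * (B + ((B * A) * (B * A) + (B * A) * (B * A)))
      ≡⟨ cong (λ i → (1ℚ * i) * (B + ((B * A) * (B * A) + (B * A) * (B * A)))) D⁻¹≡ ⟩
    (1ℚ * (twelve * j)) * (B + ((B * A) * (B * A) + (B * A) * (B * A)))
      ≡⟨ cong (_* E) (*-identityˡ (twelve * j)) ⟩
    twelve * j * E
      ≤⟨ *-monoˡ-≤-nonNeg (twelve * j) {{nonNegative (*-nonneg (<⇒≤ (fromℕ-pos 11)) 0≤j)}} E≤ ⟩
    twelve * j * (A * A * B * (five * 1ℚ + (1ℚ + 1ℚ) * B))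
      ≡⟨ cong₂ (λ u v → twelve * j * (A * A * B * (five * u + v * B))) 12/12 12/6 ⟨
    twelve * j * (A * A * B * (five * (twelve * twelve ⁻¹) + (twelve * six ⁻¹) * B))
      ≡⟨ solve 7 (λ t j a b f r s → t :* j :* (a :* a :* b :* (f :* (t :* r) :+ (t :* s) :* b))
           := j :* b :* ((t :* a) :* (t :* a)) :* (f :* r :+ s :* b)) refl twelve j A B five (twelve ⁻¹) (six ⁻¹) ⟩
    j * B * ((twelve * A) * (twelve * A)) * (five * twelve ⁻¹ + six ⁻¹ * B)
      ≤⟨ *-mono (*-nonneg 0≤jB (0≤p*p (twelve * A)))
           (*-monoˡ-≤-nonNeg (j * B) {{nonNegative 0≤jB}} (fourth-power-bound 0≤ℓ))
           (+-mono-≤ (from-yes (0ℚ ≤? five * twelve ⁻¹)) (*-nonneg (from-yes (0ℚ ≤? six ⁻¹)) 0≤B))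
           (+-monoʳ-≤ (five * twelve ⁻¹) (*-monoʳ-≤-nonNeg B {{nonNegative 0≤B}} z≥)) ⟩
    j * B * (P * (P * (P * P))) * (five * twelve ⁻¹ + z * B)
      ≡⟨ cong (λ i → i * B * (P * (P * (P * P))) * (five * twelve ⁻¹ + z * B)) (*-identityˡ j) ⟨
    1ℚ * j * B * (P * (P * (P * P))) * (five * twelve ⁻¹ + z * B) ∎
    where
    A = 1ℚ + ℓ
    B = 1ℚ + μ
    P = four + ℓ
    j = (twelve * D) ⁻¹
    E = B + ((B * A) * (B * A) + (B * A) * (B * A))
    12/12 : twelve * twelve ⁻¹ ≡ 1ℚ
    12/12 = refl
    12/6 : twelve * six ⁻¹ ≡ 1ℚ + 1ℚ
    12/6 = refl
    0<12D = *-pos (fromℕ-pos 11) 0<D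
    0≤j = <⇒≤ (⁻¹-pos 0<12D)
    0≤B : 0ℚ ≤ B
    0≤B = +-mono-≤ (<⇒≤ 0<1) 0≤μ
    0≤jB = *-nonneg 0≤j 0≤B
    1≤A : 1ℚ ≤ A
    1≤A = ≤-trans (≤-reflexive (sym (+-identityʳ 1ℚ))) (+-monoʳ-≤ 1ℚ 0≤ℓ)
    slack : 0ℚ ≤ five * (A * A) - 1ℚ
    slack = 0≤b-a (begin
      1ℚ              ≤⟨ from-yes (1ℚ ≤? five * (1ℚ * 1ℚ)) ⟩
      five * (1ℚ * 1ℚ) ≤⟨ *-monoˡ-≤-nonNeg five (*-mono (<⇒≤ 0<1) 1≤A (<⇒≤ 0<1) 1≤A) ⟩
      five * (A * A)  ∎)
    -- The difference of the sides is B (5 A² - 1): the summand 5/12 absorbs the term B of the case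
    -- P = Q, because A is at least 1.
    E≤ : E ≤ A * A * B * (five * 1ℚ + (1ℚ + 1ℚ) * B)
    E≤ = 0≤b-a⇒a≤b (begin
      0ℚ                                                   ≤⟨ *-nonneg 0≤B slack ⟩
      B * (five * (A * A) - 1ℚ)
        ≡⟨ solve 3 (λ f a b → b :* (f :* (a :* a) :- con 1ℚ)
             := a :* a :* b :* (f :* con 1ℚ :+ (con 1ℚ :+ con 1ℚ) :* b) :- (b :+ ((b :* a) :* (b :* a) :+ (b :* a) :* (b :* a)))) refl five A B ⟩
      A * A * B * (five * 1ℚ + (1ℚ + 1ℚ) * B) - E          ∎)
    D⁻¹≡ : D ⁻¹ ≡ twelve * j
    D⁻¹≡ = begin-equality
      D ⁻¹                    ≡⟨ *-identityʳ (D ⁻¹) ⟨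
      D ⁻¹ * 1ℚ               ≡⟨ cong (λ t → D ⁻¹ * t) (⁻¹-inverse 0<12D) ⟨
      D ⁻¹ * (twelve * D * j) ≡⟨ solve 3 (λ i d j → i :* (con twelve :* d :* j) := (d :* i) :* (con twelve :* j)) refl (D ⁻¹) D j ⟩
      (D * D ⁻¹) * (twelve * j) ≡⟨ cong (_* (twelve * j)) (⁻¹-inverse 0<D) ⟩
      1ℚ * (twelve * j)       ≡⟨ *-identityˡ _ ⟩
      twelve * j              ∎

  term₂ : ∀ {A m} → 0ℚ ≤ A → 0ℚ < m → 0ℚ ≤ two * (A * A) * m ⁻¹
  term₂ {A} 0≤A 0<m = *-nonneg (*-nonneg (<⇒≤ (fromℕ-pos 1)) (0≤p*p A)) (<⇒≤ (⁻¹-pos 0<m))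

  assemble : ∀ {x L² D m ℓ μ z} → 0ℚ < x → 0ℚ < D → 0ℚ < m → 0ℚ ≤ ℓ → 0ℚ ≤ μ → six ⁻¹ ≤ z →
    let A = 1ℚ + ℓ; B = 1ℚ + μ; P = four + ℓ in
    x * L² * (½ * A) + (x * x) * (1ℚ * D ⁻¹) * (B + ((B * A) * (B * A) + (B * A) * (B * A)))
    ≤ (x * x) * (L² * (two * x) ⁻¹ * A + two * (A * A) * m ⁻¹
        + 1ℚ * (twelve * D) ⁻¹ * B * (P * (P * (P * P))) * (five * twelve ⁻¹ + z * B))
  assemble {x} {L²} {D} {m} {ℓ} {μ} {z} 0<x 0<D 0<m 0≤ℓ 0≤μ z≥ = begin
    x * L² * (½ * A) + (x * x) * (1ℚ * D ⁻¹) * E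
      ≡⟨ cong₂ _+_ (term₁ 0<x L² A) (*-assoc (x * x) (1ℚ * D ⁻¹) E) ⟩
    (x * x) * t₁ + (x * x) * ((1ℚ * D ⁻¹) * E)
      -- The 0 holds the place of the second term of `C`.
      ≡⟨ solve 3 (λ y a b → y :* a :+ y :* b := y :* (a :+ con 0ℚ :+ b)) refl (x * x) t₁ ((1ℚ * D ⁻¹) * E) ⟩
    (x * x) * (t₁ + 0ℚ + (1ℚ * D ⁻¹) * E)
      ≤⟨ *-monoˡ-≤-nonNeg (x * x) {{nonNegative (0≤p*p x)}}
           (+-mono-≤ (+-monoʳ-≤ t₁ (term₂ (+-mono-≤ (<⇒≤ 0<1) 0≤ℓ) 0<m)) (term₃ 0<D 0≤ℓ 0≤μ z≥)) ⟩
    (x * x) * (t₁ + two * (A * A) * m ⁻¹ + 1ℚ * (twelve * D) ⁻¹ * B * (P * (P * (P * P))) * (five * twelve ⁻¹ + z * B)) ∎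
    where
    A = 1ℚ + ℓ
    B = 1ℚ + μ
    P = four + ℓ
    E = B + ((B * A) * (B * A) + (B * A) * (B * A))
    t₁ = L² * (two * x) ⁻¹ * A

  -- The threshold 4 is sharp: 1/8 + 1/27 is 35/216, just below 1/6, and adding 1/64 passes it.
  zeta3-bound : ∀ n → 4 ℕ.≤ n → six ⁻¹ ≤ zetaSum 3 n - 1ℚ
  zeta3-bound n 4≤n = begin
    six ⁻¹            ≤⟨ from-yes (six ⁻¹ ≤? zetaSum 3 4 - 1ℚ) ⟩
    zetaSum 3 4 - 1ℚ  ≤⟨ +-monoˡ-≤ (- 1ℚ) (subst (λ k → zetaSum 3 4 ≤ zetaSum 3 k) (ℕ.m∸n+n≡m 4≤n) (zetaSum-mono 3 (n ℕ.∸ 4) 4)) ⟩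
    zetaSum 3 n - 1ℚ  ∎

-- Natural parameters read off from a finite list of members

module Parameters where

  open import Defs
  open Rational using (fromℕ; fromℕ-mono)
  open import Data.Nat as ℕ using (ℕ; suc; s≤s; _⊔_; _⊓_)
  import Data.Nat.Properties as ℕ
  import Data.Nat.Divisibility as ℕ
  open import Data.Rational as ℚ using (ℚ; ½; 0ℚ; 1ℚ)
  import Data.Rational.Properties as ℚ
  open import Data.Rational.Solver using (module +-*-Solver)
  open import Data.List using (List; []; _∷_)
  open import Data.List.Membership.Propositional using (_∈_)
  open import Data.List.Relation.Unary.All as All using (All; []; _∷_)
  open import Data.List.Relation.Unary.Any using (here; there)
  open import Data.Product using (∃-syntax; _×_; _,_)
  open import Data.Sum using (_⊎_; inj₁; inj₂)
  open import Relation.Binary.PropositionalEquality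
  open Profile
  open RationalSums using (inv; inv-nonneg; inv-inverse; 0≤fromℕ; fromℕ-*)
  open Estimate using (Shape; square; twoPrimes)
  open RealBounds

  #-⊔ : ∀ {m n x} → # m ≤ x → # n ≤ x → # (m ⊔ n) ≤ x
  #-⊔ {m} {n} {x} hm hn with ℕ.⊔-sel m n
  ... | inj₁ e = subst (λ k → # k ≤ x) (sym e) hm
  ... | inj₂ e = subst (λ k → # k ≤ x) (sym e) hn

  #-⊓ : ∀ {m n x} → x ≤ # m → x ≤ # n → x ≤ # (m ⊓ n)
  #-⊓ {m} {n} {x} hm hn with ℕ.⊓-sel m n
  ... | inj₁ e = subst (λ k → x ≤ # k) (sym e) hm
  ... | inj₂ e = subst (λ k → x ≤ # k) (sym e) hn

  Shape-mono : ∀ {w L L′ K K′ T T′ n} → L ℕ.≤ L′ → K ℕ.≤ K′ → T′ ℕ.≤ T → Shape w L K T n → Shape w L′ K′ T′ n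
  Shape-mono L≤ K≤ T≤ (square p p>0 p≤L T≤p² p²∣n wp≤n) = square p p>0 (ℕ.≤-trans p≤L L≤) (ℕ.≤-trans T≤ T≤p²) p²∣n wp≤n
  Shape-mono L≤ K≤ T≤ (twoPrimes d u e v d>0 u>0 e>0 v>0 d≤K e≤K du≤L ev<du T≤duev pq∣n u∣ v∣ wde≤n) =
    twoPrimes d u e v d>0 u>0 e>0 v>0 (ℕ.≤-trans d≤K K≤) (ℕ.≤-trans e≤K K≤) (ℕ.≤-trans du≤L L≤) ev<du (ℕ.≤-trans T≤ T≤duev) pq∣n u∣ v∣ wde≤n

  -- Here d ≤ φ / f = (1 / f) L₁ (φ / L₁), and replacing φ / L₁ by its upper bound f leaves L₁.
  ratio-bound : ∀ {d f φₙ L₁} {{0<L₁ : # 0 < L₁}} → 0 ℕ.< f → d ℕ.* f ℕ.≤ φₙ → # φₙ / L₁ ≤ # f → # d ≤ L₁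
  ratio-bound {d} {f@(suc _)} {φₙ} {L₁} {{0<L₁}} _ df≤φ h =
    ≤-trans (eventually≤⇒≤ (eventually-map (λ {n} → expand {n}) (eventually-positive {L₁} 0<L₁)))
      (≤-trans (*-monoˡ-≤ {ι (inv f) * L₁} {# φₙ / L₁} {# f} (*-nonneg {ι (inv f)} {L₁} (ι-nonneg (inv-nonneg f)) (0<⇒nonneg {L₁} 0<L₁)) h)
        (pointwise≤⇒≤ {(ι (inv f) * L₁) * # f} {L₁} λ n → ℚ.≤-reflexive (collapse (seq L₁ n))))
    where
    open ℚ.≤-Reasoning
    open +-*-Solver
    expand : ∀ {n} → 0ℚ ℚ.< seq L₁ n → fromℕ d ℚ.≤ (inv f ℚ.* seq L₁ n) ℚ.* (fromℕ φₙ ℚ.* (seq L₁ n) Rational.⁻¹)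
    expand {n} 0<l = begin
      fromℕ d                                  ≡⟨ ℚ.*-identityʳ (fromℕ d) ⟨
      fromℕ d ℚ.* 1ℚ                           ≡⟨ cong (fromℕ d ℚ.*_) (inv-inverse f) ⟨
      fromℕ d ℚ.* (fromℕ f ℚ.* inv f)          ≡⟨ ℚ.*-assoc (fromℕ d) (fromℕ f) (inv f) ⟨
      fromℕ d ℚ.* fromℕ f ℚ.* inv f            ≡⟨ cong (ℚ._* inv f) (fromℕ-* d f) ⟨
      fromℕ (d ℕ.* f) ℚ.* inv f                ≤⟨ ℚ.*-monoʳ-≤-nonNeg (inv f) {{ℚ.nonNegative (inv-nonneg f)}} (fromℕ-mono df≤φ) ⟩
      fromℕ φₙ ℚ.* inv f                       ≡⟨ ℚ.*-identityʳ _ ⟨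
      fromℕ φₙ ℚ.* inv f ℚ.* 1ℚ                ≡⟨ cong (λ t → fromℕ φₙ ℚ.* inv f ℚ.* t) (Rational.⁻¹-inverse 0<l) ⟨
      fromℕ φₙ ℚ.* inv f ℚ.* (l ℚ.* l Rational.⁻¹) ≡⟨ solve 4 (λ p i l j → p :* i :* (l :* j) := (i :* l) :* (p :* j)) refl (fromℕ φₙ) (inv f) l (l Rational.⁻¹) ⟩
      (inv f ℚ.* l) ℚ.* (fromℕ φₙ ℚ.* l Rational.⁻¹) ∎
      where l = seq L₁ n
    collapse : ∀ l → (inv f ℚ.* l) ℚ.* fromℕ f ≡ l
    collapse l = begin-equality
      (inv f ℚ.* l) ℚ.* fromℕ f ≡⟨ solve 3 (λ i l f → (i :* l) :* f := (f :* i) :* l) refl (inv f) l (fromℕ f) ⟩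
      (fromℕ f ℚ.* inv f) ℚ.* l ≡⟨ cong (ℚ._* l) (inv-inverse f) ⟩
      1ℚ ℚ.* l                  ≡⟨ ℚ.*-identityˡ l ⟩
      l                         ∎

  square-gap : ∀ {L M p} → # 0 < L → M < # (p ℕ.* p) → M - # 2 * L ≤ # (p ℕ.* p)
  square-gap {L} {M} {p} 0<L M<p² = eventually≤⇒≤ (eventually-map (λ {n} (m≤ , 0≤l) → begin
    seq M n ℚ.- fromℕ 2 ℚ.* seq L n  ≤⟨ ℚ.+-monoʳ-≤ (seq M n) (ℚ.neg-antimono-≤ (Rational.*-nonneg (0≤fromℕ 2) 0≤l)) ⟩
    seq M n ℚ.+ 0ℚ                   ≡⟨ ℚ.+-identityʳ (seq M n) ⟩
    seq M n                          ≤⟨ m≤ ⟩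
    fromℕ (p ℕ.* p)                  ∎) (<⇒eventually≤ {M} {# (p ℕ.* p)} M<p² & 0<⇒nonneg {L} 0<L))
    where open ℚ.≤-Reasoning

  -- (P - 1)(Q - 1) = P Q - P - Q + 1 > M - 2 L
  product-gap : ∀ {L M s t} → # suc s ≤ L → t ℕ.≤ s → M < # (suc s ℕ.* suc t) → M - # 2 * L ≤ # (s ℕ.* t)
  product-gap {L} {M} {s} {t} (mk≤ P≤L) t≤s M<PQ = eventually≤⇒≤ (eventually-map (λ {n} (m≤ , p≤) → begin
    seq M n ℚ.- fromℕ 2 ℚ.* seq L n
      -- P ≤ L is known for approximations only up to a tolerance. Taking it as 1/2, once for P and
      -- once for Q, costs 1 in total, exactly the constant term of (P - 1)(Q - 1).
      ≡⟨ solve 2 (λ m l → m :- con (fromℕ 2) :* l := m :+ (con 1ℚ :- (l :+ con ½)) :- (l :+ con ½)) refl (seq M n) (seq L n) ⟩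
    seq M n ℚ.+ (1ℚ ℚ.- (seq L n ℚ.+ ½)) ℚ.- (seq L n ℚ.+ ½)
      ≤⟨ ℚ.+-mono-≤ (ℚ.+-mono-≤ m≤ (ℚ.+-monoʳ-≤ 1ℚ (ℚ.neg-antimono-≤ p≤)))
           (ℚ.neg-antimono-≤ (ℚ.≤-trans (fromℕ-mono (s≤s t≤s)) p≤)) ⟩
    fromℕ (suc s ℕ.* suc t) ℚ.+ (1ℚ ℚ.- fromℕ (suc s)) ℚ.- fromℕ (suc t)
      ≡⟨ cong₂ (λ a b → a ℚ.+ (1ℚ ℚ.- fromℕ (suc s)) ℚ.- b) (trans (fromℕ-* (suc s) (suc t)) (cong₂ ℚ._*_ (Rational.fromℕ-suc s) (Rational.fromℕ-suc t))) (Rational.fromℕ-suc t) ⟩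
    (1ℚ ℚ.+ fromℕ s) ℚ.* (1ℚ ℚ.+ fromℕ t) ℚ.+ (1ℚ ℚ.- fromℕ (suc s)) ℚ.- (1ℚ ℚ.+ fromℕ t)
      ≡⟨ cong (λ a → (1ℚ ℚ.+ fromℕ s) ℚ.* (1ℚ ℚ.+ fromℕ t) ℚ.+ (1ℚ ℚ.- a) ℚ.- (1ℚ ℚ.+ fromℕ t)) (Rational.fromℕ-suc s) ⟩
    (1ℚ ℚ.+ fromℕ s) ℚ.* (1ℚ ℚ.+ fromℕ t) ℚ.+ (1ℚ ℚ.- (1ℚ ℚ.+ fromℕ s)) ℚ.- (1ℚ ℚ.+ fromℕ t)
      ≡⟨ solve 2 (λ s t → (con 1ℚ :+ s) :* (con 1ℚ :+ t) :+ (con 1ℚ :- (con 1ℚ :+ s)) :- (con 1ℚ :+ t) := s :* t) refl (fromℕ s) (fromℕ t) ⟩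
    fromℕ s ℚ.* fromℕ t
      ≡⟨ fromℕ-* s t ⟨
    fromℕ (s ℕ.* t) ∎) (<⇒eventually≤ {M} {# (suc s ℕ.* suc t)} M<PQ & P≤L ½ Rational.0<½))
    where
    open ℚ.≤-Reasoning
    open +-*-Solver

  module _ {L₁ L M x : ℝ} {{0<L₁ : # 0 < L₁}} {{0<L : # 0 < L}} where

    record Bounds (X ℓ K T : ℕ) : Set where
      field
        X≤x  : # X ≤ x
        ℓ≤L  : # ℓ ≤ L
        K≤L₁ : # K ≤ L₁
        D≤T  : M - # 2 * L ≤ # T

    -- The real parameters cannot be rounded effectively, so every n supplies its own natural
    -- bounds, computed from its prime factors.
    LocalBounds : ℕ → Set
    LocalBounds n = ∃[ ℓ ] ∃[ K ] ∃[ T ] (# ℓ ≤ L × # K ≤ L₁ × M - # 2 * L ≤ # T × Shape F ℓ K T n)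

    largest-primes⇒LocalBounds : ∀ {n P Q} → 1 ℕ.< n → # φ n / L₁ ≤ # F n →
      (P ≡ Q × Square n P) ⊎ TwoPrimes n P Q → # P ≤ L → M < # (P ℕ.* Q) → LocalBounds n
    largest-primes⇒LocalBounds {n} {P} n>1 ratio (inj₁ (refl , sq)) P≤L M<PQ =
      -- There are no cofactors in this case, so 0 serves as the bound on them; the maximum with 10
      -- is taken when the list is assembled.
      P , 0 , P ℕ.* P , P≤L , <⇒≤ 0<L₁ , square-gap {L} {M} {P} 0<L M<PQ ,
      square P (ℕ.n≢0⇒n>0 λ { refl → ℕ.<⇒≢ (ℕ.<⇒≤ n>1) (sym (ℕ.0∣⇒≡0 P²∣n)) }) ℕ.≤-refl ℕ.≤-refl P²∣n FP≤n
      where open Square sq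
    largest-primes⇒LocalBounds {n} n>1 ratio (inj₂ record { d = d ; u = u ; e = e ; v = v ; d>0 = d>0 ; u>0 = u>0 ; e>0 = e>0 ; v>0 = v>0
        ; P≡ = refl ; Q≡ = refl ; Q<P = s≤s ev<du ; PQ∣n = PQ∣n ; u∣n-1 = u∣ ; v∣n-1 = v∣ ; Fde≤n = Fde≤n ; dF≤φ = dF≤φ ; eF≤φ = eF≤φ }) P≤L M<PQ =
      suc (d ℕ.* u) , d ⊔ e , d ℕ.* u ℕ.* (e ℕ.* v) , P≤L ,
      #-⊔ {d} {e} (ratio-bound {d} {F n} F>0 dF≤φ ratio) (ratio-bound {e} {F n} F>0 eF≤φ ratio) ,
      product-gap {L} {M} {d ℕ.* u} {e ℕ.* v} P≤L (ℕ.<⇒≤ ev<du) M<PQ ,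
      twoPrimes d u e v d>0 u>0 e>0 v>0 (ℕ.m≤m⊔n d e) (ℕ.m≤n⊔m d e) (ℕ.n≤1+n (d ℕ.* u)) ev<du ℕ.≤-refl PQ∣n u∣ v∣ Fde≤n
      where
      F>0 : 0 ℕ.< F n
      F>0 = F-positive n>1

    𝒩⇒LocalBounds : ∀ {n} → 𝒩 L₁ L M x n → 0 ℕ.< n × # n ≤ x × LocalBounds n
    𝒩⇒LocalBounds (_ , composite , n≤x , P≤L , M<PQ , ratio) =
      let n>1 , shape = largest-primes composite
      in ℕ.<⇒≤ n>1 , n≤x , largest-primes⇒LocalBounds n>1 ratio shape P≤L M<PQ

    CommonBounds : List ℕ → Set
    CommonBounds ns = ∃[ X ] ∃[ ℓ ] ∃[ K ] ∃[ T ] (Bounds X ℓ K T × 1 ℕ.≤ ℓ × 10 ℕ.≤ K ×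
      (∀ {n} → n ∈ ns → (0 ℕ.< n × n ℕ.≤ X) × Shape F ℓ K T n))

    -- Raising ℓ and K and lowering T preserves every `Shape`. A maximum or minimum is always one of
    -- its two arguments, so the comparison with the real parameter is inherited.
    extend : ∀ {n ns} → 0 ℕ.< n × # n ≤ x × LocalBounds n → CommonBounds ns → CommonBounds (n ∷ ns)
    extend {n} {ns} (n>0 , n≤x , ℓ′ , K′ , T′ , ℓ′≤L , K′≤L₁ , D≤T′ , shape) (X , ℓ , K , T , b , 1≤ℓ , 10≤K , shapes) =
      n ⊔ X , ℓ′ ⊔ ℓ , K′ ⊔ K , T′ ⊓ T ,
      record { X≤x = #-⊔ n≤x X≤x ; ℓ≤L = #-⊔ ℓ′≤L ℓ≤L ; K≤L₁ = #-⊔ K′≤L₁ K≤L₁ ; D≤T = #-⊓ D≤T′ D≤T } ,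
      ℕ.≤-trans 1≤ℓ (ℕ.m≤n⊔m ℓ′ ℓ) , ℕ.≤-trans 10≤K (ℕ.m≤n⊔m K′ K) , all
      where
      open Bounds b
      all : ∀ {m} → m ∈ n ∷ ns → (0 ℕ.< m × m ℕ.≤ n ⊔ X) × Shape F (ℓ′ ⊔ ℓ) (K′ ⊔ K) (T′ ⊓ T) m
      all (here refl) = (n>0 , ℕ.m≤m⊔n n X) , Shape-mono (ℕ.m≤m⊔n ℓ′ ℓ) (ℕ.m≤m⊔n K′ K) (ℕ.m⊓n≤m T′ T) shape
      all (there m∈)  = let (m>0 , m≤X) , s = shapes m∈ in
        (m>0 , ℕ.≤-trans m≤X (ℕ.m≤n⊔m n X)) , Shape-mono (ℕ.m≤n⊔m ℓ′ ℓ) (ℕ.m≤n⊔m K′ K) (ℕ.m⊓n≤n T′ T) s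

    common-bounds : # 10 < L₁ → # 1 < L → # 0 < x → ∀ {ns} → All (𝒩 L₁ L M x) ns → CommonBounds ns
    -- The starting values secure 1 ≤ ℓ and 10 ≤ K and are admissible because L > 1 and L₁ > 10; the
    -- latter is what brings in the tenth harmonic number. T starts at any natural above M - 2 L and
    -- can only decrease.
    common-bounds 10<L₁ 1<L 0<x [] = let T , D≤T = ∃-natural-above (M - # 2 * L) in 0 , 1 , 10 , T ,
      record { X≤x = <⇒≤ 0<x ; ℓ≤L = <⇒≤ 1<L ; K≤L₁ = <⇒≤ 10<L₁ ; D≤T = D≤T } , ℕ.≤-refl , ℕ.≤-refl , λ ()
    common-bounds 10<L₁ 1<L 0<x (n∈𝒩 ∷ ns∈𝒩) = extend (𝒩⇒LocalBounds n∈𝒩) (common-bounds 10<L₁ 1<L 0<x ns∈𝒩)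

-- Termwise comparison with x² C

module Comparison where

  open import Defs
  open Rational using (fromℕ)
  import Data.Rational as ℚ
  open ℚ using (½)
  open import Data.Product using (_,_)
  open RealBounds
  open TermBounds

  -- Real operations act on approximations termwise, so both sides unfold at each index to the two
  -- sides of `assemble`. What remains is that its positivity conditions hold eventually; the one
  -- for ζ(3) does from the fourth partial sum on.
  bound≤x²C : ∀ {L₁ L M x} {{0<L₁ : # 0 < L₁}} {{0<L : # 0 < L}} {{0<M : # 0 < M}} {{0<x : # 0 < x}}
    {{0<logM : # 0 < log M}} {{0<D : # 0 < M - # 2 * L}} → # 1 < L₁ → # 1 < L →
    let A = # 1 + log L₁; B = # 1 + log L in
    x * (L * L) * (ι ½ * A) + (x * x) * (# 1 / (M - # 2 * L)) * (B + ((B * A) * (B * A) + (B * A) * (B * A)))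
    ≤ x ^ 2 * C L₁ L M x
  bound≤x²C {L₁} {L} {M} {x} {{0<L₁}} {{0<L}} {{0<M}} {{0<x}} {{0<logM}} {{0<D}} 1<L₁ 1<L = eventually≤⇒≤
    (eventually-map (λ {n} (px , pD , pm , pℓ , pμ , pz) → assemble {seq x n} {seq L n ℚ.* seq L n} {seq M n ℚ.- fromℕ 2 ℚ.* seq L n} {seq M n ℚ.* seq (log M) n} px pD pm pℓ pμ pz)
      (eventually-positive {x} 0<x & eventually-positive {M - # 2 * L} 0<D & eventually-positive {M * log M} (*-pos {M} {log M} 0<M 0<logM)
       & log-nonneg {L₁} 1<L₁ & log-nonneg {L} 1<L & (4 , zeta3-bound)))

-- Passage from the natural parameters to the real ones

module FinalBound where

  open import Defs
  open Rational using (fromℕ)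
  open import Data.Nat as ℕ using (ℕ)
  import Data.Nat.Properties as ℕ
  open import Data.Nat.ListAction using (sum)
  open import Data.Rational as ℚ using (ℚ; ½)
  import Data.Rational.Properties as ℚ
  open import Data.List using (map)
  open import Data.List.Relation.Unary.Unique.Propositional using (Unique)
  open import Data.Product using (_,_; proj₁; proj₂)
  open import Relation.Binary.PropositionalEquality
  open RationalSums using (inv; ∑-fromℕ; fromℕ-*)
  open Harmonic using (H)
  open Estimate using (∑-shapes-bound)
  open RealBounds
  open Parameters
  open Comparison

  module _ {L₁ L M x : ℝ} {{0<L₁ : # 0 < L₁}} {{0<L : # 0 < L}} {{0<M : # 0 < M}} {{0<x : # 0 < x}}
    {{0<logM : # 0 < log M}} {{0<D : # 0 < M - # 2 * L}} (10<L₁ : # 10 < L₁) (1<L : # 1 < L) where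

    private
      1<L₁ : # 1 < L₁
      1<L₁ = fromℕ-≤ (ℕ.s≤s ℕ.z≤n) 10<L₁
      A = # 1 + log L₁
      B = # 1 + log L

    -- The expression is built from sums and products of nonnegative quantities, so each parameter
    -- may be replaced separately: X by x, ℓ by L, the harmonic sums by 1 + log, and 1 / T by 1 / (M
    -- - 2 L).
    bound-mono : ∀ {X ℓ K T} .{{_ : ℕ.NonZero T}} → Bounds {L₁} {L} {M} {x} X ℓ K T → 1 ℕ.≤ ℓ → 1 ℕ.≤ K →
      let a = ι (H K); b = ι (H ℓ) in
      # X * (# ℓ * # ℓ) * (ι ½ * a) + (# X * # X) * ι (inv T) * (b + ((b * a) * (b * a) + (b * a) * (b * a)))
      ≤ x * (L * L) * (ι ½ * A) + (x * x) * (# 1 / (M - # 2 * L)) * (B + ((B * A) * (B * A) + (B * A) * (B * A)))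
    bound-mono {X} {ℓ} {K} {T} bounds 1≤ℓ 1≤K = le
      (+-⊑ (*-⊑ (*-⊑ X⊑ (*-⊑ ℓ⊑ ℓ⊑)) (*-⊑ (⊑-refl {ι ½} (ι-nonneg (ℚ.<⇒≤ Rational.0<½))) a⊑))
           (*-⊑ (*-⊑ (*-⊑ X⊑ X⊑) T⊑) (+-⊑ b⊑ (+-⊑ (*-⊑ ba⊑ ba⊑) (*-⊑ ba⊑ ba⊑)))))
      where
      open Bounds bounds
      X⊑ : # X ⊑ x
      X⊑ = #-⊑ X≤x 0<x
      ℓ⊑ : # ℓ ⊑ L
      ℓ⊑ = #-⊑ ℓ≤L 0<L
      a⊑ : ι (H K) ⊑ A
      a⊑ = H⊑1+log {K} {L₁} 1≤K K≤L₁ 1<L₁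
      b⊑ : ι (H ℓ) ⊑ B
      b⊑ = H⊑1+log {ℓ} {L} 1≤ℓ ℓ≤L 1<L
      ba⊑ : ι (H ℓ) * ι (H K) ⊑ B * A
      ba⊑ = *-⊑ b⊑ a⊑
      T⊑ : ι (inv T) ⊑ # 1 / (M - # 2 * L)
      T⊑ = inv≤1/ D≤T

    common-bounds⇒sum-bound : ∀ {ns} → Unique ns → CommonBounds {L₁} {L} {M} {x} ns → # sum (map F ns) ≤ x ^ 2 * C L₁ L M x
    common-bounds⇒sum-bound {ns} unique (X , ℓ , K , T , bounds , 1≤ℓ , 10≤K , shapes) =
      -- Before the comparison all quantities are constant sequences, so the rational estimate is
      -- valid at every index.
      ≤-trans (pointwise≤⇒≤ λ _ → combinatorial)
        (≤-trans (bound-mono bounds 1≤ℓ (ℕ.≤-trans (ℕ.s≤s ℕ.z≤n) 10≤K)) (bound≤x²C {L₁} {L} {M} {x} 1<L₁ 1<L))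
      where
      instance
        T≢0 : ℕ.NonZero T
        T≢0 = positive≤#⇒nonZero 0<D (Bounds.D≤T bounds)
      E = H ℓ ℚ.+ ((H ℓ ℚ.* H K) ℚ.* (H ℓ ℚ.* H K) ℚ.+ (H ℓ ℚ.* H K) ℚ.* (H ℓ ℚ.* H K))
      B₁ = fromℕ X ℚ.* (fromℕ ℓ ℚ.* fromℕ ℓ) ℚ.* (½ ℚ.* H K)
      combinatorial : fromℕ (sum (map F ns)) ℚ.≤ B₁ ℚ.+ (fromℕ X ℚ.* fromℕ X) ℚ.* inv T ℚ.* E
      combinatorial = subst₂ ℚ._≤_ (∑-fromℕ F ns) (cong (λ y → B₁ ℚ.+ y ℚ.* inv T ℚ.* E) (fromℕ-* X X))
        (∑-shapes-bound F X ℓ K T unique (λ n∈ → proj₁ (shapes n∈)) 10≤K (λ n∈ → proj₂ (shapes n∈)))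

open import Defs
open import Data.Nat using (s≤s; z≤n)
open Parameters using (common-bounds)
open FinalBound using (common-bounds⇒sum-bound)

theorem4p3 : (L₁ L M x : ℝ)
    (10<L₁ : # 10 < L₁) (L₁<L : L₁ < L) (L<M/2 : L < M / # 2)
    (L²<x : L ^ 2 < x) (M<L² : M < L ^ 2) →
    let open Positivity 10<L₁ L₁<L L<M/2 L²<x M<L² in
    ∑[ 𝒩 L₁ L M x ] F ≤ x ^ 2 * C L₁ L M x
theorem4p3 L₁ L M x 10<L₁ L₁<L L<M/2 L²<x M<L² ns unique ns∈𝒩 =
  common-bounds⇒sum-bound 10<L₁ 1<L unique (common-bounds 10<L₁ 1<L 0<x ns∈𝒩)
  where
  open Positivity {L₁} {L} {M} {x} 10<L₁ L₁<L L<M/2 L²<x M<L²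
  1<L : # 1 < L
  1<L = <-trans (fromℕ-≤ (s≤s z≤n) 10<L₁) L₁<L
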